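{- The finite satisfiability problem and the infinite satisfiability problem for the prenex fragment $\mathsf{PRE}(\mathsf{SL}^1)$ of Separation Logic with one selector are both decidable.
   Context: Let $\mathsf{Var}$ be a countable set of variables and $k\geq 1$. Formulae of $\mathsf{SL}^k$ are given by the grammar $\varphi ::= \bot \mid \top \mid \mathsf{emp} \mid x\approx y \mid x\mapsto (y_1,\dots,y_k) \mid \varphi\wedge\varphi \mid \neg\varphi \mid \varphi * \varphi \mid \varphi \multimap \varphi \mid \exists x.\varphi$ with $x,y,y_i\in\mathsf{Var}$ ($\forall$, $\vee$, $\rightarrow$ are the usual abbreviations). An $\mathsf{SL}$-structure is a triple $(U,s,h)$ where $U$ is a countable set (the universe), $s:\mathsf{Var}\rightharpoonup U$ is a partial map (the store), and $h:U\rightharpoonup U^k$ is a partial map with finite domain (the heap). Two heaps are disjoint if their domains are disjoint; $h_1\uplus h_2$ denotes their union. Semantics: $(U,s,h)\models \mathsf{emp}$ iff $h$ is empty; $(U,s,h)\models x\mapsto(y_1,\dots,y_k)$ iff $h=\{s(x)\mapsto (s(y_1),\dots,s(y_k))\}$; $(U,s,h)\models\varphi_1*\varphi_2$ iff $h=h_1\uplus h_2$ for disjoint heaps $h_1,h_2$ with $(U,s,h_i)\models\varphi_i$ for $i=1,2$; $(U,s,h)\models \varphi_1\multimap\varphi_2$ iff for every heap $h'$ disjoint from $h$ with $(U,s,h')\models\varphi_1$ we have $(U,s,h'\uplus h)\models\varphi_2$; $x\approx y$, boolean connectives and $\exists x$ (ranging over $U$) have their usual meaning. A structure is finite iff $U$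 is finite, infinite otherwise. The finite (resp. infinite) satisfiability problem asks whether a given formula has a finite (resp. infinite) model. $\mathsf{PRE}(\mathsf{SL}^k)$ is the set of sentences $Q_1x_1\dots Q_nx_n.\phi$ with $Q_i\in\{\exists,\forall\}$ and $\phi$ a quantifier-free $\mathsf{SL}^k$ formula. -}

module Defs where

open import Data.Nat using (ℕ; _≟_)
open import Data.Fin using (Fin)
open import Data.Vec using (Vec; map)
open import Data.List using (List; []; _∷_)
open import Data.List.Membership.Propositional using (_∈_)
open import Data.Maybe using (Maybe; just; nothing)
open import Data.Product using (Σ; ∃; _×_; _,_)
open import Data.Sum using (_⊎_)
open import Data.Unit using (⊤)
open import Data.Empty using (⊥)
open import Relation.Nullary using (¬_; yes; no)
open import Relation.Binary.PropositionalEquality using (_≡_; _≢_)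
open import Function.Bundles using (_↔_)
open import Function.Definitions using (Injective)

Var : Set
Var = ℕ

data Form (k : ℕ) : Set where
  ⊥f ⊤f emp : Form k
  _≈f_  : Var → Var → Form k
  _↦f_  : Var → Vec Var k → Form k
  _∧f_  : Form k → Form k → Form k
  ¬f_   : Form k → Form k
  _*f_  : Form k → Form k → Form k
  _-*f_ : Form k → Form k → Form k
  ∃f    : Var → Form k → Form k

∀f : ∀ {k} → Var → Form k → Form k
∀f x φ = ¬f (∃f x (¬f φ))

Store : Set → Set
Store U = Var → Maybe U

_[_≔_] : ∀ {U} → Store U → Var → U → Store U
(s [ x ≔ u ]) y with y ≟ x
... | yes _ = just u
... | no  _ = s y

HasFiniteDomain : ∀ {U : Set} {k} → (U → Maybe (Vec U k)) → Set
HasFiniteDomain {U} h = Σ (List U) λ L → ∀ u → h u ≢ nothing → u ∈ L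

Heap : Set → ℕ → Set
Heap U k = Σ (U → Maybe (Vec U k)) HasFiniteDomain

app : ∀ {U k} → Heap U k → U → Maybe (Vec U k)
app (h , _) = h

Disjoint : ∀ {U k} → Heap U k → Heap U k → Set
Disjoint {U} h₁ h₂ = ∀ (u : U) → app h₁ u ≡ nothing ⊎ app h₂ u ≡ nothing

IsUnion : ∀ {U k} → Heap U k → Heap U k → Heap U k → Set
IsUnion {U} h h₁ h₂ =
  Disjoint h₁ h₂ ×
  (∀ (u : U) → (app h u ≡ app h₁ u × app h₂ u ≡ nothing)
             ⊎ (app h u ≡ app h₂ u × app h₁ u ≡ nothing))

_,_,_⊨_ : ∀ {k} (U : Set) → Store U → Heap U k → Form k → Set
U , s , h ⊨ ⊥f = ⊥
U , s , h ⊨ ⊤f = ⊤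
U , s , h ⊨ emp = ∀ u → app h u ≡ nothing
U , s , h ⊨ (x ≈f y) = Σ U λ a → s x ≡ just a × s y ≡ just a
U , s , h ⊨ (x ↦f ys) =
  Σ U λ a → Σ (Vec U _) λ vs →
    s x ≡ just a × map s ys ≡ map just vs ×
    app h a ≡ just vs × (∀ u → u ≢ a → app h u ≡ nothing)
U , s , h ⊨ (φ ∧f ψ) = (U , s , h ⊨ φ) × (U , s , h ⊨ ψ)
U , s , h ⊨ (¬f φ) = ¬ (U , s , h ⊨ φ)
U , s , h ⊨ (φ *f ψ) =
  Σ (Heap U _) λ h₁ → Σ (Heap U _) λ h₂ →
    IsUnion h h₁ h₂ × (U , s , h₁ ⊨ φ) × (U , s , h₂ ⊨ ψ)
U , s , h ⊨ (φ -*f ψ) =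
  ∀ (h' : Heap U _) → Disjoint h' h → (U , s , h' ⊨ φ) →
    ∀ (h'' : Heap U _) → IsUnion h'' h' h → U , s , h'' ⊨ ψ
U , s , h ⊨ (∃f x φ) = Σ U λ u → U , (s [ x ≔ u ]) , h ⊨ φ

data QF {k} : Form k → Set where
  qf-⊥ : QF ⊥f
  qf-⊤ : QF ⊤f
  qf-emp : QF emp
  qf-≈ : ∀ {x y} → QF (x ≈f y)
  qf-↦ : ∀ {x ys} → QF (x ↦f ys)
  qf-∧ : ∀ {φ ψ} → QF φ → QF ψ → QF (φ ∧f ψ)
  qf-¬ : ∀ {φ} → QF φ → QF (¬f φ)
  qf-* : ∀ {φ ψ} → QF φ → QF ψ → QF (φ *f ψ)
  qf-—* : ∀ {φ ψ} → QF φ → QF ψ → QF (φ -*f ψ)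

data Prenex {k} : Form k → Set where
  pre-qf : ∀ {φ} → QF φ → Prenex φ
  pre-∃  : ∀ {x φ} → Prenex φ → Prenex (∃f x φ)
  pre-∀  : ∀ {x φ} → Prenex φ → Prenex (∀f x φ)

data ScopedIn {k} : List Var → Form k → Set where
  sc-⊥ : ∀ {bs} → ScopedIn bs ⊥f
  sc-⊤ : ∀ {bs} → ScopedIn bs ⊤f
  sc-emp : ∀ {bs} → ScopedIn bs emp
  sc-≈ : ∀ {bs x y} → x ∈ bs → y ∈ bs → ScopedIn bs (x ≈f y)
  sc-↦ : ∀ {bs x ys} → x ∈ bs → (∀ i → Data.Vec.lookup ys i ∈ bs) → ScopedIn bs (x ↦f ys)
  sc-∧ : ∀ {bs φ ψ} → ScopedIn bs φ → ScopedIn bs ψ → ScopedIn bs (φ ∧f ψ)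
  sc-¬ : ∀ {bs φ} → ScopedIn bs φ → ScopedIn bs (¬f φ)
  sc-* : ∀ {bs φ ψ} → ScopedIn bs φ → ScopedIn bs ψ → ScopedIn bs (φ *f ψ)
  sc-—* : ∀ {bs φ ψ} → ScopedIn bs φ → ScopedIn bs ψ → ScopedIn bs (φ -*f ψ)
  sc-∃ : ∀ {bs x φ} → ScopedIn (x ∷ bs) φ → ScopedIn bs (∃f x φ)

Sentence : ∀ {k} → Form k → Set
Sentence φ = ScopedIn [] φ

PRE : (k : ℕ) → Form k → Set
PRE k φ = Prenex φ × Sentence φ

Countable : Set → Set
Countable U = Σ (U → ℕ) λ f → Injective _≡_ _≡_ f

IsFinite : Set → Set
IsFinite U = Σ ℕ λ n → Fin n ↔ U

IsInfinite : Set → Set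
IsInfinite U = ¬ IsFinite U

FinSat : ∀ {k} → Form k → Set₁
FinSat {k} φ = Σ Set λ U → Countable U × IsFinite U ×
  Σ (Store U) λ s → Σ (Heap U k) λ h → U , s , h ⊨ φ

InfSat : ∀ {k} → Form k → Set₁
InfSat {k} φ = Σ Set λ U → Countable U × IsInfinite U ×
  Σ (Store U) λ s → Σ (Heap U k) λ h → U , s , h ⊨ φ

{-# OPTIONS --safe #-}
-- On quantifier-free formulas a heap matters only through its pattern on the named locations and
-- through the numbers of anonymous allocated and anonymous free locations, both counted up to a
-- threshold. Hence an Ehrenfeucht–Fraïssé game on the partial function given by the heap, with these
-- data compared at its end, controls prenex sentences. Game equivalence is a congruence for
-- disjoint union and for adding an edge between named points, and it has finitely many classes. Every
-- finite partial function is built from single points by such operations with two names: while some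
-- location is unallocated there is one without predecessor, which can be removed and grafted back;
-- otherwise an edge is cut and closed again. So finitely many terms, found by saturation, represent
-- all finite partial functions up to the game. In an infinite universe the isolated locations are
-- replaced by a finite set as large as the number of rounds, while the number of free locations is
-- declared infinite.
module Submission where

open import Defs
open import Data.Nat using (ℕ; zero; suc; _+_; _*_; _∸_; _^_; _≤_; _<_; z≤n; s≤s; _⊓_; _⊔_)
import Data.Nat as ℕ
open import Data.Nat.ListAction using (sum)
import Data.Nat.Properties as ℕₚ
open import Data.Fin using (Fin; zero; suc; toℕ; splitAt; _↑ˡ_; _↑ʳ_; punchIn; punchOut; combine; funToFin; finToFun)
import Data.Fin as Fin
import Data.Fin.Properties as Finₚ
open import Data.Bool using (Bool; true; false; if_then_else_)
open import Data.Vec using (Vec; []; _∷_)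
import Data.Vec as Vec
import Data.Vec.Properties as Vecₚ
open import Data.List using (List; []; _∷_; _++_; length; filter; deduplicate; take; allFin)
import Data.List as List
import Data.List.Properties as Listₚ
open import Data.List.Relation.Unary.Any using (here; there)
import Data.List.Relation.Unary.Any as Any
import Data.List.Relation.Unary.Any.Properties as Anyₚ
open import Data.List.Relation.Unary.All using (All; []; _∷_)
import Data.List.Relation.Unary.All as All
import Data.List.Relation.Unary.All.Properties as Allₚ
open import Data.List.Relation.Unary.AllPairs using ([]; _∷_)
open import Data.List.Relation.Unary.Unique.Propositional using (Unique)
import Data.List.Relation.Unary.Unique.Propositional.Properties as Uniqueₚ
import Data.List.Relation.Unary.Unique.DecPropositional.Properties as DecUniqueₚ
open import Data.List.Membership.Propositional using (_∈_; _∉_; find; lose)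
import Data.List.Membership.Propositional.Properties as ∈ₚ
open import Data.Maybe using (Maybe; just; nothing; _<∣>_)
import Data.Maybe as Maybe
import Data.Maybe.Properties as Maybeₚ
open import Data.Product using (Σ; _×_; _,_; proj₁; proj₂; -,_)
import Data.Product as Product
open import Data.Sum using (_⊎_; inj₁; inj₂; [_,_]; [_,_]′)
import Data.Sum as Sum
import Data.Sum.Properties as Sumₚ
open import Data.Unit using (⊤; tt)
open import Data.Empty using (⊥; ⊥-elim)
open import Function using (_∘_; id; case_of_)
open import Function.Bundles using (_↔_; Inverse; mk↔ₛ′)
open import Function.Definitions using (Injective)
open import Relation.Nullary using (¬_; Dec; yes; no; contradiction)
open import Relation.Nullary.Decidable using (¬?; _×-dec_; _⊎-dec_; _→-dec_; map′; decidable-stable; False; toWitnessFalse; fromWitnessFalse)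
open import Relation.Unary using (Decidable; _≐_)
open import Relation.Binary using (DecidableEquality)
open import Relation.Binary.PropositionalEquality using (_≡_; _≢_; refl; sym; trans; cong; subst; subst₂)

-- The values of anonymous cells can be forgotten because a quantifier-free formula reads a value
-- only by comparing it with a named location; following an anonymous edge takes a quantifier, and a
-- game round pays for it. The single selector matters when heaps are generated: a partial self-map
-- has at most one edge per location, so a missing cell leaves fewer edges than locations. Two
-- points per term suffice because an edge into an unnamed location is not added at the root but
-- pushed down into the term.
--
-- The obstacle is the infinite universe. Infinity is given only as the negation of finiteness, so
-- fresh elements exist merely under double negation, and satisfaction there comes without a
-- decision procedure. Hence formulas are evaluated through abstract states, and game answers live
-- in a modality: double negation for completeness on infinite models, the identity where an actual
-- model has to be produced. The double negation is removed at the end, since the search through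
-- finitely many codes is decidable.

variable
  A B : Set
  P Q R : A → Set

-- Exact counting of decidable subsets

Unique-⊆⇒length≤ : ∀ {xs ys : List A} → Unique xs → (∀ {x} → x ∈ xs → x ∈ ys) → length xs ≤ length ys
Unique-⊆⇒length≤ {xs = []} _ _ = z≤n
Unique-⊆⇒length≤ {xs = x ∷ xs} {ys} u@(_ ∷ uxs) sub with ∈ₚ.∈-∃++ (sub (here refl))
... | as , bs , refl = ℕₚ.≤-trans (s≤s (Unique-⊆⇒length≤ {ys = as ++ bs} uxs sub′)) (ℕₚ.≤-reflexive (sym eq))
  where
  eq : length (as ++ x ∷ bs) ≡ suc (length (as ++ bs))
  eq rewrite Listₚ.length-++ as {x ∷ bs} | Listₚ.length-++ as {bs} = ℕₚ.+-suc (length as) (length bs)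
  sub′ : ∀ {z} → z ∈ xs → z ∈ as ++ bs
  sub′ z∈ with ∈ₚ.∈-++⁻ as (sub (there z∈))
  ... | inj₁ p = ∈ₚ.∈-++⁺ˡ p
  ... | inj₂ (here refl) = contradiction z∈ (Uniqueₚ.Unique[x∷xs]⇒x∉xs u)
  ... | inj₂ (there p) = ∈ₚ.∈-++⁺ʳ as p

-- Cardinality as a relation, witnessed by an enumeration without repetition: counts of the same set
-- obtained in different ways are later identified by `Cnt-unique`.
record Cnt {A : Set} (P : A → Set) (k : ℕ) : Set where
  constructor mkCnt
  field
    elems    : List A
    unique   : Unique elems
    sound    : ∀ {x} → x ∈ elems → P x
    complete : ∀ {x} → P x → x ∈ elems
    size     : length elems ≡ k
open Cnt public

Cnt-resp : ∀ {k} → P ≐ Q → Cnt P k → Cnt Q k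
Cnt-resp (to , from) (mkCnt xs u s c l) = mkCnt xs u (to ∘ s) (c ∘ from) l

Cnt-unique : ∀ {k l} → Cnt P k → Cnt P l → k ≡ l
Cnt-unique C D = trans (sym (size C)) (trans (ℕₚ.≤-antisym (le C D) (le D C)) (size D))
  where
  le : ∀ {k l} (C : Cnt P k) (D : Cnt P l) → length (elems C) ≤ length (elems D)
  le C D = Unique-⊆⇒length≤ (unique C) (complete D ∘ sound C)

Cnt-∅ : (∀ {x} → ¬ P x) → Cnt P 0
Cnt-∅ ¬p = mkCnt [] [] (λ ()) (λ p → ⊥-elim (¬p p)) refl

Cnt-0 : Cnt P 0 → ∀ {x} → ¬ P x
Cnt-0 (mkCnt [] _ _ c _) p with c p
... | ()

Cnt-suc : ∀ {k} → Cnt P (suc k) → Σ A P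
Cnt-suc (mkCnt (x ∷ _) _ s _ _) = x , s (here refl)

Cnt-filter : ∀ {k} → Decidable Q → Cnt P k → Σ ℕ (Cnt (λ x → P x × Q x))
Cnt-filter Q? (mkCnt xs u s c _) = -, mkCnt (filter Q? xs) (Uniqueₚ.filter⁺ Q? u)
  (λ p → let q = ∈ₚ.∈-filter⁻ Q? {xs = xs} p in s (proj₁ q) , proj₂ q)
  (λ p → ∈ₚ.∈-filter⁺ Q? (c (proj₁ p)) (proj₂ p)) refl

Cnt-cover : DecidableEquality A → Decidable P → (xs : List A) → (∀ {x} → P x → x ∈ xs) → Σ ℕ (Cnt P)
Cnt-cover _≟_ P? xs cov = Product.map₂ (Cnt-resp (proj₂ , λ p → cov p , p))
  (Cnt-filter P? (mkCnt (deduplicate _≟_ xs) (DecUniqueₚ.deduplicate-! _≟_ xs)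
    (∈ₚ.∈-deduplicate⁻ _≟_ xs) (∈ₚ.∈-deduplicate⁺ _≟_) refl))

Cnt-⊎ : ∀ {k l} → (∀ {x} → P x → Q x → ⊥) → Cnt P k → Cnt Q l → Cnt (λ x → P x ⊎ Q x) (k + l)
Cnt-⊎ dis (mkCnt xs u s c refl) (mkCnt ys v t d refl) =
  mkCnt (xs ++ ys) (Uniqueₚ.++⁺ u v (λ (p , q) → dis (s p) (t q)))
    (Sum.map s t ∘ ∈ₚ.∈-++⁻ xs) [ ∈ₚ.∈-++⁺ˡ ∘ c , ∈ₚ.∈-++⁺ʳ xs ∘ d ] (Listₚ.length-++ xs)

dec-⊎ : Decidable Q → P ≐ (λ x → (P x × Q x) ⊎ (P x × ¬ Q x))
dec-⊎ {Q = Q} {P = P} Q? = to , [ proj₁ , proj₁ ]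
  where
  to : ∀ {x} → P x → (P x × Q x) ⊎ (P x × ¬ Q x)
  to {x} p with Q? x
  ... | yes q = inj₁ (p , q)
  ... | no ¬q = inj₂ (p , ¬q)

≐-sym : P ≐ Q → Q ≐ P
≐-sym (f , g) = g , f

Cnt-split : ∀ {k} → Decidable Q → Cnt P k →
  Σ ℕ λ a → Σ ℕ λ b → k ≡ a + b × Cnt (λ x → P x × Q x) a × Cnt (λ x → P x × ¬ Q x) b
Cnt-split Q? C with Cnt-filter Q? C | Cnt-filter (¬? ∘ Q?) C
... | a , Ca | b , Cb = a , b ,
  Cnt-unique C (Cnt-resp (≐-sym (dec-⊎ Q?)) (Cnt-⊎ (λ p q → proj₂ q (proj₂ p)) Ca Cb)) , Ca , Cb

-- Anonymous locations are interchangeable for quantifier-free formulas, so any subset of the right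
-- size will do. It is returned as a list to keep membership in it decidable.
Cnt-choose : ∀ {a b} → DecidableEquality A → {P : A → Set} → Cnt P (a + b) →
  Σ (List A) λ ys → Cnt (λ x → P x × x ∈ ys) a × Cnt (λ x → P x × x ∉ ys) b
Cnt-choose {A} {a} {b} _≟_ {P} C@(mkCnt xs u s c l) = take a xs , Ca , Cb
  where
  open import Data.List.Membership.DecPropositional _≟_ using (_∈?_)
  take⊆ : ∀ n (ys : List A) {x} → x ∈ take n ys → x ∈ ys
  take⊆ (suc n) (y ∷ ys) (here e) = here e
  take⊆ (suc n) (y ∷ ys) (there p) = there (take⊆ n ys p)
  Ca : Cnt (λ x → P x × x ∈ take a xs) a
  Ca = mkCnt (take a xs) (Uniqueₚ.take⁺ a u) (λ p → s (take⊆ a xs p) , p) proj₂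
    (trans (Listₚ.length-take a xs) (ℕₚ.m≤n⇒m⊓n≡m (ℕₚ.≤-trans (ℕₚ.m≤m+n a b) (ℕₚ.≤-reflexive (sym l)))))
  Cb : Cnt (λ x → P x × x ∉ take a xs) b
  Cb with Cnt-split (_∈? take a xs) C
  ... | a′ , b′ , e , Ca′ , Cb′ rewrite Cnt-unique Ca′ Ca = subst (Cnt _) (sym (ℕₚ.+-cancelˡ-≡ a _ _ e)) Cb′

Cnt-map : ∀ {k} (f : A → B) → (∀ {x y} → f x ≡ f y → x ≡ y) → Cnt P k → Cnt (λ y → Σ A λ x → P x × f x ≡ y) k
Cnt-map f inj (mkCnt xs u s c l) = mkCnt (List.map f xs) (Uniqueₚ.map⁺ inj u)
  (λ p → let (x , x∈ , e) = ∈ₚ.∈-map⁻ f p in x , s x∈ , sym e)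
  (λ { (x , p , refl) → ∈ₚ.∈-map⁺ f (c p) }) (trans (Listₚ.length-map f xs) l)

-- Thresholds

data ℕ∞ : Set where
  fin : ℕ → ℕ∞
  ∞   : ℕ∞

infixr 6 _⊞_ _⊕_
_⊞_ : ℕ → ℕ∞ → ℕ∞
a ⊞ fin b = fin (a + b)
a ⊞ ∞ = ∞

_⊕_ : ℕ∞ → ℕ∞ → ℕ∞
fin a ⊕ r = a ⊞ r
∞ ⊕ _ = ∞

data _≈[_]_ (k N l : ℕ) : Set where
  same : k ≡ l → k ≈[ N ] l
  big  : N ≤ k → N ≤ l → k ≈[ N ] l

data _≈∞[_]_ : ℕ∞ → ℕ → ℕ∞ → Set where
  fin : ∀ {k N l} → k ≈[ N ] l → fin k ≈∞[ N ] fin l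
  ∞   : ∀ {N} → ∞ ≈∞[ N ] ∞

≈-sym : ∀ {k N l} → k ≈[ N ] l → l ≈[ N ] k
≈-sym (same e) = same (sym e)
≈-sym (big p q) = big q p

≈∞-sym : ∀ {k N l} → k ≈∞[ N ] l → l ≈∞[ N ] k
≈∞-sym (fin e) = fin (≈-sym e)
≈∞-sym ∞ = ∞

≈-trans : ∀ {k N l m} → k ≈[ N ] l → l ≈[ N ] m → k ≈[ N ] m
≈-trans (same refl) q = q
≈-trans (big p q) (same refl) = big p q
≈-trans (big p q) (big _ r) = big p r

≈∞-trans : ∀ {k N l m} → k ≈∞[ N ] l → l ≈∞[ N ] m → k ≈∞[ N ] m
≈∞-trans (fin p) (fin q) = fin (≈-trans p q)
≈∞-trans ∞ ∞ = ∞

≈∞-refl : ∀ {r N} → r ≈∞[ N ] r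
≈∞-refl {fin _} = fin (same refl)
≈∞-refl {∞} = ∞

≈-mono : ∀ {k l M N} → M ≤ N → k ≈[ N ] l → k ≈[ M ] l
≈-mono _ (same e) = same e
≈-mono le (big p q) = big (ℕₚ.≤-trans le p) (ℕₚ.≤-trans le q)

≈∞-mono : ∀ {k l M N} → M ≤ N → k ≈∞[ N ] l → k ≈∞[ M ] l
≈∞-mono le (fin e) = fin (≈-mono le e)
≈∞-mono le ∞ = ∞

≈-+ : ∀ {k l k′ l′ N} → k ≈[ N ] l → k′ ≈[ N ] l′ → (k + k′) ≈[ N ] (l + l′)
≈-+ (same refl) (same refl) = same refl
≈-+ {k} {l} {k′} {l′} (same _) (big p q) = big (ℕₚ.≤-trans p (ℕₚ.m≤n+m k′ k)) (ℕₚ.≤-trans q (ℕₚ.m≤n+m l′ l))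
≈-+ {k} {l} {k′} {l′} (big p q) _ = big (ℕₚ.≤-trans p (ℕₚ.m≤m+n k k′)) (ℕₚ.≤-trans q (ℕₚ.m≤m+n l l′))

≈-⊞ : ∀ {k l r r′ N} → k ≈[ N ] l → r ≈∞[ N ] r′ → (k ⊞ r) ≈∞[ N ] (l ⊞ r′)
≈-⊞ p (fin q) = fin (≈-+ p q)
≈-⊞ p ∞ = ∞

≈-⊕ : ∀ {k l r r′ N} → k ≈∞[ N ] l → r ≈∞[ N ] r′ → (k ⊕ r) ≈∞[ N ] (l ⊕ r′)
≈-⊕ (fin p) q = ≈-⊞ p q
≈-⊕ ∞ _ = ∞

≈-0 : ∀ {k N} → 1 ≤ N → 0 ≈[ N ] k → k ≡ 0
≈-0 _ (same e) = sym e
≈-0 (s≤s _) (big () _)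

≈∞-0 : ∀ {r N} → 1 ≤ N → fin 0 ≈∞[ N ] r → r ≡ fin 0
≈∞-0 le (fin e) = cong fin (≈-0 le e)

-- The smaller part of a large total is copied exactly; one of the two parts is large.
≈-split : ∀ {N} a b {k} → (a + b) ≈[ N + N ] k →
  Σ ℕ λ a′ → Σ ℕ λ b′ → k ≡ a′ + b′ × a ≈[ N ] a′ × b ≈[ N ] b′
≈-split a b (same refl) = a , b , refl , same refl , same refl
≈-split {N} a b {k} (big p q) with N ℕ.≤? a | N ℕ.≤? b
... | yes N≤a | yes N≤b = N , k ∸ N , sym (ℕₚ.m+[n∸m]≡n N≤k) , big N≤a ℕₚ.≤-refl , big N≤b (ℕₚ.m+n≤o⇒m≤o∸n N q)
  where N≤k = ℕₚ.≤-trans (ℕₚ.m≤m+n N N) q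
... | no N≰a | _ = a , k ∸ a , sym (ℕₚ.m+[n∸m]≡n a≤k) , same refl ,
    big (ℕₚ.+-cancelˡ-≤ N _ _ (ℕₚ.≤-trans p (ℕₚ.+-monoˡ-≤ b a≤N))) (ℕₚ.m+n≤o⇒m≤o∸n N (ℕₚ.≤-trans (ℕₚ.+-monoʳ-≤ N a≤N) q))
  where
  a≤N = ℕₚ.<⇒≤ (ℕₚ.≰⇒> N≰a)
  a≤k = ℕₚ.≤-trans a≤N (ℕₚ.≤-trans (ℕₚ.m≤m+n N N) q)
... | yes _ | no N≰b = k ∸ b , b , sym (ℕₚ.m∸n+n≡m b≤k) ,
    big (ℕₚ.+-cancelʳ-≤ N _ _ (ℕₚ.≤-trans p (ℕₚ.+-monoʳ-≤ a b≤N))) (ℕₚ.m+n≤o⇒m≤o∸n N (ℕₚ.≤-trans (ℕₚ.+-monoʳ-≤ N b≤N) q)) , same refl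
  where
  b≤N = ℕₚ.<⇒≤ (ℕₚ.≰⇒> N≰b)
  b≤k = ℕₚ.≤-trans b≤N (ℕₚ.≤-trans (ℕₚ.m≤m+n N N) q)

≈∞-split : ∀ {N} a r {s} → (a ⊞ r) ≈∞[ N + N ] s →
  Σ ℕ λ a′ → Σ ℕ∞ λ r′ → s ≡ a′ ⊞ r′ × a ≈[ N ] a′ × r ≈∞[ N ] r′
≈∞-split a (fin b) (fin e) with ≈-split a b e
... | a′ , b′ , e′ , p , q = a′ , fin b′ , cong fin e′ , p , fin q
≈∞-split a ∞ ∞ = a , ∞ , refl , same refl , ∞

-- Abstract states of the quantifier-free fragment

-- Exhaustive search replaces an explicit enumeration: it passes directly to sums, vectors and
-- `Maybe`, hence to patterns and to the carriers of terms.
Searchable : Set → Set₁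
Searchable A = ∀ {P : A → Set} → Decidable P → Dec (Σ A P)

search-Maybe : Searchable A → Searchable (Maybe A)
search-Maybe s P? = map′ [ (nothing ,_) , (λ (a , p) → just a , p) ]
  (λ { (nothing , p) → inj₁ p ; (just a , p) → inj₂ (a , p) }) (P? nothing ⊎-dec s (P? ∘ just))

search-Vec : Searchable A → ∀ n → Searchable (Vec A n)
search-Vec s zero P? = map′ ([] ,_) (λ { ([] , p) → p }) (P? [])
search-Vec s (suc n) P? = map′ (λ (a , as , p) → a ∷ as , p) (λ { (a ∷ as , p) → a , as , p })
  (s (λ a → search-Vec s n (P? ∘ (a ∷_))))

search-Fin : ∀ {n} → Searchable (Fin n)
search-Fin = Finₚ.any?

Dec-∀ : {P : A → Set} → Searchable A → Decidable P → Dec (∀ a → P a)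
Dec-∀ s P? = map′ (λ ¬∃ a → decidable-stable (P? a) (λ ¬p → ¬∃ (a , ¬p))) (λ ∀p (a , ¬p) → ¬p (∀p a)) (¬? (s (¬? ∘ P?)))

Dec-∃+ : {P : ℕ → ℕ → Set} → (∀ a b → Dec (P a b)) → ∀ k → Dec (Σ ℕ λ a → Σ ℕ λ b → k ≡ a + b × P a b)
Dec-∃+ P? zero = map′ (λ p → 0 , 0 , refl , p) (λ { (zero , zero , _ , p) → p }) (P? 0 0)
Dec-∃+ P? (suc k) = map′
  [ (λ p → 0 , suc k , refl , p) , (λ (a , b , e , p) → suc a , b , cong suc e , p) ]
  (λ { (zero , b , refl , p) → inj₁ p ; (suc a , b , e , p) → inj₂ (a , b , ℕₚ.suc-injective e , p) })
  (P? 0 (suc k) ⊎-dec Dec-∃+ (P? ∘ suc) k)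

Dec-∀≤ : {P : ℕ → Set} → Decidable P → ∀ k → Dec (∀ a → a ≤ k → P a)
Dec-∀≤ {P} P? k = map′ (λ f a a≤k → subst P (Finₚ.toℕ-fromℕ< (s≤s a≤k)) (f (Fin.fromℕ< (s≤s a≤k))))
  (λ f i → f (toℕ i) (ℕₚ.≤-pred (Finₚ.toℕ<n i))) (Dec-∀ (search-Fin {suc k}) (P? ∘ toℕ))

-- The target of a named cell: none, an anonymous location, or a named one.
Target : ℕ → Set
Target m = Maybe (Maybe (Fin m))

Pattern : ℕ → Set
Pattern m = Vec (Target m) m

Split : ∀ {m} → Pattern m → Pattern m → Pattern m → Set
Split σ σ₁ σ₂ = ∀ i →
  (Vec.lookup σ i ≡ Vec.lookup σ₁ i × Vec.lookup σ₂ i ≡ nothing) ⊎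
  (Vec.lookup σ i ≡ Vec.lookup σ₂ i × Vec.lookup σ₁ i ≡ nothing)

-- The condition for realising the targets of an added heap: an anonymous target needs an anonymous
-- location to point at. The wand supplies the number of all of them, allocated or free. Parts of an
-- existing heap meet the condition by themselves, so `*f` does not state it.
Anonymous : ∀ {m} → Pattern m → ℕ∞ → Set
Anonymous σ r = (Σ _ λ i → Vec.lookup σ i ≡ just nothing) → r ≢ fin 0

-- A heap over pairwise distinct named locations is abstracted by its pattern σ on them,
-- the number d of allocated anonymous locations, and the number r of free anonymous ones.
⟦_⟧ : ∀ {m} → Form 1 → Store (Fin m) → Pattern m → ℕ → ℕ∞ → Set
⟦ ⊥f ⟧ e σ d r = ⊥
⟦ ⊤f ⟧ e σ d r = ⊤
⟦ emp ⟧ e σ d r = (∀ i → Vec.lookup σ i ≡ nothing) × d ≡ 0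
⟦ x ≈f y ⟧ e σ d r = Σ _ λ i → e x ≡ just i × e y ≡ just i
⟦ x ↦f (y ∷ []) ⟧ e σ d r = Σ _ λ i → Σ _ λ j → e x ≡ just i × e y ≡ just j ×
  Vec.lookup σ i ≡ just (just j) × (∀ k → k ≢ i → Vec.lookup σ k ≡ nothing) × d ≡ 0
⟦ φ ∧f ψ ⟧ e σ d r = ⟦ φ ⟧ e σ d r × ⟦ ψ ⟧ e σ d r
⟦ ¬f φ ⟧ e σ d r = ¬ ⟦ φ ⟧ e σ d r
⟦ φ *f ψ ⟧ e σ d r = Σ ℕ λ d₁ → Σ ℕ λ d₂ → d ≡ d₁ + d₂ × (Σ _ λ σ₁ → Σ _ λ σ₂ →
  Split σ σ₁ σ₂ × ⟦ φ ⟧ e σ₁ d₁ (d₂ ⊞ r) × ⟦ ψ ⟧ e σ₂ d₂ (d₁ ⊞ r))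
⟦ φ -*f ψ ⟧ e σ d r = ∀ a r₀ → r ≡ a ⊞ r₀ → ∀ σ′ σ″ → Split σ″ σ′ σ → Anonymous σ′ (d ⊞ r) →
  ⟦ φ ⟧ e σ′ a (d ⊞ r₀) → ⟦ ψ ⟧ e σ″ (a + d) r₀
⟦ ∃f x φ ⟧ e σ d r = ⊥

-- `emp` and `↦f` must tell one cell from none. Both `*f` and `-*f` divide a count in two, and
-- `≈-split` halves the precision, hence the doubling. The `suc` at `-*f` keeps the precision
-- positive, so that the emptiness tested by `Anonymous` is respected too.
threshold : Form 1 → ℕ
threshold emp = 1
threshold (x ↦f ys) = 1
threshold (φ ∧f ψ) = threshold φ ⊔ threshold ψ
threshold (¬f φ) = threshold φ
threshold (φ *f ψ) = let n = threshold φ ⊔ threshold ψ in n + n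
threshold (φ -*f ψ) = let n = suc (threshold φ ⊔ threshold ψ) in n + n
threshold (∃f x φ) = threshold φ
threshold _ = 0

-- A partition of a count on one side is copied to the other by `≈-split`: of the allocated cells
-- for `*f`, of the free locations for `-*f`. What one part occupies is free for the other, so the
-- remaining counts are sums and stay equivalent.
⟦⟧-resp : ∀ {m φ N d d′ r r′} {e : Store (Fin m)} {σ} → QF φ → threshold φ ≤ N →
  d ≈[ N ] d′ → r ≈∞[ N ] r′ → ⟦ φ ⟧ e σ d r → ⟦ φ ⟧ e σ d′ r′
⟦⟧-resp qf-⊤ _ _ _ p = p
⟦⟧-resp qf-emp le p q (f , refl) = f , ≈-0 le p
⟦⟧-resp qf-≈ _ _ _ p = p
⟦⟧-resp (qf-↦ {ys = _ ∷ []}) le p q (i , j , a , b , c , f , refl) = i , j , a , b , c , f , ≈-0 le p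
⟦⟧-resp (qf-∧ {φ} {ψ} a b) le p q (x , y) =
  ⟦⟧-resp a (ℕₚ.m⊔n≤o⇒m≤o (threshold φ) (threshold ψ) le) p q x ,
  ⟦⟧-resp b (ℕₚ.m⊔n≤o⇒n≤o (threshold φ) (threshold ψ) le) p q y
⟦⟧-resp (qf-¬ a) le p q f x = f (⟦⟧-resp a le (≈-sym p) (≈∞-sym q) x)
⟦⟧-resp (qf-* {φ} {ψ} a b) le p q (d₁ , d₂ , refl , σ₁ , σ₂ , sp , x , y)
  with ≈-split {threshold φ ⊔ threshold ψ} d₁ d₂ (≈-mono le p)
... | e₁ , e₂ , refl , p₁ , p₂ = e₁ , e₂ , refl , σ₁ , σ₂ , sp ,
  ⟦⟧-resp a (ℕₚ.m≤m⊔n _ _) p₁ (≈-⊞ p₂ (≈∞-mono (ℕₚ.≤-trans (ℕₚ.m≤m+n _ _) le) q)) x ,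
  ⟦⟧-resp b (ℕₚ.m≤n⊔m (threshold φ) _) p₂ (≈-⊞ p₁ (≈∞-mono (ℕₚ.≤-trans (ℕₚ.m≤m+n _ _) le) q)) y
-- The wand is contravariant: the given partition of `r′` is copied back to `r`, where the
-- hypothesis applies.
⟦⟧-resp {d = d} {d′} {r} {r′} (qf-—* {φ} {ψ} a b) le p q f c r₀ refl σ′ σ″ sp an x
  with ≈∞-split c r₀ (≈∞-mono le (≈∞-sym q))
... | c′ , r₀′ , eq , p₁ , p₂ = ⟦⟧-resp b (ℕₚ.m≤n⇒m≤1+n (ℕₚ.m≤n⊔m (threshold φ) _)) (≈-+ (≈-sym p₁) p′) (≈∞-sym p₂)
  (f c′ r₀′ eq σ′ σ″ sp
    (λ i z → an i (≈∞-0 (s≤s z≤n) (subst (_≈∞[ suc n ] (d′ ⊞ c ⊞ r₀)) z (≈-⊞ p′ (≈∞-mono half q)))))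
    (⟦⟧-resp a (ℕₚ.m≤n⇒m≤1+n (ℕₚ.m≤m⊔n _ _)) p₁ (≈-⊞ (≈-sym p′) p₂) x))
  where
  n = threshold φ ⊔ threshold ψ
  half = ℕₚ.≤-trans (ℕₚ.m≤m+n (suc n) (suc n)) le
  p′ : d ≈[ suc n ] d′
  p′ = ≈-mono half p

Split? : ∀ {m} (σ σ₁ σ₂ : Pattern m) → Dec (Split σ σ₁ σ₂)
Split? σ σ₁ σ₂ = Finₚ.all? λ i →
  (Vec.lookup σ i ≟T Vec.lookup σ₁ i ×-dec Vec.lookup σ₂ i ≟T nothing) ⊎-dec
  (Vec.lookup σ i ≟T Vec.lookup σ₂ i ×-dec Vec.lookup σ₁ i ≟T nothing)
  where _≟T_ = Maybeₚ.≡-dec (Maybeₚ.≡-dec Finₚ._≟_)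

search-Pattern : ∀ {m} → Searchable (Pattern m)
search-Pattern {m} = search-Vec (search-Maybe (search-Maybe search-Fin)) m

Anonymous? : ∀ {m} (σ : Pattern m) r → Dec (Anonymous σ r)
Anonymous? σ r = search-Fin (λ i → Maybeₚ.≡-dec (Maybeₚ.≡-dec Finₚ._≟_) (Vec.lookup σ i) (just nothing)) →-dec ¬? (0? r)
  where
  0? : ∀ r → Dec (r ≡ fin 0)
  0? (fin zero) = yes refl
  0? (fin (suc _)) = no λ ()
  0? ∞ = no λ ()

⟦⟧? : ∀ {m φ} → QF φ → ∀ (e : Store (Fin m)) σ d r → Dec (⟦ φ ⟧ e σ d r)
⟦⟧? qf-⊥ e σ d r = no λ ()
⟦⟧? qf-⊤ e σ d r = yes tt
⟦⟧? qf-emp e σ d r = Finₚ.all? (λ i → Maybeₚ.≡-dec (Maybeₚ.≡-dec Finₚ._≟_) (Vec.lookup σ i) nothing) ×-dec d ℕ.≟ 0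
⟦⟧? (qf-≈ {x} {y}) e σ d r = search-Fin λ i → e x ≟M just i ×-dec e y ≟M just i
  where _≟M_ = Maybeₚ.≡-dec Finₚ._≟_
⟦⟧? (qf-↦ {x} {y ∷ []}) e σ d r = search-Fin λ i → search-Fin λ j → e x ≟M just i ×-dec e y ≟M just j ×-dec
  Vec.lookup σ i ≟T just (just j) ×-dec
  Finₚ.all? (λ k → ¬? (k Finₚ.≟ i) →-dec Vec.lookup σ k ≟T nothing) ×-dec d ℕ.≟ 0
  where
  _≟M_ = Maybeₚ.≡-dec Finₚ._≟_
  _≟T_ = Maybeₚ.≡-dec _≟M_
⟦⟧? (qf-∧ a b) e σ d r = ⟦⟧? a e σ d r ×-dec ⟦⟧? b e σ d r
⟦⟧? (qf-¬ a) e σ d r = ¬? (⟦⟧? a e σ d r)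
⟦⟧? (qf-* a b) e σ d r = Dec-∃+ (λ d₁ d₂ → search-Pattern λ σ₁ → search-Pattern λ σ₂ →
  Split? σ σ₁ σ₂ ×-dec ⟦⟧? a e σ₁ d₁ (d₂ ⊞ r) ×-dec ⟦⟧? b e σ₂ d₂ (d₁ ⊞ r)) d
⟦⟧? (qf-—* {φ} {ψ} a b) e σ d r = go r
  where
  Body : ℕ∞ → ℕ → ℕ∞ → Set
  Body r c r₀ = ∀ σ′ σ″ → Split σ″ σ′ σ → Anonymous σ′ (d ⊞ r) → ⟦ φ ⟧ e σ′ c (d ⊞ r₀) → ⟦ ψ ⟧ e σ″ (c + d) r₀
  Body? : ∀ r c r₀ → Dec (Body r c r₀)
  Body? r c r₀ = Dec-∀ search-Pattern λ σ′ → Dec-∀ search-Pattern λ σ″ → Split? σ″ σ′ σ →-dec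
    Anonymous? σ′ (d ⊞ r) →-dec ⟦⟧? a e σ′ c (d ⊞ r₀) →-dec ⟦⟧? b e σ″ (c + d) r₀
  N = threshold φ ⊔ threshold ψ
  cut : ∀ c → Σ ℕ λ c′ → c′ ≤ N × c ≈[ N ] c′
  cut c with N ℕ.≤? c
  ... | yes p = N , ℕₚ.≤-refl , big p ℕₚ.≤-refl
  ... | no p = c , ℕₚ.<⇒≤ (ℕₚ.≰⇒> p) , same refl
  go : ∀ r → Dec (∀ c r₀ → r ≡ c ⊞ r₀ → Body r c r₀)
  go (fin k) = map′ (λ { ¬∃ c (fin r₀) refl → decidable-stable (Body? (fin k) c (fin r₀)) (λ ¬p → ¬∃ (c , r₀ , refl , ¬p)) })
    (λ { f (c , r₀ , refl , ¬p) → ¬p (f c (fin r₀) refl) })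
    (¬? (Dec-∃+ (λ c r₀ → ¬? (Body? (fin k) c (fin r₀))) k))
  -- The number of added cells is unbounded here, but from `N` on all numbers look alike to both
  -- subformulas, so testing `c ≤ N` is enough.
  go ∞ = map′ (λ { f c ∞ refl σ′ σ″ sp an x → let c′ , le , eq = cut c in
      ⟦⟧-resp b (ℕₚ.m≤n⊔m (threshold φ) _) (≈-+ (≈-sym eq) (same refl)) ∞
        (f c′ le σ′ σ″ sp an (⟦⟧-resp a (ℕₚ.m≤m⊔n _ _) eq ∞ x)) })
    (λ f c _ → f c ∞ refl) (Dec-∀≤ (λ c → Body? ∞ c ∞) N)

-- Correctness of the abstraction

¬¬_ : Set → Set
¬¬ A = ¬ ¬ A

data Extent (U : Set) : Set where
  finite   : (xs : List U) → (∀ u → u ∈ xs) → Extent U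
  infinite : Extent U

-- 'infinite' is only a declaration: a finite carrier may bear it, standing for an
-- infinite one in the evaluation of formulas. 'Truthful' says that the declaration is correct.
Truthful : ∀ {U} → Extent U → Set
Truthful (finite _ _) = ⊤
Truthful {U} infinite = ∀ (xs : List U) → ¬¬ Σ U (_∉ xs)

-- The sets measured have finite complement, so on an infinite carrier the answer is always `∞`.
-- Under a false declaration the same answer is the intended fiction.
FSize : ∀ {U} → Extent U → (U → Set) → ℕ∞ → Set
FSize (finite _ _) P (fin k) = Cnt P k
FSize infinite P ∞ = ⊤
FSize _ _ _ = ⊥

FSize-resp : ∀ (E : Extent A) {r} → P ≐ Q → FSize E P r → FSize E Q r
FSize-resp (finite _ _) {fin _} e C = Cnt-resp e C
FSize-resp infinite {∞} e C = C

FSize-unique : ∀ (E : Extent A) {P : A → Set} {r r′} → FSize E P r → FSize E P r′ → r ≡ r′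
FSize-unique (finite _ _) {r = fin _} {fin _} C D = cong fin (Cnt-unique C D)
FSize-unique infinite {r = ∞} {∞} _ _ = refl

FSize-exists : DecidableEquality A → (E : Extent A) → Decidable P → Σ ℕ∞ (FSize E P)
FSize-exists _≟_ (finite xs all) P? = Product.map fin id (Cnt-cover _≟_ P? xs (λ _ → all _))
FSize-exists _≟_ infinite P? = ∞ , tt

FSize-⊎ : ∀ (E : Extent A) {P Q : A → Set} {k r} → (∀ {x} → P x → Q x → ⊥) →
  Cnt P k → FSize E Q r → FSize E (λ x → P x ⊎ Q x) (k ⊞ r)
FSize-⊎ (finite _ _) {r = fin _} dis C D = Cnt-⊎ dis C D
FSize-⊎ infinite {r = ∞} dis C D = tt

module _ {U : Set} (_≟_ : DecidableEquality U) where

  -- On an infinite carrier the points are drawn one by one outside `xs` and the earlier draws. Each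
  -- draw is available only under double negation, hence so is the whole choice.
  FSize-choose : ∀ (E : Extent U) {P a r} → Truthful E → (xs : List U) → (∀ {u} → u ∉ xs → P u) → FSize E P (a ⊞ r) →
    ¬¬ Σ (List U) λ ys → Cnt (λ u → P u × u ∈ ys) a × FSize E (λ u → P u × u ∉ ys) r
  FSize-choose (finite _ _) {r = fin _} _ _ _ C k = k (Cnt-choose _≟_ C)
  FSize-choose infinite {P} {a} {r = ∞} fresh xs out _ k = pick a λ { (ys , u , s , l) →
    k (ys , mkCnt ys u (λ p → s p , p) proj₂ l , tt) }
    where
    pick : ∀ a → ¬¬ Σ (List U) λ ys → Unique ys × (∀ {u} → u ∈ ys → P u) × length ys ≡ a
    pick zero k = k ([] , [] , (λ ()) , refl)
    pick (suc a) k = pick a λ { (ys , u , s , l) → fresh (xs ++ ys) λ { (y , y∉) →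
      k (y ∷ ys , All.tabulate (λ { z∈ refl → y∉ (∈ₚ.∈-++⁺ʳ xs z∈) }) ∷ u ,
        (λ { (here refl) → out (y∉ ∘ ∈ₚ.∈-++⁺ˡ) ; (there p) → s p }) , cong suc l) } }

Fresh : ∀ {U : Set} {m} → (Fin m → U) → U → Set
Fresh c u = ∀ i → c i ≢ u

data Shows {U : Set} {m} (c : Fin m → U) : Maybe (Vec U 1) → Target m → Set where
  none  : Shows c nothing nothing
  anon  : ∀ {v} → Fresh c v → Shows c (just (v ∷ [])) (just nothing)
  named : ∀ {v} j → c j ≡ v → Shows c (just (v ∷ [])) (just (just j))

choice : ∀ {m} {P : Fin m → A → Set} → (∀ i → Σ A (P i)) → Σ (Vec A m) λ v → ∀ i → P i (Vec.lookup v i)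
choice {P = P} f = Vec.tabulate (proj₁ ∘ f) ,
  λ i → subst (P i) (sym (Vecₚ.lookup∘tabulate (proj₁ ∘ f) i)) (proj₂ (f i))

module _ {U : Set} {m : ℕ} {c : Fin m → U} where

  shows-unique : Injective _≡_ _≡_ c → ∀ {x t t′} → Shows c x t → Shows c x t′ → t ≡ t′
  shows-unique inj none none = refl
  shows-unique inj (anon f) (anon g) = refl
  shows-unique inj (anon f) (named j e) = contradiction e (f j)
  shows-unique inj (named j e) (anon f) = contradiction e (f j)
  shows-unique inj (named j e) (named k e′) = cong (just ∘ just) (inj (trans e (sym e′)))

  shows-nothing : ∀ {x t} → Shows c x t → x ≡ nothing → t ≡ nothing
  shows-nothing none _ = refl

  shows-nothing⁻ : ∀ {x t} → Shows c x t → t ≡ nothing → x ≡ nothing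
  shows-nothing⁻ none _ = refl

  AnonDom AnonFree : (U → Maybe (Vec U 1)) → U → Set
  AnonDom h u = h u ≢ nothing × Fresh c u
  AnonFree h u = h u ≡ nothing × Fresh c u

nothing? : ∀ {A : Set} (x : Maybe A) → Dec (x ≡ nothing)
nothing? nothing = yes refl
nothing? (just _) = no λ ()

record Abs {U : Set} (E : Extent U) {m} (c : Fin m → U) (h : U → Maybe (Vec U 1)) (σ : Pattern m) (d : ℕ) (r : ℕ∞) : Set where
  constructor mkAbs
  field
    shown : ∀ i → Shows c (h (c i)) (Vec.lookup σ i)
    doms  : Cnt (AnonDom {c = c} h) d
    frees : FSize E (AnonFree {c = c} h) r
open Abs public

module Locations {U : Set} (_≟_ : DecidableEquality U) where

  named? : ∀ {m} (c : Fin m → U) u → (Σ (Fin m) λ i → c i ≡ u) ⊎ Fresh c u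
  named? c u with Finₚ.any? (λ i → c i ≟ u)
  ... | yes p = inj₁ p
  ... | no p = inj₂ λ i e → p (i , e)

  fresh? : ∀ {m} (c : Fin m → U) → Decidable (Fresh c)
  fresh? c u = Finₚ.all? (λ i → ¬? (c i ≟ u))

  shows : ∀ {m} (c : Fin m → U) x → Σ (Target m) (Shows c x)
  shows c nothing = nothing , none
  shows c (just (v ∷ [])) with named? c v
  ... | inj₁ (j , e) = just (just j) , named j e
  ... | inj₂ f = just nothing , anon f

  anonDom? : ∀ {m} (c : Fin m → U) h → Decidable (AnonDom {c = c} h)
  anonDom? c h u = ¬? (nothing? (h u)) ×-dec fresh? c u

  anonFree? : ∀ {m} (c : Fin m → U) h → Decidable (AnonFree {c = c} h)
  anonFree? c h u = nothing? (h u) ×-dec fresh? c u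

  countDom : ∀ {m} (c : Fin m → U) (H : Heap U 1) → Σ ℕ (Cnt (AnonDom {c = c} (app H)))
  countDom c H@(h , xs , cov) = Cnt-cover _≟_ (anonDom? c h) xs (λ p → cov _ (proj₁ p))

  abstraction : ∀ {m} (E : Extent U) (c : Fin m → U) (H : Heap U 1) →
    Σ (Pattern m) λ σ → Σ ℕ λ d → Σ ℕ∞ λ r → Abs E c (app H) σ d r
  abstraction E c H@(h , _) =
    let σ , sh = choice (λ i → shows c (h (c i)))
        d , C = countDom c H
        r , F = FSize-exists _≟_ E (anonFree? c h)
    in σ , d , r , mkAbs sh C F

IsUnion-sym : ∀ {U} {H H₁ H₂ : Heap U 1} → IsUnion H H₁ H₂ → IsUnion H H₂ H₁
IsUnion-sym (dis , un) = (λ u → Sum.swap (dis u)) , (λ u → Sum.swap (un u))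

module _ {U : Set} {m : ℕ} {c : Fin m → U} {H H₁ H₂ : Heap U 1} (un : IsUnion H H₁ H₂) where

  union-doms : (λ u → AnonDom {c = c} (app H₁) u ⊎ AnonDom {c = c} (app H₂) u) ≐ AnonDom {c = c} (app H)
  union-doms = to , from
    where
    to : ∀ {u} → AnonDom (app H₁) u ⊎ AnonDom (app H₂) u → AnonDom (app H) u
    to {u} p with proj₂ un u | p
    ... | inj₁ (e , n) | inj₁ (a , f) = a ∘ trans (sym e) , f
    ... | inj₁ (e , n) | inj₂ (a , f) = contradiction n a
    ... | inj₂ (e , n) | inj₁ (a , f) = contradiction n a
    ... | inj₂ (e , n) | inj₂ (a , f) = a ∘ trans (sym e) , f
    from : ∀ {u} → AnonDom (app H) u → AnonDom (app H₁) u ⊎ AnonDom (app H₂) u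
    from {u} (a , f) with proj₂ un u
    ... | inj₁ (e , _) = inj₁ (a ∘ trans e , f)
    ... | inj₂ (e , _) = inj₂ (a ∘ trans e , f)

  union-doms-disjoint : ∀ {u} → AnonDom {c = c} (app H₁) u → AnonDom {c = c} (app H₂) u → ⊥
  union-doms-disjoint {u} (a , _) (b , _) = [ a , b ] (proj₁ un u)

  -- The source of the count `d₂ ⊞ r` in the semantics of `*f`: the cells of one part are free for
  -- the other.
  union-frees : (λ u → AnonDom {c = c} (app H₂) u ⊎ AnonFree {c = c} (app H) u) ≐ AnonFree {c = c} (app H₁)
  union-frees = to , from
    where
    to : ∀ {u} → AnonDom (app H₂) u ⊎ AnonFree (app H) u → AnonFree (app H₁) u
    to {u} (inj₁ (a , f)) = [ (λ n → n , f) , (λ n → contradiction n a) ] (proj₁ un u)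
    to {u} (inj₂ (n , f)) = [ (λ (e , _) → trans (sym e) n , f) , (λ (_ , e) → e , f) ] (proj₂ un u)
    from : ∀ {u} → AnonFree (app H₁) u → AnonDom (app H₂) u ⊎ AnonFree (app H) u
    from {u} (n , f) with proj₂ un u | nothing? (app H₂ u)
    ... | inj₁ (e , _) | _ = inj₂ (trans e n , f)
    ... | inj₂ (e , _) | yes n₂ = inj₂ (trans e n₂ , f)
    ... | inj₂ (e , _) | no a = inj₁ (a , f)

  union-frees-disjoint : ∀ {u} → AnonDom {c = c} (app H₂) u → AnonFree {c = c} (app H) u → ⊥
  union-frees-disjoint p (n , _) = proj₁ (proj₁ union-doms (inj₂ p)) n

  union-split : Injective _≡_ _≡_ c → ∀ {σ σ₁ σ₂} →
    (∀ i → Shows c (app H (c i)) (Vec.lookup σ i)) → (∀ i → Shows c (app H₁ (c i)) (Vec.lookup σ₁ i)) →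
    (∀ i → Shows c (app H₂ (c i)) (Vec.lookup σ₂ i)) → Split σ σ₁ σ₂
  union-split inj sh sh₁ sh₂ i with proj₂ un (c i)
  ... | inj₁ (e , n) = inj₁ (shows-unique inj (sh i) (subst (λ x → Shows c x _) (sym e) (sh₁ i)) , shows-nothing (sh₂ i) n)
  ... | inj₂ (e , n) = inj₂ (shows-unique inj (sh i) (subst (λ x → Shows c x _) (sym e) (sh₂ i)) , shows-nothing (sh₁ i) n)

  split-union : ∀ {σ σ₁ σ₂} → Split σ σ₁ σ₂ → (∀ i → Shows c (app H₁ (c i)) (Vec.lookup σ₁ i)) →
    (∀ i → Shows c (app H₂ (c i)) (Vec.lookup σ₂ i)) → ∀ i → Shows c (app H (c i)) (Vec.lookup σ i)
  split-union sp sh₁ sh₂ i with proj₂ un (c i) | sp i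
  ... | inj₁ (e , _) | inj₁ (e′ , _) = subst₂ (Shows c) (sym e) (sym e′) (sh₁ i)
  ... | inj₂ (e , _) | inj₂ (e′ , _) = subst₂ (Shows c) (sym e) (sym e′) (sh₂ i)
  -- Heap and pattern may credit the cell to different parts; then it is empty in both.
  ... | inj₁ (e , n) | inj₂ (e′ , n′) = subst₂ (Shows c) (sym (trans e (shows-nothing⁻ (sh₁ i) n′))) (sym (trans e′ (shows-nothing (sh₂ i) n))) none
  ... | inj₂ (e , n) | inj₁ (e′ , n′) = subst₂ (Shows c) (sym (trans e (shows-nothing⁻ (sh₂ i) n′))) (sym (trans e′ (shows-nothing (sh₁ i) n))) none

module _ {U : Set} (E : Extent U) {m : ℕ} {c : Fin m → U} {H H₁ H₂ : Heap U 1} {d₁ d₂ : ℕ} {r : ℕ∞}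
  (un : IsUnion H H₁ H₂) (C₁ : Cnt (AnonDom {c = c} (app H₁)) d₁) (C₂ : Cnt (AnonDom {c = c} (app H₂)) d₂) where

  union-count : Cnt (AnonDom {c = c} (app H)) (d₁ + d₂)
  union-count = Cnt-resp (union-doms {H = H} {H₁} {H₂} un) (Cnt-⊎ (union-doms-disjoint {H = H} {H₁} {H₂} un) C₁ C₂)

  union-size : FSize E (AnonFree {c = c} (app H)) r → FSize E (AnonFree {c = c} (app H₁)) (d₂ ⊞ r)
  union-size F = FSize-resp E (union-frees {H = H} {H₁} {H₂} un)
    (FSize-⊎ E (union-frees-disjoint {H = H} {H₁} {H₂} un) C₂ F)

-- Realising abstract splittings and extensions by heaps

keep : ∀ {X A : Set} → Dec X → Maybe A → Maybe A
keep (yes _) x = x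
keep (no _) _ = nothing

keep-yes : ∀ {X A : Set} (d : Dec X) {x : Maybe A} → X → keep d x ≡ x
keep-yes (yes _) _ = refl
keep-yes (no ¬p) p = contradiction p ¬p

keep-no : ∀ {X A : Set} (d : Dec X) {x : Maybe A} → ¬ X → keep d x ≡ nothing
keep-no (yes p) ¬p = contradiction p ¬p
keep-no (no _) _ = refl

keep-≢ : ∀ {X A : Set} (d : Dec X) {x : Maybe A} → keep d x ≢ nothing → X × x ≢ nothing
keep-≢ (yes p) n = p , n
keep-≢ (no _) n = contradiction refl n

restrict : ∀ {U} {S : U → Set} → Decidable S → Heap U 1 → Heap U 1
restrict S? (h , xs , cov) = (λ u → keep (S? u) (h u)) , xs , λ u n → cov u (proj₂ (keep-≢ (S? u) n))

restrict-union : ∀ {U} {S : U → Set} (S? : Decidable S) (H : Heap U 1) → IsUnion H (restrict S? H) (restrict (¬? ∘ S?) H)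
restrict-union {U} S? H = dis , un
  where
  dis : Disjoint (restrict S? H) (restrict (¬? ∘ S?) H)
  dis u with S? u
  ... | yes _ = inj₂ refl
  ... | no _ = inj₁ refl
  un : ∀ u → (app H u ≡ keep (S? u) (app H u) × keep (¬? (S? u)) (app H u) ≡ nothing) ⊎
             (app H u ≡ keep (¬? (S? u)) (app H u) × keep (S? u) (app H u) ≡ nothing)
  un u with S? u
  ... | yes _ = inj₁ (refl , refl)
  ... | no _ = inj₂ (refl , refl)

union : ∀ {U} → Heap U 1 → Heap U 1 → Heap U 1
union (h₁ , xs₁ , cov₁) (h₂ , xs₂ , cov₂) = (λ u → h₁ u <∣> h₂ u) , xs₁ ++ xs₂ , cov
  where
  cov : ∀ u → (h₁ u <∣> h₂ u) ≢ nothing → u ∈ xs₁ ++ xs₂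
  cov u n with h₁ u in eq
  ... | just _ = ∈ₚ.∈-++⁺ˡ (cov₁ u λ e → case trans (sym eq) e of λ ())
  ... | nothing = ∈ₚ.∈-++⁺ʳ xs₁ (cov₂ u n)

union-isUnion : ∀ {U} (H₁ H₂ : Heap U 1) → Disjoint H₁ H₂ → IsUnion (union H₁ H₂) H₁ H₂
union-isUnion H₁ H₂ dis = dis , un
  where
  un : ∀ u → ((app H₁ u <∣> app H₂ u) ≡ app H₁ u × app H₂ u ≡ nothing) ⊎
             ((app H₁ u <∣> app H₂ u) ≡ app H₂ u × app H₁ u ≡ nothing)
  un u with app H₁ u | dis u
  ... | just _ | inj₂ n = inj₁ (refl , n)
  ... | nothing | _ = inj₂ (refl , refl)

Sees : ∀ {U m} → (Fin m → U) → List Var → Store U → Store (Fin m) → Set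
Sees c bs s e = ∀ {x} → x ∈ bs → Σ _ λ i → e x ≡ just i × s x ≡ just (c i)

module Correctness {U : Set} (_≟_ : DecidableEquality U) (E : Extent U) (truth : Truthful E)
  {m : ℕ} (c : Fin m → U) (inj : Injective _≡_ _≡_ c) where

  open Locations _≟_
  open import Data.List.Membership.DecPropositional _≟_ using (_∈?_)

  -- Restriction realises the partition: the first part keeps the named cells claimed by `σ₁` and
  -- any `d₁` of the anonymous cells, the second part keeps the rest.
  split-real : ∀ {H σ d₁ d₂ r} → Abs E c (app H) σ (d₁ + d₂) r → ∀ {σ₁ σ₂} → Split σ σ₁ σ₂ →
    Σ (Heap U 1) λ H₁ → Σ (Heap U 1) λ H₂ → IsUnion H H₁ H₂ ×
      Abs E c (app H₁) σ₁ d₁ (d₂ ⊞ r) × Abs E c (app H₂) σ₂ d₂ (d₁ ⊞ r)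
  split-real {H} {σ} {d₁} {d₂} {r} α {σ₁} {σ₂} sp with Cnt-choose {a = d₁} {d₂} _≟_ (doms α)
  ... | ys , C₁ , C₂ = H₁ , H₂ , un ,
      mkAbs sh₁ C₁′ (union-size E {H = H} {H₁} {H₂} un C₁′ C₂′ (frees α)) ,
      mkAbs sh₂ C₂′ (union-size E {H = H} {H₂} {H₁} (IsUnion-sym {H = H} {H₁} {H₂} un) C₂′ C₁′ (frees α))
    where
    S : U → Set
    S u = (Σ (Fin m) λ i → c i ≡ u × Vec.lookup σ₁ i ≢ nothing) ⊎ (Fresh c u × u ∈ ys)
    S? : Decidable S
    S? u = Finₚ.any? (λ i → c i ≟ u ×-dec ¬? (nothing? _)) ⊎-dec (fresh? c u ×-dec u ∈? ys)
    H₁ = restrict S? H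
    H₂ = restrict (¬? ∘ S?) H
    un = restrict-union S? H
    in₁ : ∀ {i} → Vec.lookup σ₁ i ≢ nothing → S (c i)
    in₁ n = inj₁ (_ , refl , n)
    out₁ : ∀ {i} → Vec.lookup σ₁ i ≡ nothing → ¬ S (c i)
    out₁ n (inj₁ (j , e , a)) = a (subst (λ k → Vec.lookup σ₁ k ≡ nothing) (sym (inj e)) n)
    out₁ n (inj₂ (f , _)) = f _ refl
    sh₁ : ∀ i → Shows c (app H₁ (c i)) (Vec.lookup σ₁ i)
    sh₁ i with nothing? (Vec.lookup σ₁ i)
    ... | yes n = subst₂ (Shows c) (sym (keep-no (S? (c i)) (out₁ n))) (sym n) none
    ... | no a with sp i
    ...   | inj₁ (e , _) = subst₂ (Shows c) (sym (keep-yes (S? (c i)) (in₁ a))) e (shown α i)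
    ...   | inj₂ (_ , n) = contradiction n a
    sh₂ : ∀ i → Shows c (app H₂ (c i)) (Vec.lookup σ₂ i)
    sh₂ i with nothing? (Vec.lookup σ₁ i) | sp i
    ... | yes n | inj₂ (e , _) = subst₂ (Shows c) (sym (keep-yes (¬? (S? (c i))) (out₁ n))) e (shown α i)
    ... | yes n | inj₁ (e , n′) = subst₂ (Shows c)
      (sym (trans (keep-yes (¬? (S? (c i))) (out₁ n)) (shows-nothing⁻ (shown α i) (trans e n)))) (sym n′) none
    ... | no a | inj₁ (_ , n) = subst₂ (Shows c) (sym (keep-no (¬? (S? (c i))) (λ ¬s → ¬s (in₁ a)))) (sym n) none
    ... | no a | inj₂ (_ , n) = contradiction n a
    C₁′ : Cnt (AnonDom {c = c} (app H₁)) d₁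
    C₁′ = Cnt-resp ((λ {u} ((a , f) , q) → subst (_≢ nothing) (sym (keep-yes (S? u) (inj₂ (f , q)))) a , f) ,
      λ {u} (a , f) → let s , a′ = keep-≢ (S? u) a in (a′ , f) , [ (λ (i , e , _) → contradiction e (f i)) , proj₂ ] s) C₁
    C₂′ : Cnt (AnonDom {c = c} (app H₂)) d₂
    C₂′ = Cnt-resp ((λ {u} ((a , f) , q) → subst (_≢ nothing)
        (sym (keep-yes (¬? (S? u)) [ (λ (i , e , _) → f i e) , q ∘ proj₂ ])) a , f) ,
      λ {u} (a , f) → let s , a′ = keep-≢ (¬? (S? u)) a in (a′ , f) , λ q → s (inj₂ (f , q))) C₂

  someFresh : ∀ {h σ d r} → Abs E c h σ d r → d ⊞ r ≢ fin 0 → ¬¬ Σ U (Fresh c)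
  someFresh {h} {d = d} {r} α ne k = go E truth (FSize-⊎ E (λ p q → proj₁ p (proj₁ q)) (doms α) (frees α)) ne
    where
    go : ∀ E → Truthful E → ∀ {r} → FSize E (λ u → AnonDom {c = c} h u ⊎ AnonFree {c = c} h u) r → r ≢ fin 0 → ⊥
    go (finite _ _) _ {fin zero} _ ne = ne refl
    go (finite _ _) _ {fin (suc _)} C _ = let u , p = Cnt-suc C in k (u , [ proj₂ , proj₂ ]′ p)
    go infinite t {∞} _ _ = t (List.tabulate c) λ (u , u∉) → k (u , λ { i refl → u∉ (∈ₚ.∈-tabulate⁺ i) })

  someValues : ∀ {h σ d r} → Abs E c h σ d r → ∀ σ′ → Anonymous σ′ (d ⊞ r) →
    ¬¬ (∀ i → Σ _ λ x → Shows c x (Vec.lookup σ′ i))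
  someValues {σ = σ} {d} {r} α σ′ an k = case search-Fin (λ i → Maybeₚ.≡-dec (Maybeₚ.≡-dec Finₚ._≟_) (Vec.lookup σ′ i) (just nothing)) of λ where
      (yes p) → someFresh α (an p) λ (v , f) → k λ i → value (Vec.lookup σ′ i) (λ _ → v , f)
      (no ¬p) → k λ i → value (Vec.lookup σ′ i) (λ e → contradiction (i , e) ¬p)
    where
    value : ∀ t → (t ≡ just nothing → Σ U (Fresh c)) → Σ _ λ x → Shows c x t
    value nothing _ = nothing , none
    value (just nothing) v = let v , f = v refl in just (v ∷ []) , anon f
    value (just (just j)) _ = just (c j ∷ []) , named j refl

  -- The pattern `σ′` is written on the named cells and `a` new cells are put on free anonymous
  -- locations. These locations, and a value for anonymous targets, have to be found in the carrier,
  -- which costs the double negation.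
  extend-real : ∀ {H σ d r a r₀} → Abs E c (app H) σ d r → r ≡ a ⊞ r₀ → ∀ {σ′ σ″} → Split σ″ σ′ σ → Anonymous σ′ (d ⊞ r) →
    ¬¬ Σ (Heap U 1) λ H′ → Σ (Heap U 1) λ H″ → IsUnion H″ H′ H ×
      Abs E c (app H′) σ′ a (d ⊞ r₀) × Abs E c (app H″) σ″ (a + d) r₀
  extend-real {H} {σ} {d} {r} {a} {r₀} α refl {σ′} {σ″} sp an k =
    someValues α σ′ an λ vals →
    FSize-choose _≟_ E {r = r₀} truth (List.tabulate c ++ proj₁ (proj₂ H))
      (λ {u} u∉ → decidable-stable (nothing? _) (λ a → u∉ (∈ₚ.∈-++⁺ʳ (List.tabulate c) (proj₂ (proj₂ H) u a))) ,
        λ { i refl → u∉ (∈ₚ.∈-++⁺ˡ (∈ₚ.∈-tabulate⁺ i)) })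
      (frees α) λ { (ys , C , F) → k (build vals ys C F) }
    where
    build : (∀ i → Σ _ λ x → Shows c x (Vec.lookup σ′ i)) → ∀ ys →
      Cnt (λ u → AnonFree {c = c} (app H) u × u ∈ ys) a → FSize E (λ u → AnonFree {c = c} (app H) u × u ∉ ys) r₀ → _
    build vals ys C F = H′ , union H′ H , un ,
        mkAbs sh′ C′ (union-size E {H = union H′ H} {H′} {H} un C′ (doms α) F″) ,
        mkAbs (split-union {H = union H′ H} {H′} {H} un {σ″} {σ′} {σ} sp sh′ (shown α))
          (union-count E {H = union H′ H} {H′} {H} {r = r₀} un C′ (doms α)) F″
      where
      Q? : Decidable (λ u → AnonFree {c = c} (app H) u × u ∈ ys)
      Q? u = anonFree? c (app H) u ×-dec u ∈? ys
      place : ∀ u → (Σ (Fin m) λ i → c i ≡ u) ⊎ Fresh c u → Maybe (Vec U 1)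
      place u (inj₁ (i , _)) = proj₁ (vals i)
      -- The content of an anonymous cell is invisible to the abstraction; a self-loop is always at
      -- hand.
      place u (inj₂ _) = keep (Q? u) (just (u ∷ []))
      H′ : Heap U 1
      H′ = (λ u → place u (named? c u)) , List.tabulate c ++ elems C , cov
        where
        cov : ∀ u → place u (named? c u) ≢ nothing → u ∈ List.tabulate c ++ elems C
        cov u n with named? c u
        ... | inj₁ (i , refl) = ∈ₚ.∈-++⁺ˡ (∈ₚ.∈-tabulate⁺ i)
        ... | inj₂ _ = ∈ₚ.∈-++⁺ʳ (List.tabulate c) (complete C (proj₁ (keep-≢ (Q? u) n)))
      at-named : ∀ i → app H′ (c i) ≡ proj₁ (vals i)
      at-named i with named? c (c i)
      ... | inj₁ (j , e) = cong (proj₁ ∘ vals) (inj e)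
      ... | inj₂ f = contradiction refl (f i)
      at-fresh : ∀ {u} → Fresh c u → app H′ u ≡ keep (Q? u) (just (u ∷ []))
      at-fresh {u} f with named? c u
      ... | inj₁ (i , e) = contradiction e (f i)
      ... | inj₂ _ = refl
      sh′ : ∀ i → Shows c (app H′ (c i)) (Vec.lookup σ′ i)
      sh′ i = subst (λ x → Shows c x _) (sym (at-named i)) (proj₂ (vals i))
      C′ : Cnt (AnonDom {c = c} (app H′)) a
      C′ = Cnt-resp ((λ {u} q → subst (_≢ nothing) (sym (trans (at-fresh (proj₂ (proj₁ q))) (keep-yes (Q? u) q))) (λ ()) , proj₂ (proj₁ q)) ,
        λ {u} (n , f) → proj₁ (keep-≢ (Q? u) (subst (_≢ nothing) (at-fresh f) n))) C
      dis : Disjoint H′ H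
      dis u with named? c u in eq
      ... | inj₁ (i , refl) = [ (λ (_ , n) → inj₂ (shows-nothing⁻ (shown α i) n)) ,
        (λ (_ , n) → inj₁ (shows-nothing⁻ (proj₂ (vals i)) n)) ]′ (sp i)
      ... | inj₂ f = case Q? u of λ where
        (yes ((n , _) , _)) → inj₂ n
        (no ¬q) → inj₁ (keep-no (Q? u) ¬q)
      un : IsUnion (union H′ H) H′ H
      un = union-isUnion H′ H dis
      F″ : FSize E (AnonFree {c = c} (app (union H′ H))) r₀
      F″ = FSize-resp E (to , from) F
        where
        to : ∀ {u} → AnonFree {c = c} (app H) u × u ∉ ys → AnonFree {c = c} (app (union H′ H)) u
        to {u} ((n , f) , ∉) = trans (cong (_<∣> app H u) (trans (at-fresh f) (keep-no (Q? u) (∉ ∘ proj₂)))) n , f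
        from : ∀ {u} → AnonFree {c = c} (app (union H′ H)) u → AnonFree {c = c} (app H) u × u ∉ ys
        from {u} (n , f) with proj₂ un u
        ... | inj₁ (e , n′) = (n′ , f) , λ q → case trans (sym (trans (at-fresh f) (keep-yes (Q? u) ((n′ , f) , q)))) (trans (sym e) n) of λ ()
        ... | inj₂ (e , n′) = (trans (sym e) n , f) , λ q →
          case trans (sym (trans (at-fresh f) (keep-yes (Q? u) ((trans (sym e) n , f) , q)))) n′ of λ ()

  empty-anon : ∀ {h σ d r} → Abs E c h σ d r → d ≡ 0 → ∀ {u} → Fresh c u → h u ≡ nothing
  empty-anon {h} α refl {u} f = decidable-stable (nothing? (h u)) λ a → Cnt-0 (doms α) (a , f)

  anon-empty : ∀ {h σ d r} → Abs E c h σ d r → (∀ {u} → Fresh c u → h u ≡ nothing) → d ≡ 0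
  anon-empty α n = Cnt-unique (doms α) (Cnt-∅ λ (a , f) → a (n f))

  -- Concrete subheaps are abstracted, abstract ones are realised by `split-real` and `extend-real`.
  -- Scoping together with `Sees` gives every variable that occurs a defined, named value.
  correct : ∀ {φ bs s e H σ d r} → QF φ → ScopedIn bs φ → Sees c bs s e → Abs E c (app H) σ d r →
    ((U , s , H ⊨ φ) → ⟦ φ ⟧ e σ d r) × (⟦ φ ⟧ e σ d r → U , s , H ⊨ φ)
  correct qf-⊥ _ _ _ = id , id
  correct qf-⊤ _ _ _ = id , id
  correct {H = H} qf-emp sc-emp ρ α =
    (λ n → (λ i → shows-nothing (shown α i) (n _)) , anon-empty α (λ _ → n _)) ,
    λ (f , z) u → [ (λ { (i , refl) → shows-nothing⁻ (shown α i) (f i) }) , empty-anon α z ] (named? c u)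
  correct {s = s} {e} qf-≈ (sc-≈ x∈ y∈) ρ α with ρ x∈ | ρ y∈
  ... | i , ei , si | j , ej , sj =
    (λ (a , p , q) → i , ei , trans ej (cong just (inj (Maybeₚ.just-injective
      (trans (trans (sym sj) q) (trans (sym p) si)))))) ,
    λ (k , p , q) → c i , si , trans sj (cong (just ∘ c) (Maybeₚ.just-injective (trans (trans (sym ej) q) (trans (sym p) ei))))
  correct {s = s} {e} {H} {σ} (qf-↦ {ys = y ∷ []}) (sc-↦ x∈ y∈) ρ α with ρ x∈ | ρ (y∈ zero)
  ... | i , ei , si | j , ej , sj = to , from
    where
    to : _ → _
    to (a , v ∷ [] , p , q , ha , rest) with Maybeₚ.just-injective (trans (sym si) p)
      | Maybeₚ.just-injective (trans (sym sj) (Vecₚ.∷-injectiveˡ q))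
    ... | refl | refl = i , j , ei , ej , target , (λ k k≢i → shows-nothing (shown α k) (rest _ (k≢i ∘ inj))) ,
        anon-empty α (λ {u} f → rest u (λ e → f i (sym e)))
      where
      target : Vec.lookup σ i ≡ just (just j)
      target = shows-unique inj (shown α i) (subst (λ x → Shows c x _) (sym ha) (named j refl))
    from : _ → _
    from (i′ , j′ , p , q , t , rest , z) with Maybeₚ.just-injective (trans (sym ei) p) | Maybeₚ.just-injective (trans (sym ej) q)
    ... | refl | refl = c i , c j ∷ [] , si , cong (_∷ []) sj , target (shown α i) t ,
        λ u u≢ → [ (λ { (k , refl) → shows-nothing⁻ (shown α k) (rest k (u≢ ∘ cong c)) }) , empty-anon α z ] (named? c u)
      where
      target : ∀ {x t} → Shows c x t → t ≡ just (just j) → x ≡ just (c j ∷ [])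
      target (named _ refl) refl = refl
  correct (qf-∧ a b) (sc-∧ sa sb) ρ α = Product.map (proj₁ (correct a sa ρ α)) (proj₁ (correct b sb ρ α)) ,
    Product.map (proj₂ (correct a sa ρ α)) (proj₂ (correct b sb ρ α))
  correct (qf-¬ a) (sc-¬ sa) ρ α = (_∘ proj₂ (correct a sa ρ α)) , (_∘ proj₁ (correct a sa ρ α))
  correct {H = H} {σ} {d} {r} (qf-* a b) (sc-* sa sb) ρ α = to , from
    where
    to : _ → _
    to (H₁ , H₂ , un , p , q) with countDom c H₁ | countDom c H₂
    ... | d₁ , C₁ | d₂ , C₂ =
      let σ₁ , sh₁ = choice (λ i → shows c (app H₁ (c i)))
          σ₂ , sh₂ = choice (λ i → shows c (app H₂ (c i)))
      in d₁ , d₂ , Cnt-unique (doms α) (union-count E {H = H} {H₁} {H₂} {r = r} un C₁ C₂) , σ₁ , σ₂ ,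
        union-split {H = H} {H₁} {H₂} un inj {σ} {σ₁} {σ₂} (shown α) sh₁ sh₂ ,
        proj₁ (correct {H = H₁} a sa ρ (mkAbs sh₁ C₁ (union-size E {H = H} {H₁} {H₂} un C₁ C₂ (frees α)))) p ,
        proj₁ (correct {H = H₂} b sb ρ (mkAbs sh₂ C₂ (union-size E {H = H} {H₂} {H₁} (IsUnion-sym {H = H} {H₁} {H₂} un) C₂ C₁ (frees α)))) q
    from : _ → _
    from (d₁ , d₂ , refl , σ₁ , σ₂ , sp , p , q) with split-real {H} {σ} {d₁} {d₂} α {σ₁} {σ₂} sp
    ... | H₁ , H₂ , un , α₁ , α₂ = H₁ , H₂ , un , proj₂ (correct {H = H₁} a sa ρ α₁) p , proj₂ (correct {H = H₂} b sb ρ α₂) q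
  correct {e = e} {H = H} {σ} {d} {r} (qf-—* a b) (sc-—* sa sb) ρ α = to , from
    where
    to : _ → _
    -- The added heap exists only under double negation, but the abstract conclusion is decidable
    -- and hence stable.
    to f k r₀ eq σ′ σ″ sp an p = decidable-stable (⟦⟧? b e σ″ (k + d) r₀) λ ¬q →
      extend-real {H} {a = k} {r₀} α eq {σ′} {σ″} sp an λ { (H′ , H″ , un , α′ , α″) →
        ¬q (proj₁ (correct {H = H″} b sb ρ α″) (f H′ (proj₁ un) (proj₂ (correct {H = H′} a sa ρ α′) p) H″ un)) }
    from : _ → _
    from f H′ dis p H″ un with countDom c H′ | FSize-exists _≟_ E (anonFree? c (app H″))
    ... | k , C | r₀ , F =
      let σ′ , sh′ = choice (λ i → shows c (app H′ (c i)))
          σ″ , sh″ = choice (λ i → shows c (app H″ (c i)))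
          eq = FSize-unique E (frees α) (union-size E {H = H″} {H} {H′} (IsUnion-sym {H = H″} {H′} {H} un) (doms α) C F)
      in proj₂ (correct {H = H″} b sb ρ (mkAbs sh″ (union-count E {H = H″} {H′} {H} {r = r} un C (doms α)) F))
        (f k r₀ eq σ′ σ″ (union-split {H = H″} {H′} {H} un inj {σ″} {σ′} {σ} sh″ sh′ (shown α)) (someAnonymous H′ σ′ sh′)
          (proj₁ (correct {H = H′} a sa ρ (mkAbs sh′ C (union-size E {H = H″} {H′} {H} un C (doms α) F))) p))
      where
      -- A stored anonymous value is itself an anonymous location, so their total is not zero.
      someAnonymous : ∀ H′ σ′ → (∀ i → Shows c (app H′ (c i)) (Vec.lookup σ′ i)) → Anonymous σ′ (d ⊞ r)
      someAnonymous H′ σ′ sh′ (i , e) z = go (sh′ i) e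
        where
        nobody : ∀ {v} → ¬ Fresh c v
        nobody {v} f = absurd E (subst (FSize E _) z (FSize-⊎ E (λ p q → proj₁ p (proj₁ q)) (doms α) (frees α)))
          where
          absurd : ∀ E → FSize E (λ u → AnonDom {c = c} (app H) u ⊎ AnonFree {c = c} (app H) u) (fin 0) → ⊥
          absurd (finite _ _) C with nothing? (app H v)
          ... | yes n = Cnt-0 C (inj₂ (n , f))
          ... | no a = Cnt-0 C (inj₁ (a , f))
        go : ∀ {x t} → Shows c x t → t ≡ just nothing → ⊥
        go (anon f) _ = nobody f

-- Prenex formulas and Ehrenfeucht–Fraïssé games

record Str : Set₁ where
  constructor mkStr
  field
    Carrier : Set
    _≟_     : DecidableEquality Carrier
    heap    : Heap Carrier 1
    extent  : Extent Carrier
open Str public using (Carrier; heap; extent)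

hp : (S : Str) → Carrier S → Maybe (Vec (Carrier S) 1)
hp S = app (heap S)

infixr 5 _▹_
_▹_ : ∀ {U : Set} {m} → U → (Fin m → U) → Fin (suc m) → U
(u ▹ c) zero = u
(u ▹ c) (suc i) = c i

▹-injective : ∀ {U : Set} {m} {c : Fin m → U} {u} → Injective _≡_ _≡_ c → Fresh c u → Injective _≡_ _≡_ (u ▹ c)
▹-injective inj f {zero} {zero} e = refl
▹-injective inj f {zero} {suc j} e = contradiction (sym e) (f j)
▹-injective inj f {suc i} {zero} e = contradiction e (f i)
▹-injective inj f {suc i} {suc j} e = cong suc (inj e)

Picks : Set → Set₁
Picks U = ∀ {m} → (Fin m → U) → Store (Fin m) → Set

shift : ∀ {m} → Store (Fin m) → Store (Fin (suc m))
shift e = Maybe.map suc ∘ e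

-- The witness is an old name or a new location. This case distinction keeps the names pairwise
-- distinct, as the abstraction requires, while `e` lets several variables share a name.
Ex : ∀ {U} → Var → Picks U → Picks U
Ex {U} x F {m} c e = (Σ (Fin m) λ i → F c (e [ x ≔ i ])) ⊎ (Σ U λ u → Fresh c u × F (u ▹ c) (shift e [ x ≔ zero ]))

-- The extent is consulted only at the quantifier-free matrix and only through abstract states, so a
-- finite carrier declared infinite can be evaluated by exhaustive search.
ev : ∀ (S : Str) {φ} → Prenex φ → Picks (Carrier S)
ev S (pre-qf {φ} _) c e =
  let σ , d , r , _ = Locations.abstraction (Str._≟_ S) (extent S) c (heap S) in ⟦ φ ⟧ e σ d r
ev S (pre-∃ {x} p) c e = Ex x (ev S p) c e
ev S (pre-∀ {x} p) c e = ¬ Ex x (λ c e → ¬ ev S p c e) c e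

depth : ∀ {φ : Form 1} → Prenex φ → ℕ
depth (pre-qf _) = 0
depth (pre-∃ p) = suc (depth p)
depth (pre-∀ p) = suc (depth p)

module _ {U : Set} (_≟_ : DecidableEquality U) (s : Searchable U) where

  Ex? : ∀ x {F : Picks U} → (∀ {m} (c : Fin m → U) e → Dec (F c e)) → ∀ {m} (c : Fin m → U) e → Dec (Ex x F c e)
  Ex? x F? c e = search-Fin (λ i → F? c _) ⊎-dec s (λ u → Locations.fresh? _≟_ c u ×-dec F? (u ▹ c) _)

ev? : ∀ (S : Str) → Searchable (Carrier S) → ∀ {φ} (p : Prenex φ) {m} (c : Fin m → Carrier S) e → Dec (ev S p c e)
ev? S s (pre-qf q) c e = ⟦⟧? q e _ _ _
ev? S s (pre-∃ {x} p) c e = Ex? (Str._≟_ S) s x {ev S p} (ev? S s p) c e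
ev? S s (pre-∀ {x} p) c e = ¬? (Ex? (Str._≟_ S) s x {λ c e → ¬ ev S p c e} (λ c e → ¬? (ev? S s p c e)) c e)

module _ (S : Str) (truth : Truthful (extent S)) where
  open Str S using (_≟_)

  private
    Sees-named : ∀ {m} {c : Fin m → Carrier S} {bs s e x i} → Sees c bs s e → Sees c (x ∷ bs) (s [ x ≔ c i ]) (e [ x ≔ i ])
    Sees-named {x = x} ρ {y} y∈ with y ℕ.≟ x | y∈
    ... | yes _ | _ = _ , refl , refl
    ... | no n | here e = contradiction e n
    ... | no _ | there p = ρ p

    Sees-fresh : ∀ {m} {c : Fin m → Carrier S} {bs s e x u} → Sees c bs s e → Sees (u ▹ c) (x ∷ bs) (s [ x ≔ u ]) (shift e [ x ≔ zero ])
    Sees-fresh {x = x} ρ {y} y∈ with y ℕ.≟ x | y∈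
    ... | yes _ | _ = zero , refl , refl
    ... | no n | here e = contradiction e n
    ... | no _ | there p = let i , a , b = ρ p in suc i , cong (Maybe.map suc) a , b

  ev-correct : ∀ {φ} (p : Prenex φ) {bs m} {c : Fin m → Carrier S} {s e} → Injective _≡_ _≡_ c → ScopedIn bs φ → Sees c bs s e →
    ((Carrier S , s , heap S ⊨ φ) → ev S p c e) × (ev S p c e → Carrier S , s , heap S ⊨ φ)
  ev-correct (pre-qf q) {c = c} inj sc ρ = Correctness.correct _≟_ (extent S) truth c inj {H = heap S} q sc ρ
    (proj₂ (proj₂ (proj₂ (Locations.abstraction _≟_ (extent S) c (heap S)))))
  ev-correct (pre-∃ {x} {φ} p) {bs} {m} {c} {s} {e} inj (sc-∃ sc) ρ = to , from
    where
    to : (Σ (Carrier S) λ u → Carrier S , (s [ x ≔ u ]) , heap S ⊨ φ) → Ex x (ev S p) c e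
    to (u , t) with Locations.named? _≟_ c u
    ... | inj₁ (i , refl) = inj₁ (i , proj₁ (ev-correct p inj sc (Sees-named {s = s} {e} ρ)) t)
    ... | inj₂ f = inj₂ (u , f , proj₁ (ev-correct p (▹-injective inj f) sc (Sees-fresh {s = s} {e} ρ)) t)
    from : Ex x (ev S p) c e → Σ (Carrier S) λ u → Carrier S , (s [ x ≔ u ]) , heap S ⊨ φ
    from (inj₁ (i , t)) = c i , proj₂ (ev-correct p inj sc (Sees-named {s = s} {e} ρ)) t
    from (inj₂ (u , f , t)) = u , proj₂ (ev-correct p (▹-injective inj f) sc (Sees-fresh {s = s} {e} ρ)) t
  ev-correct (pre-∀ {x} {φ} p) {bs} {m} {c} {s} {e} inj (sc-¬ (sc-∃ (sc-¬ sc))) ρ = _∘ from , _∘ to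
    where
    F : Picks (Carrier S)
    F c e = ¬ ev S p c e
    to : (Σ (Carrier S) λ u → ¬ (Carrier S , (s [ x ≔ u ]) , heap S ⊨ φ)) → Ex x F c e
    to (u , t) with Locations.named? _≟_ c u
    ... | inj₁ (i , refl) = inj₁ (i , t ∘ proj₂ (ev-correct p inj sc (Sees-named {s = s} {e} ρ)))
    ... | inj₂ f = inj₂ (u , f , t ∘ proj₂ (ev-correct p (▹-injective inj f) sc (Sees-fresh {s = s} {e} ρ)))
    from : Ex x F c e → Σ (Carrier S) λ u → ¬ (Carrier S , (s [ x ≔ u ]) , heap S ⊨ φ)
    from (inj₁ (i , t)) = c i , t ∘ proj₁ (ev-correct p inj sc (Sees-named {s = s} {e} ρ))
    from (inj₂ (u , f , t)) = u , t ∘ proj₁ (ev-correct p (▹-injective inj f) sc (Sees-fresh {s = s} {e} ρ))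

-- Game equivalence and transfer of evaluation

record Half (S : Str) {m} (c : Fin m → Carrier S) (T : Str) (d : Fin m → Carrier T) : Set where
  constructor mkHalf
  field
    eq→ : ∀ {i j} → c i ≡ c j → d i ≡ d j
    pt→ : ∀ {i j} → hp S (c i) ≡ just (c j ∷ []) → hp T (d i) ≡ just (d j ∷ [])
    al→ : ∀ {i} → hp S (c i) ≡ nothing → hp T (d i) ≡ nothing
open Half public

Doms : (S : Str) {m : ℕ} → (Fin m → Carrier S) → ℕ → Set
Doms S c = Cnt (AnonDom {c = c} (hp S))

Frees : (S : Str) {m : ℕ} → (Fin m → Carrier S) → ℕ∞ → Set
Frees S c = FSize (extent S) (AnonFree {c = c} (hp S))

-- The winning condition at the end of a play. The partial isomorphism is stated as two one-sided
-- conditions, so that many proofs treat one side and obtain the other by exchange.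
record Sim (N : ℕ) (S : Str) {m} (c : Fin m → Carrier S) (T : Str) (d : Fin m → Carrier T) : Set where
  constructor mkSim
  field
    forth : Half S c T d
    back  : Half T d S c
    dom≈  : Σ ℕ λ k → Σ ℕ λ l → Doms S c k × Doms T d l × k ≈[ N ] l
    free≈ : Σ ℕ∞ λ k → Σ ℕ∞ λ l → Frees S c k × Frees T d l × k ≈∞[ N ] l
open Sim public

Sim-sym : ∀ {N S T m} {c : Fin m → Carrier S} {d : Fin m → Carrier T} → Sim N S c T d → Sim N T d S c
Sim-sym (mkSim f b (k , l , C , D , e) (k′ , l′ , C′ , D′ , e′)) =
  mkSim b f (l , k , D , C , ≈-sym e) (l′ , k′ , D′ , C′ , ≈∞-sym e′)

Half-trans : ∀ {S T R : Str} {m} {c : Fin m → Carrier S} {d : Fin m → Carrier T} {e : Fin m → Carrier R} →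
  Half S c T d → Half T d R e → Half S c R e
Half-trans (mkHalf a b c) (mkHalf a′ b′ c′) = mkHalf (a′ ∘ a) (b′ ∘ b) (c′ ∘ c)

Sim-trans : ∀ {N S T R m} {c : Fin m → Carrier S} {d : Fin m → Carrier T} {e : Fin m → Carrier R} →
  Sim N S c T d → Sim N T d R e → Sim N S c R e
Sim-trans {T = T} (mkSim f b (_ , _ , C , D , p) (_ , _ , C′ , D′ , p′)) (mkSim g h (_ , _ , E , F , q) (_ , _ , E′ , F′ , q′)) =
  mkSim (Half-trans f g) (Half-trans h b)
    (-, -, C , F , ≈-trans p (subst (_≈[ _ ] _) (Cnt-unique E D) q))
    (-, -, C′ , F′ , ≈∞-trans p′ (subst (_≈∞[ _ ] _) (FSize-unique (extent T) E′ D′) q′))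

record Modality : Set₁ where
  field
    M      : Set → Set
    return : A → M A
    _>>=_  : M A → (A → M B) → M B
    run    : ¬ M ⊥

  _<&>_ : M A → (A → B) → M B
  x <&> f = x >>= (return ∘ f)

-- Witnesses are real ones under the identity modality; under double negation they cover
-- infinite carriers from which elements cannot be drawn constructively.
identity doubleNegation : Modality
identity = record { M = id ; return = id ; _>>=_ = λ x f → f x ; run = id }
doubleNegation = record { M = ¬¬_ ; return = λ x k → k x ; _>>=_ = λ x f k → x (λ a → f a k) ; run = λ k → k id }

bound : ∀ {φ : Form 1} → Prenex φ → ℕ
bound (pre-qf {φ} _) = threshold φ
bound (pre-∃ p) = bound p
bound (pre-∀ p) = bound p

module Game (𝓜 : Modality) (N : ℕ) where
  open Modality 𝓜

  -- Moves name new locations only. Including the shorter game in `EF (suc n)` allows a round to be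
  -- skipped, which is what a quantifier choosing an old name does.
  EF : ℕ → (S : Str) {m : ℕ} → (Fin m → Carrier S) → (T : Str) → (Fin m → Carrier T) → Set
  EF zero S c T d = Sim N S c T d
  EF (suc n) S c T d = EF n S c T d ×
    (∀ u → Fresh c u → M (Σ (Carrier T) λ v → Fresh d v × EF n S (u ▹ c) T (v ▹ d))) ×
    (∀ v → Fresh d v → M (Σ (Carrier S) λ u → Fresh c u × EF n S (u ▹ c) T (v ▹ d)))

  EF⇒Sim : ∀ n {S T m} {c : Fin m → Carrier S} {d : Fin m → Carrier T} → EF n S c T d → Sim N S c T d
  EF⇒Sim zero E = E
  EF⇒Sim (suc n) (E , _) = EF⇒Sim n E

  EF-sym : ∀ n {S T m} {c : Fin m → Carrier S} {d : Fin m → Carrier T} → EF n S c T d → EF n T d S c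
  EF-sym zero E = Sim-sym E
  EF-sym (suc n) (E , f , b) = EF-sym n E ,
    (λ v fr → b v fr <&> λ (u , fr′ , E′) → u , fr′ , EF-sym n E′) ,
    (λ u fr → f u fr <&> λ (v , fr′ , E′) → v , fr′ , EF-sym n E′)

  EF-trans : ∀ n {S T R m} {c : Fin m → Carrier S} {d : Fin m → Carrier T} {e : Fin m → Carrier R} →
    EF n S c T d → EF n T d R e → EF n S c R e
  EF-trans zero E F = Sim-trans E F
  EF-trans (suc n) (E , f , b) (F , g , h) = EF-trans n E F ,
    (λ u fr → f u fr >>= λ (v , fr′ , E′) → g v fr′ <&> λ (w , fr″ , F′) → w , fr″ , EF-trans n E′ F′) ,
    (λ w fr → h w fr >>= λ (v , fr′ , F′) → b v fr′ <&> λ (u , fr″ , E′) → u , fr″ , EF-trans n E′ F′)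

  private
    Sim-pattern : ∀ {S T m} {c : Fin m → Carrier S} {d : Fin m → Carrier T} → Injective _≡_ _≡_ c → Injective _≡_ _≡_ d →
      Sim N S c T d → ∀ i {t t′} → Shows c (hp S (c i)) t → Shows d (hp T (d i)) t′ → t ≡ t′
    Sim-pattern {S} {T} {c = c} {d} injc injd sim i p q with hp S (c i) in eqS | hp T (d i) in eqT | p | q
    ... | _ | _ | none | none = refl
    ... | _ | _ | anon f | anon g = refl
    ... | _ | _ | none | anon _ with () ← trans (sym eqT) (al→ (forth sim) eqS)
    ... | _ | _ | none | named _ _ with () ← trans (sym eqT) (al→ (forth sim) eqS)
    ... | _ | _ | anon _ | none with () ← trans (sym eqS) (al→ (back sim) eqT)
    ... | _ | _ | named _ _ | none with () ← trans (sym eqS) (al→ (back sim) eqT)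
    ... | _ | _ | anon f | named j refl = contradiction (Vecₚ.∷-injectiveˡ (Maybeₚ.just-injective (trans (sym (pt→ (back sim) eqT)) eqS))) (f j)
    ... | _ | _ | named j refl | anon f = contradiction (Vecₚ.∷-injectiveˡ (Maybeₚ.just-injective (trans (sym (pt→ (forth sim) eqS)) eqT))) (f j)
    ... | _ | _ | named j refl | named k e = cong (just ∘ just)
      (injd (trans (Vecₚ.∷-injectiveˡ (Maybeₚ.just-injective (trans (sym (pt→ (forth sim) eqS)) eqT))) (sym e)))

  EF-ev : ∀ {φ} (p : Prenex φ) → bound p ≤ N → ∀ {S T m} {c : Fin m → Carrier S} {d : Fin m → Carrier T} {e} →
    Injective _≡_ _≡_ c → Injective _≡_ _≡_ d → EF (depth p) S c T d → ev S p c e → M (ev T p d e)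
  EF-ev (pre-qf {φ} q) le {S} {T} {m} {c} {d} {e} injc injd sim x
    with dom≈ sim | free≈ sim
  ... | _ , _ , C , D , p | _ , _ , F , G , s =
    return (⟦⟧-resp q le (subst₂ _≈[ N ]_ (Cnt-unique C (doms α)) (Cnt-unique D (doms α′)) p)
      (subst₂ _≈∞[ N ]_ (FSize-unique (extent S) F (frees α)) (FSize-unique (extent T) G (frees α′)) s)
      (subst (λ σ → ⟦ φ ⟧ e σ _ _) σ≡ x))
    where
    α = proj₂ (proj₂ (proj₂ (Locations.abstraction (Str._≟_ S) (extent S) c (heap S))))
    α′ = proj₂ (proj₂ (proj₂ (Locations.abstraction (Str._≟_ T) (extent T) d (heap T))))
    σ = proj₁ (Locations.abstraction (Str._≟_ S) (extent S) c (heap S))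
    σ′ = proj₁ (Locations.abstraction (Str._≟_ T) (extent T) d (heap T))
    σ≡ : σ ≡ σ′
    σ≡ = trans (sym (Vecₚ.tabulate∘lookup σ)) (trans (Vecₚ.tabulate-cong
      (λ i → Sim-pattern injc injd sim i (shown α i) (shown α′ i))) (Vecₚ.tabulate∘lookup σ′))
  EF-ev (pre-∃ p) le injc injd (E , f , b) (inj₁ (i , x)) = EF-ev p le injc injd E x <&> λ y → inj₁ (i , y)
  EF-ev (pre-∃ p) le injc injd (E , f , b) (inj₂ (u , fr , x)) = f u fr >>= λ (v , fr′ , E′) →
    EF-ev p le (▹-injective injc fr) (▹-injective injd fr′) E′ x <&> λ y → inj₂ (v , fr′ , y)
  -- A universal formula is a negation, so the opponent's witness need only be refuted, and a
  -- contradiction can leave the modality by `run`.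
  EF-ev (pre-∀ p) le injc injd (E , f , b) ¬ex = return λ where
    (inj₁ (i , ¬y)) → ¬ex (inj₁ (i , λ x → run (EF-ev p le injc injd E x <&> ¬y)))
    (inj₂ (v , fr , ¬y)) → run (b v fr <&> λ (u , fr′ , E′) → ¬ex (inj₂ (u , fr′ , λ x →
      run (EF-ev p le (▹-injective injc fr′) (▹-injective injd fr) E′ x <&> ¬y))))

-- Isomorphisms, reindexing, edges and sums

Cnt-along : ∀ {A B : Set} {P : A → Set} {Q : B → Set} (R : A → B → Set) {k} →
  (∀ {x} → P x → Σ B λ y → Q y × R x y) → (∀ {y} → Q y → Σ A λ x → P x × R x y) →
  (∀ {x x′ y} → R x y → R x′ y → x ≡ x′) → (∀ {x y y′} → R x y → R x y′ → y ≡ y′) → Cnt P k → Cnt Q k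
Cnt-along {A} {B} {P} {Q} R f g inj fun (mkCnt xs u s c l) with images xs u s
  where
  images : ∀ xs → Unique xs → (∀ {x} → x ∈ xs → P x) → Σ (List B) λ ys → Unique ys × length ys ≡ length xs ×
    (∀ {y} → y ∈ ys → Q y × Σ A λ x → x ∈ xs × R x y) × (∀ {x} → x ∈ xs → Σ B λ y → y ∈ ys × R x y)
  images [] _ _ = [] , [] , refl , (λ ()) , (λ ())
  images (x ∷ xs) u@(_ ∷ uxs) s with images xs uxs (s ∘ there) | f (s (here refl))
  ... | ys , uys , e , so , co | y , qy , r = y ∷ ys ,
    All.tabulate (λ { z∈ refl → let _ , x′ , x′∈ , r′ = so z∈ in
      Uniqueₚ.Unique[x∷xs]⇒x∉xs u (subst (_∈ xs) (inj r′ r) x′∈) }) ∷ uys ,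
    cong suc e ,
    (λ { (here refl) → qy , x , here refl , r ; (there p) → let q , x′ , x′∈ , r′ = so p in q , x′ , there x′∈ , r′ }) ,
    (λ { (here refl) → y , here refl , r ; (there p) → let y′ , y∈ , r′ = co p in y′ , there y∈ , r′ })
... | ys , uys , e , so , co = mkCnt ys uys (proj₁ ∘ so)
  (λ q → let x , p , r = g q ; y′ , y∈ , r′ = co (c p) in subst (_∈ ys) (fun r′ r) y∈) (trans e l)

data SameKind {U V : Set} : Extent U → Extent V → Set where
  finite   : ∀ {xs ys a b} → SameKind (finite xs a) (finite ys b)
  infinite : SameKind infinite infinite

FSize-along : ∀ {A B : Set} {P : A → Set} {Q : B → Set} {E : Extent A} {F : Extent B} → SameKind E F → (R : A → B → Set) → ∀ {r} →
  (∀ {x} → P x → Σ B λ y → Q y × R x y) → (∀ {y} → Q y → Σ A λ x → P x × R x y) →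
  (∀ {x x′ y} → R x y → R x′ y → x ≡ x′) → (∀ {x y y′} → R x y → R x y′ → y ≡ y′) → FSize E P r → FSize F Q r
FSize-along finite R {fin _} f g i h C = Cnt-along R f g i h C
FSize-along infinite R {∞} f g i h C = tt

cell : (A → B) → Maybe (Vec A 1) → Maybe (Vec B 1)
cell f = Maybe.map (Vec.map f)

cell-injective : {f : A → B} → (∀ {x y} → f x ≡ f y → x ≡ y) → ∀ {x y} → cell f x ≡ cell f y → x ≡ y
cell-injective inj {just (x ∷ [])} {just (y ∷ [])} e = cong (just ∘ (_∷ [])) (inj (Vecₚ.∷-injectiveˡ (Maybeₚ.just-injective e)))
cell-injective inj {nothing} {nothing} e = refl

cell-≢ : {f : A → B} → ∀ {x} → cell f x ≢ nothing → x ≢ nothing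
cell-≢ n refl = n refl

cell-≢⁺ : {f : A → B} → ∀ {x} → x ≢ nothing → cell f x ≢ nothing
cell-≢⁺ {x = just _} _ ()
cell-≢⁺ {x = nothing} n _ = n refl

record Iso (S T : Str) : Set where
  field
    to       : Carrier S → Carrier T
    from     : Carrier T → Carrier S
    to-from  : ∀ y → to (from y) ≡ y
    from-to  : ∀ x → from (to x) ≡ x
    to-heap  : ∀ x → hp T (to x) ≡ cell to (hp S x)
    kind     : SameKind (extent S) (extent T)

  to-injective : ∀ {x y} → to x ≡ to y → x ≡ y
  to-injective {x} {y} e = trans (sym (from-to x)) (trans (cong from e) (from-to y))

Sim-iso : ∀ {N S T} (I : Iso S T) {m} {c : Fin m → Carrier S} {d : Fin m → Carrier T} →
  (∀ i → Iso.to I (c i) ≡ d i) → Sim N S c T d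
Sim-iso {N} {S} {T} I {m} {c} {d} ≗ = mkSim
  (mkHalf (λ {i} {j} e → trans (sym (≗ i)) (trans (cong to e) (≗ j)))
    (λ {i} {j} e → trans (heap-at i) (trans (cong (cell to) e) (cong (just ∘ (_∷ [])) (≗ j))))
    (λ {i} e → trans (heap-at i) (cong (cell to) e)))
  (mkHalf (λ {i} {j} e → to-injective (trans (≗ i) (trans e (sym (≗ j)))))
    (λ {i} {j} e → cell-injective to-injective (trans (sym (heap-at i)) (trans e (cong (just ∘ (_∷ [])) (sym (≗ j))))))
    (λ {i} e → cell-injective to-injective (trans (sym (heap-at i)) e)))
  (let k , C = Locations.countDom (Str._≟_ S) c (heap S) in k , k , C ,
    Cnt-along Graph (λ {x} (n , f) → to x , ((λ e → n (cell-injective to-injective (trans (sym (to-heap x)) e))) , fresh f) , refl)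
      (λ {y} (n , f) → from y , ((λ e → n (trans (cong (hp T) (sym (to-from y))) (trans (to-heap _) (cong (cell to) e)))) , unfresh f) , to-from y)
      (λ p q → to-injective (trans p (sym q))) (λ p q → trans (sym p) q) C , same refl)
  (let r , F = FSize-exists (Str._≟_ S) (extent S) (Locations.anonFree? (Str._≟_ S) c (hp S)) in r , r , F ,
    FSize-along kind Graph (λ {x} (n , f) → to x , (trans (to-heap x) (cong (cell to) n) , fresh f) , refl)
      (λ {y} (n , f) → from y , (cell-injective to-injective (trans (sym (to-heap _)) (trans (cong (hp T) (to-from y)) n)) , unfresh f) , to-from y)
      (λ p q → to-injective (trans p (sym q))) (λ p q → trans (sym p) q) F , ≈∞-refl)
  where
  open Iso I
  Graph : Carrier S → Carrier T → Set
  Graph x y = to x ≡ y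
  heap-at : ∀ i → hp T (d i) ≡ cell to (hp S (c i))
  heap-at i = trans (cong (hp T) (sym (≗ i))) (to-heap (c i))
  fresh : ∀ {x} → Fresh c x → Fresh d (to x)
  fresh f i e = f i (to-injective (trans (≗ i) e))
  unfresh : ∀ {y} → Fresh d y → Fresh c (from y)
  unfresh {y} f i e = f i (trans (sym (≗ i)) (trans (cong to e) (to-from y)))

-- Dropping names raises the anonymous counts by the number of dropped locations, the same on both sides.
Sim-reindex : ∀ {N S T m m′} {c : Fin m → Carrier S} {c′ : Fin m → Carrier T} {d : Fin m′ → Carrier S} {d′ : Fin m′ → Carrier T} →
  (∀ i → Σ (Fin m) λ j → c j ≡ d i × c′ j ≡ d′ i) → Sim N S c T c′ → Sim N S d T d′
Sim-reindex {N} {S} {T} {m} {m′} {c} {c′} {d} {d′} incl sim = mkSim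
    (half {S} {T} {c} {c′} {d} {d′} incl (forth sim)) (half {T} {S} {c′} {c} {d′} {d} incl′ (back sim))
    (let k , l , C , D , e = dom≈ sim
         x , X , Y = extra (Alloc S) (λ u → ¬? (nothing? (hp S u))) (Alloc T)
           (_∘ al→ (back sim)) (_∘ al→ (forth sim))
     in x + k , x + l , Cnt-resp (join {S} (Alloc S) incl) (Cnt-⊎ (disjoint (Alloc S)) X C) ,
        Cnt-resp (join {T} (Alloc T) incl′) (Cnt-⊎ (disjoint (Alloc T)) Y D) , ≈-+ {x} (same refl) e)
    (let k , l , C , D , e = free≈ sim
         x , X , Y = extra (Free S) (λ u → nothing? (hp S u)) (Free T)
           (al→ (forth sim)) (al→ (back sim))
     in x ⊞ k , x ⊞ l , FSize-resp (extent S) (join {S} (Free S) incl) (FSize-⊎ (extent S) (disjoint (Free S)) X C) ,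
       FSize-resp (extent T) (join {T} (Free T) incl′) (FSize-⊎ (extent T) (disjoint (Free T)) Y D) , ≈-⊞ {x} (same refl) e)
  where
  Alloc Free : (S : Str) → Carrier S → Set
  Alloc S u = hp S u ≢ nothing
  Free S u = hp S u ≡ nothing
  incl′ : ∀ i → Σ (Fin m) λ j → c′ j ≡ d′ i × c j ≡ d i
  incl′ i = Product.map₂ Product.swap (incl i)
  half : ∀ {S T} {c : Fin m → Carrier S} {c′ : Fin m → Carrier T} {d : Fin m′ → Carrier S} {d′ : Fin m′ → Carrier T} →
    (∀ i → Σ (Fin m) λ j → c j ≡ d i × c′ j ≡ d′ i) → Half S c T c′ → Half S d T d′
  half {S} {T} {c} {c′} {d} {d′} incl H = mkHalf eq pt al
    where
    eq : ∀ {i j} → d i ≡ d j → d′ i ≡ d′ j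
    eq {i} {j} e with incl i | incl j
    ... | i′ , p , q | j′ , p′ , q′ = trans (sym q) (trans (eq→ H (trans p (trans e (sym p′)))) q′)
    pt : ∀ {i j} → hp S (d i) ≡ just (d j ∷ []) → hp T (d′ i) ≡ just (d′ j ∷ [])
    pt {i} {j} e with incl i | incl j
    ... | i′ , p , q | j′ , p′ , q′ = trans (cong (hp T) (sym q)) (trans (pt→ H (trans (cong (hp S) p)
      (trans e (cong (just ∘ (_∷ [])) (sym p′))))) (cong (just ∘ (_∷ [])) q′))
    al : ∀ {i} → hp S (d i) ≡ nothing → hp T (d′ i) ≡ nothing
    al {i} e with incl i
    ... | i′ , p , q = trans (cong (hp T) (sym q)) (al→ H (trans (cong (hp S) p) e))
  Extra : ∀ {U : Set} (W : U → Set) (c : Fin m → U) (d : Fin m′ → U) → U → Set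
  Extra W c d u = (W u × Fresh d u) × Σ (Fin m) λ i → c i ≡ u
  disjoint : ∀ {U : Set} (W : U → Set) {c : Fin m → U} {d : Fin m′ → U} {u} → Extra W c d u → W u × Fresh c u → ⊥
  disjoint _ (_ , i , e) (_ , f) = f i e
  join : ∀ {S : Str} {V : Set} (W : Carrier S → Set) {c : Fin m → Carrier S} {d : Fin m′ → Carrier S} {c′ : Fin m → V} {d′ : Fin m′ → V} →
    (∀ i → Σ (Fin m) λ j → c j ≡ d i × c′ j ≡ d′ i) →
    (λ u → Extra W c d u ⊎ (W u × Fresh c u)) ≐ (λ u → W u × Fresh d u)
  join {S} W {c} {d} incl = [ proj₁ , (λ (w , f) → w , λ i e → let j , p , _ = incl i in f j (trans p e)) ]′ , from
    where
    from : ∀ {u} → W u × Fresh d u → Extra W c d u ⊎ (W u × Fresh c u)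
    from {u} (w , f) with Locations.named? (Str._≟_ S) c u
    ... | inj₁ p = inj₁ ((w , f) , p)
    ... | inj₂ g = inj₂ (w , g)
  extra : (W : Carrier S → Set) → Decidable W → (W′ : Carrier T → Set) → (∀ {i} → W (c i) → W′ (c′ i)) → (∀ {i} → W′ (c′ i) → W (c i)) →
    Σ ℕ λ k → Cnt (Extra W c d) k × Cnt (Extra W′ c′ d′) k
  extra W W? W′ f g with Cnt-cover (Str._≟_ S)
    (λ u → (W? u ×-dec Locations.fresh? (Str._≟_ S) d u) ×-dec Finₚ.any? (λ i → Str._≟_ S (c i) u))
    (List.tabulate c) (λ { (_ , i , refl) → ∈ₚ.∈-tabulate⁺ i })
  ... | k , C = k , C , Cnt-along (λ u v → Σ (Fin m) λ i → c i ≡ u × c′ i ≡ v)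
    (λ { ((w , fr) , i , refl) → c′ i , ((f w , λ j e → let j′ , p , q = incl j in
      fr j (trans (sym p) (eq→ (back sim) (trans q e)))) , i , refl) , i , refl , refl })
    (λ { ((w , fr) , i , refl) → c i , ((g w , λ j e → let j′ , p , q = incl j in
      fr j (trans (sym q) (eq→ (forth sim) (trans p e)))) , i , refl) , i , refl , refl })
    (λ { (i , refl , p) (j , refl , q) → eq→ (back sim) (trans p (sym q)) })
    (λ { (i , p , refl) (j , q , refl) → eq→ (forth sim) (trans p (sym q)) }) C

setHeap : ∀ {U} → DecidableEquality U → U → U → Heap U 1 → Heap U 1
setHeap {U} _≟_ a x (h , xs , cov) = h′ , a ∷ xs , cov′
  where
  h′ : U → Maybe (Vec U 1)
  h′ u with u ≟ a
  ... | yes _ = just (x ∷ [])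
  ... | no _ = h u
  cov′ : ∀ u → h′ u ≢ nothing → u ∈ a ∷ xs
  cov′ u n with u ≟ a
  ... | yes e = here e
  ... | no _ = there (cov u n)

set : (S : Str) → Carrier S → Carrier S → Str
set (mkStr U _≟_ H E) a x = mkStr U _≟_ (setHeap _≟_ a x H) E

set-at : ∀ S {a x u} → u ≡ a → hp (set S a x) u ≡ just (x ∷ [])
set-at S {a} {x} {u} e with Str._≟_ S u a
... | yes _ = refl
... | no n = contradiction e n

set-off : ∀ S {a x u} → u ≢ a → hp (set S a x) u ≡ hp S u
set-off S {a} {x} {u} n with Str._≟_ S u a
... | yes e = contradiction e n
... | no _ = refl

-- The rewritten cell is named before and after, so no anonymous count changes. Which named cells
-- differ from it agrees on both sides by the opposite half of the partial isomorphism.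
Sim-set : ∀ {N S T m} {c : Fin m → Carrier S} {d : Fin m → Carrier T} i j → Sim N S c T d →
  Sim N (set S (c i) (c j)) c (set T (d i) (d j)) d
Sim-set {N} {S} {T} {m} {c} {d} i j sim = mkSim (half {S} {T} {c} {d} (forth sim) (back sim)) (half {T} {S} {d} {c} (back sim) (forth sim))
    (let k , l , C , D , e = dom≈ sim in k , l , Cnt-resp (resp S (_≢ nothing)) C , Cnt-resp (resp T (_≢ nothing)) D , e)
    (let k , l , C , D , e = free≈ sim in k , l , FSize-resp (extent S) (resp S (_≡ nothing)) C , FSize-resp (extent T) (resp T (_≡ nothing)) D , e)
  where
  half : ∀ {S T} {c : Fin m → Carrier S} {d : Fin m → Carrier T} → Half S c T d → Half T d S c →
    Half (set S (c i) (c j)) c (set T (d i) (d j)) d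
  half {S} {T} {c} {d} H H′ = mkHalf (eq→ H) pt al
    where
    pt : ∀ {k l} → hp (set S (c i) (c j)) (c k) ≡ just (c l ∷ []) → hp (set T (d i) (d j)) (d k) ≡ just (d l ∷ [])
    pt {k} {l} e with Str._≟_ S (c k) (c i)
    ... | yes p = trans (set-at T (eq→ H p)) (cong (just ∘ (_∷ [])) (eq→ H (Vecₚ.∷-injectiveˡ (Maybeₚ.just-injective e))))
    ... | no n = trans (set-off T (n ∘ eq→ H′)) (pt→ H e)
    al : ∀ {k} → hp (set S (c i) (c j)) (c k) ≡ nothing → hp (set T (d i) (d j)) (d k) ≡ nothing
    al {k} e with Str._≟_ S (c k) (c i)
    ... | no n = trans (set-off T (n ∘ eq→ H′)) (al→ H e)
  resp : ∀ S {c : Fin m → Carrier S} (X : Maybe (Vec (Carrier S) 1) → Set) →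
    (λ u → X (hp S u) × Fresh c u) ≐ (λ u → X (hp (set S (c i) (c j)) u) × Fresh c u)
  resp S X = (λ (w , f) → subst X (sym (set-off S (λ e → f i (sym e)))) w , f) ,
    (λ (w , f) → subst X (set-off S (λ e → f i (sym e))) w , f)

sumHeap : ∀ {A B : Set} → (A → Maybe (Vec A 1)) → (B → Maybe (Vec B 1)) → A ⊎ B → Maybe (Vec (A ⊎ B) 1)
sumHeap g h (inj₁ a) = cell inj₁ (g a)
sumHeap g h (inj₂ b) = cell inj₂ (h b)

sumExtent : ∀ {A B : Set} → Extent A → Extent B → Extent (A ⊎ B)
sumExtent (finite xs a) (finite ys b) = finite (List.map inj₁ xs ++ List.map inj₂ ys)
  [ (λ u → ∈ₚ.∈-++⁺ˡ (∈ₚ.∈-map⁺ inj₁ (a u))) , (λ u → ∈ₚ.∈-++⁺ʳ (List.map inj₁ xs) (∈ₚ.∈-map⁺ inj₂ (b u))) ]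
sumExtent _ _ = infinite

infixr 4 _⊎ₛ_
_⊎ₛ_ : Str → Str → Str
mkStr A _≟A_ (g , xs , covg) E ⊎ₛ mkStr B _≟B_ (h , ys , covh) F =
  mkStr (A ⊎ B) (Sumₚ.≡-dec _≟A_ _≟B_) (sumHeap g h , List.map inj₁ xs ++ List.map inj₂ ys , cov) (sumExtent E F)
  where
  cov : ∀ u → sumHeap g h u ≢ nothing → u ∈ List.map inj₁ xs ++ List.map inj₂ ys
  cov (inj₁ a) n = ∈ₚ.∈-++⁺ˡ (∈ₚ.∈-map⁺ inj₁ (covg a (cell-≢ n)))
  cov (inj₂ b) n = ∈ₚ.∈-++⁺ʳ (List.map inj₁ xs) (∈ₚ.∈-map⁺ inj₂ (covh b (cell-≢ n)))

sumNames : ∀ {A B : Set} {m n} → (Fin m → A) → (Fin n → B) → Fin (m + n) → A ⊎ B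
sumNames {m = m} c d i = Sum.map c d (splitAt m i)

sum-fresh₁ : ∀ {A B : Set} {m n} {c : Fin m → A} (d : Fin n → B) {a} → Fresh c a → Fresh (sumNames c d) (inj₁ a)
sum-fresh₁ {m = m} d f i e with splitAt m i | e
... | inj₁ j | refl = f j refl

sum-fresh₂ : ∀ {A B : Set} {m n} (c : Fin m → A) {d : Fin n → B} {b} → Fresh d b → Fresh (sumNames c d) (inj₂ b)
sum-fresh₂ {m = m} c f i e with splitAt m i | e
... | inj₂ j | refl = f j refl

sum-fresh₁⁻ : ∀ {A B : Set} {m n} {c : Fin m → A} (d : Fin n → B) {a} → Fresh (sumNames c d) (inj₁ a) → Fresh c a
sum-fresh₁⁻ {m = m} {n} {c} d f i e = f (i ↑ˡ n) (trans (cong (Sum.map c d) (Finₚ.splitAt-↑ˡ m i n)) (cong inj₁ e))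

sum-fresh₂⁻ : ∀ {A B : Set} {m n} (c : Fin m → A) {d : Fin n → B} {b} → Fresh (sumNames c d) (inj₂ b) → Fresh d b
sum-fresh₂⁻ {m = m} {n} c {d} f i e = f (m ↑ʳ i) (trans (cong (Sum.map c d) (Finₚ.splitAt-↑ʳ m n i)) (cong inj₂ e))

module _ {S T : Str} {m n : ℕ} {c : Fin m → Carrier S} {d : Fin n → Carrier T} where

  private
    Images : (Carrier S → Set) → (Carrier T → Set) → Carrier S ⊎ Carrier T → Set
    Images P Q y = (Σ _ λ a → P a × inj₁ a ≡ y) ⊎ (Σ _ λ b → Q b × inj₂ b ≡ y)

    images-disjoint : ∀ {P : Carrier S → Set} {Q : Carrier T → Set} {y : Carrier S ⊎ Carrier T} →
      (Σ _ λ a → P a × inj₁ a ≡ y) → (Σ _ λ b → Q b × inj₂ b ≡ y) → ⊥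
    images-disjoint (_ , _ , refl) (_ , _ , ())

    sum-≐ : (X : ∀ {U : Set} → Maybe (Vec U 1) → Set) →
      (∀ {U V : Set} (f : U → V) {x} → X x → X (cell f x)) → (∀ {U V : Set} (f : U → V) {x} → X (cell f x) → X x) →
      Images (λ u → X (hp S u) × Fresh c u) (λ u → X (hp T u) × Fresh d u) ≐ (λ u → X (hp (S ⊎ₛ T) u) × Fresh (sumNames c d) u)
    sum-≐ X up down = [ (λ { (a , (w , f) , refl) → up inj₁ w , sum-fresh₁ d f }) , (λ { (b , (w , f) , refl) → up inj₂ w , sum-fresh₂ c f }) ]′ , from
      where
      from : ∀ {u} → X (hp (S ⊎ₛ T) u) × Fresh (sumNames c d) u → _
      from {inj₁ a} (w , f) = inj₁ (a , (down inj₁ w , sum-fresh₁⁻ d f) , refl)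
      from {inj₂ b} (w , f) = inj₂ (b , (down inj₂ w , sum-fresh₂⁻ c f) , refl)

    FSize-images : ∀ (E : Extent (Carrier S)) (F : Extent (Carrier T)) {P Q r r′} → FSize E P r → FSize F Q r′ → FSize (sumExtent E F) (Images P Q) (r ⊕ r′)
    FSize-images (finite _ _) (finite _ _) {r = fin _} {fin _} C D =
      Cnt-⊎ images-disjoint (Cnt-map inj₁ Sumₚ.inj₁-injective C) (Cnt-map inj₂ Sumₚ.inj₂-injective D)
    FSize-images (finite _ _) infinite {r = fin _} {∞} _ _ = tt
    FSize-images infinite (finite _ _) {r = ∞} {fin _} _ _ = tt
    FSize-images infinite infinite {r = ∞} {∞} _ _ = tt

    cell-nothing⁻ : ∀ {U V : Set} (f : U → V) {x} → cell f x ≡ nothing → x ≡ nothing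
    cell-nothing⁻ f {nothing} _ = refl

  Doms-sum : ∀ {k l} → Doms S c k → Doms T d l → Doms (S ⊎ₛ T) (sumNames c d) (k + l)
  Doms-sum C D = Cnt-resp (sum-≐ (_≢ nothing) (λ f → cell-≢⁺) (λ f → cell-≢))
    (Cnt-⊎ images-disjoint (Cnt-map inj₁ Sumₚ.inj₁-injective C) (Cnt-map inj₂ Sumₚ.inj₂-injective D))

  Frees-sum : ∀ {k l} → Frees S c k → Frees T d l → Frees (S ⊎ₛ T) (sumNames c d) (k ⊕ l)
  Frees-sum C D = FSize-resp (sumExtent (extent S) (extent T)) (sum-≐ (_≡ nothing) (λ f → cong (cell f)) cell-nothing⁻)
    (FSize-images (extent S) (extent T) C D)

Half-sum : ∀ {S S′ T T′ : Str} {m n} {c : Fin m → Carrier S} {c′ : Fin m → Carrier S′} {d : Fin n → Carrier T} {d′ : Fin n → Carrier T′} →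
  Half S c S′ c′ → Half T d T′ d′ → Half (S ⊎ₛ T) (sumNames c d) (S′ ⊎ₛ T′) (sumNames c′ d′)
Half-sum {S} {S′} {T} {T′} {m} {n} {c} {c′} {d} {d′} H K = mkHalf
  (λ {i} {j} → eq (splitAt m i) (splitAt m j)) (λ {i} {j} → pt (splitAt m i) (splitAt m j)) (λ {i} → al (splitAt m i))
  where
  f : Fin m ⊎ Fin n → Carrier (S ⊎ₛ T)
  f = Sum.map c d
  f′ : Fin m ⊎ Fin n → Carrier (S′ ⊎ₛ T′)
  f′ = Sum.map c′ d′
  eq : ∀ s t → f s ≡ f t → f′ s ≡ f′ t
  eq (inj₁ i) (inj₁ j) e = cong inj₁ (eq→ H (Sumₚ.inj₁-injective e))
  eq (inj₂ i) (inj₂ j) e = cong inj₂ (eq→ K (Sumₚ.inj₂-injective e))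
  pt : ∀ s t → hp (S ⊎ₛ T) (f s) ≡ just (f t ∷ []) → hp (S′ ⊎ₛ T′) (f′ s) ≡ just (f′ t ∷ [])
  pt (inj₁ i) (inj₁ j) e = cong (cell inj₁) (pt→ H (cell-injective Sumₚ.inj₁-injective e))
  pt (inj₂ i) (inj₂ j) e = cong (cell inj₂) (pt→ K (cell-injective Sumₚ.inj₂-injective e))
  pt (inj₁ i) (inj₂ j) e with hp S (c i) | e
  ... | just (_ ∷ []) | ()
  ... | nothing | ()
  pt (inj₂ i) (inj₁ j) e with hp T (d i) | e
  ... | just (_ ∷ []) | ()
  ... | nothing | ()
  al : ∀ s → hp (S ⊎ₛ T) (f s) ≡ nothing → hp (S′ ⊎ₛ T′) (f′ s) ≡ nothing
  al (inj₁ i) e = cong (cell inj₁) (al→ H (cell-injective Sumₚ.inj₁-injective e))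
  al (inj₂ i) e = cong (cell inj₂) (al→ K (cell-injective Sumₚ.inj₂-injective e))

Sim-sum : ∀ {N} {S S′ T T′ : Str} {m n} {c : Fin m → Carrier S} {c′ : Fin m → Carrier S′} {d : Fin n → Carrier T} {d′ : Fin n → Carrier T′} →
  Sim N S c S′ c′ → Sim N T d T′ d′ → Sim N (S ⊎ₛ T) (sumNames c d) (S′ ⊎ₛ T′) (sumNames c′ d′)
Sim-sum {S = S} {S′} {T} {T′} {c = c} {c′} {d} {d′} p q = mkSim
  (Half-sum {S} {S′} {T} {T′} {c = c} {c′} {d} {d′} (forth p) (forth q)) (Half-sum {S′} {S} {T′} {T} {c = c′} {c} {d′} {d} (back p) (back q))
  (let k , l , C , D , e = dom≈ p ; k′ , l′ , C′ , D′ , e′ = dom≈ q in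
    k + k′ , l + l′ , Doms-sum {S} {T} C C′ , Doms-sum {S′} {T′} D D′ , ≈-+ e e′)
  (let k , l , C , D , e = free≈ p ; k′ , l′ , C′ , D′ , e′ = free≈ q in
    k ⊕ k′ , l ⊕ l′ , Frees-sum {S} {T} C C′ , Frees-sum {S′} {T′} D D′ , ≈-⊕ e e′)

module GameLemmas (𝓜 : Modality) (N : ℕ) where
  open Modality 𝓜
  open Game 𝓜 N

  EF-iso : ∀ n {S T} (I : Iso S T) {m} {c : Fin m → Carrier S} {d : Fin m → Carrier T} →
    (∀ i → Iso.to I (c i) ≡ d i) → EF n S c T d
  EF-iso zero I ≗ = Sim-iso I ≗
  EF-iso (suc n) {S} {T} I {m} {c} {d} ≗ = EF-iso n I ≗ ,
    (λ u f → return (to u , (λ i e → f i (to-injective (trans (≗ i) e))) , EF-iso n I (λ { zero → refl ; (suc i) → ≗ i }))) ,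
    (λ v f → return (from v , (λ i e → f i (trans (sym (≗ i)) (trans (cong to e) (to-from v)))) ,
      EF-iso n I (λ { zero → to-from v ; (suc i) → ≗ i })))
    where open Iso I

  -- Names may be dropped, permuted or repeated. A move to a location whose name was dropped is
  -- answered by its partner, and the game on the larger tuple skips that round.
  EF-reindex : ∀ n {S T m m′} {c : Fin m → Carrier S} {c′ : Fin m → Carrier T} {d : Fin m′ → Carrier S} {d′ : Fin m′ → Carrier T} →
    (∀ i → Σ (Fin m) λ j → c j ≡ d i × c′ j ≡ d′ i) → EF n S c T c′ → EF n S d T d′
  EF-reindex zero incl sim = Sim-reindex incl sim
  EF-reindex (suc n) {S} {T} {m} {m′} {c} {c′} {d} {d′} incl E@(E₀ , _ , _) = EF-reindex n incl E₀ ,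
    step incl E ,
    λ v f → step (λ i → Product.map₂ Product.swap (incl i)) (EF-sym (suc n) E) v f <&> λ (u , f′ , E′) → u , f′ , EF-sym n E′
    where
    step : ∀ {S T} {c : Fin m → Carrier S} {c′ : Fin m → Carrier T} {d : Fin m′ → Carrier S} {d′ : Fin m′ → Carrier T} →
      (∀ i → Σ (Fin m) λ j → c j ≡ d i × c′ j ≡ d′ i) → EF (suc n) S c T c′ →
      ∀ u → Fresh d u → M (Σ (Carrier T) λ v → Fresh d′ v × EF n S (u ▹ d) T (v ▹ d′))
    step {S} {T} {c} {c′} {d} {d′} incl (E , f , b) u fr with Locations.named? (Str._≟_ S) c u
    ... | inj₁ (j , refl) = return (c′ j , (λ i e → let k , p , q = incl i in
      fr i (trans (sym p) (eq→ (back (EF⇒Sim n E)) (trans q e)))) ,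
      EF-reindex n (λ { zero → j , refl , refl ; (suc i) → incl i }) E)
    ... | inj₂ fr′ = f u fr′ <&> λ (v , frv , E′) → v , (λ i e → let k , p , q = incl i in frv k (trans q e)) ,
      EF-reindex n (λ { zero → zero , refl , refl ; (suc i) → let k , p , q = incl i in suc k , p , q }) E′

  -- Both ends of the edge stay named during the whole play, so the old answers remain good and the
  -- edge matters only at the final position.
  EF-set : ∀ n {S T m} {c : Fin m → Carrier S} {d : Fin m → Carrier T} i j → EF n S c T d →
    EF n (set S (c i) (c j)) c (set T (d i) (d j)) d
  EF-set zero i j sim = Sim-set i j sim
  EF-set (suc n) i j (E , f , b) = EF-set n i j E ,
    (λ u fr → f u fr <&> λ (v , fr′ , E′) → v , fr′ , EF-set n (suc i) (suc j) E′) ,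
    (λ v fr → b v fr <&> λ (u , fr′ , E′) → u , fr′ , EF-set n (suc i) (suc j) E′)

  -- Composition of strategies as in the Feferman-Vaught method: a move is answered inside its own
  -- summand while the other summand skips the round. `EF-reindex` then restores the order of the
  -- names.
  EF-sum : ∀ n {S S′ T T′ : Str} {k l} {c : Fin k → Carrier S} {c′ : Fin k → Carrier S′} {d : Fin l → Carrier T} {d′ : Fin l → Carrier T′} →
    EF n S c S′ c′ → EF n T d T′ d′ → EF n (S ⊎ₛ T) (sumNames c d) (S′ ⊎ₛ T′) (sumNames c′ d′)
  EF-sum zero E F = Sim-sum E F
  EF-sum (suc n) {S} {S′} {T} {T′} {k} {l} E@(E₀ , _) F@(F₀ , _) = EF-sum n E₀ F₀ , step E F ,
    λ v f → step (EF-sym (suc n) E) (EF-sym (suc n) F) v f <&> λ (u , f′ , G) → u , f′ , EF-sym n G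
    where
    incl₁ : ∀ {A B : Set} {c : Fin k → A} {d : Fin l → B} {a} {A′ B′ : Set} {c′ : Fin k → A′} {d′ : Fin l → B′} {a′} →
      ∀ i → Σ (Fin (suc k + l)) λ j → sumNames (a ▹ c) d j ≡ (inj₁ a ▹ sumNames c d) i ×
        sumNames (a′ ▹ c′) d′ j ≡ (inj₁ a′ ▹ sumNames c′ d′) i
    incl₁ zero = zero , refl , refl
    incl₁ {c = c} {d} {c′ = c′} {d′} (suc i) = suc i , Sumₚ.map-map (splitAt k i) , Sumₚ.map-map (splitAt k i)
    incl₂ : ∀ {A B : Set} {c : Fin k → A} {d : Fin l → B} {b} {A′ B′ : Set} {c′ : Fin k → A′} {d′ : Fin l → B′} {b′} →
      ∀ i → Σ (Fin (k + suc l)) λ j → sumNames c (b ▹ d) j ≡ (inj₂ b ▹ sumNames c d) i ×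
        sumNames c′ (b′ ▹ d′) j ≡ (inj₂ b′ ▹ sumNames c′ d′) i
    incl₂ {c = c} {d} {b} {c′ = c′} {d′} {b′} zero = k ↑ʳ zero ,
      cong (Sum.map c (b ▹ d)) (Finₚ.splitAt-↑ʳ k (suc l) zero) , cong (Sum.map c′ (b′ ▹ d′)) (Finₚ.splitAt-↑ʳ k (suc l) zero)
    incl₂ {c = c} {d} {b} {c′ = c′} {d′} {b′} (suc i) with splitAt k i
    ... | inj₁ j = j ↑ˡ suc l , cong (Sum.map c (b ▹ d)) (Finₚ.splitAt-↑ˡ k j (suc l)) , cong (Sum.map c′ (b′ ▹ d′)) (Finₚ.splitAt-↑ˡ k j (suc l))
    ... | inj₂ j = k ↑ʳ suc j , cong (Sum.map c (b ▹ d)) (Finₚ.splitAt-↑ʳ k (suc l) (suc j)) ,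
      cong (Sum.map c′ (b′ ▹ d′)) (Finₚ.splitAt-↑ʳ k (suc l) (suc j))
    step : ∀ {S S′ T T′ : Str} {c : Fin k → Carrier S} {c′ : Fin k → Carrier S′} {d : Fin l → Carrier T} {d′ : Fin l → Carrier T′} →
      EF (suc n) S c S′ c′ → EF (suc n) T d T′ d′ → ∀ u → Fresh (sumNames c d) u →
      M (Σ (Carrier (S′ ⊎ₛ T′)) λ v → Fresh (sumNames c′ d′) v × EF n (S ⊎ₛ T) (u ▹ sumNames c d) (S′ ⊎ₛ T′) (v ▹ sumNames c′ d′))
    step {c = c} {c′} {d} {d′} (E , f , _) (F , _) (inj₁ a) fr = f a (sum-fresh₁⁻ d fr) <&> λ (a′ , fr′ , E′) →
      inj₁ a′ , sum-fresh₁ d′ fr′ , EF-reindex n incl₁ (EF-sum n E′ F)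
    step {c = c} {c′} {d} {d′} (E , _) (F , f , _) (inj₂ b) fr = f b (sum-fresh₂⁻ c fr) <&> λ (b′ , fr′ , F′) →
      inj₂ b′ , sum-fresh₂ c′ fr′ , EF-reindex n incl₂ (EF-sum n E F′)

  Supply : ℕ → Set → Set
  Supply K U = ∀ {m} (c : Fin m → U) → m < K → M (Σ U (Fresh c))

  -- Without cells a position is determined by the equalities among its names, and the free counts
  -- agree by declaration. Each round therefore only needs a fresh location, and `K` bounds the
  -- number of names ever in play.
  EF-pure : ∀ n {S T m K} {c : Fin m → Carrier S} {d : Fin m → Carrier T} →
    (∀ u → hp S u ≡ nothing) → (∀ u → hp T u ≡ nothing) → extent S ≡ infinite → extent T ≡ infinite →
    Supply K (Carrier S) → Supply K (Carrier T) → m + n ≤ K →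
    (∀ {i j} → c i ≡ c j → d i ≡ d j) → (∀ {i j} → d i ≡ d j → c i ≡ c j) → EF n S c T d
  EF-pure zero {S} {T} {m} {c = c} {d} pS pT iS iT _ _ _ f g = mkSim
    (mkHalf f (λ e → case trans (sym (pS _)) e of λ ()) (λ _ → pT _))
    (mkHalf g (λ e → case trans (sym (pT _)) e of λ ()) (λ _ → pS _))
    (0 , 0 , Cnt-∅ (λ (n , _) → n (pS _)) , Cnt-∅ (λ (n , _) → n (pT _)) , same refl)
    (∞ , ∞ , subst (λ E → FSize E (AnonFree {c = c} (hp S)) ∞) (sym iS) tt , subst (λ E → FSize E (AnonFree {c = d} (hp T)) ∞) (sym iT) tt , ∞)
  EF-pure (suc n) {S} {T} {m} {K} {c} {d} pS pT iS iT sS sT le f g = EF-pure n pS pT iS iT sS sT (ℕₚ.≤-trans (ℕₚ.+-monoʳ-≤ m (ℕₚ.n≤1+n n)) le) f g ,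
    (λ u fr → sT d m<K <&> λ (v , fr′) → v , fr′ , next fr fr′) ,
    (λ v fr → sS c m<K <&> λ (u , fr′) → u , fr′ , next fr′ fr)
    where
    le′ : suc m + n ≤ K
    le′ = subst (_≤ K) (ℕₚ.+-suc m n) le
    m<K : m < K
    m<K = ℕₚ.≤-trans (ℕₚ.m≤m+n (suc m) n) le′
    ext : ∀ {A B : Set} {c : Fin m → A} {d : Fin m → B} {u v} → (∀ {i j} → c i ≡ c j → d i ≡ d j) → Fresh c u → Fresh d v →
      ∀ {i j} → (u ▹ c) i ≡ (u ▹ c) j → (v ▹ d) i ≡ (v ▹ d) j
    ext f p q {zero} {zero} e = refl
    ext f p q {zero} {suc j} e = contradiction (sym e) (p j)
    ext f p q {suc i} {zero} e = contradiction e (p i)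
    ext f p q {suc i} {suc j} e = f e
    next : ∀ {u v} → Fresh c u → Fresh d v → EF n S (u ▹ c) T (v ▹ d)
    next p q = EF-pure n pS pT iS iT sS sT le′ (λ {i} {j} → ext f p q {i} {j}) (λ {i} {j} → ext g q p {i} {j})

-- Finitely many game types

search-⊎ : Searchable A → Searchable B → Searchable (A ⊎ B)
search-⊎ s t P? = map′ [ (λ (a , p) → inj₁ a , p) , (λ (b , p) → inj₂ b , p) ]
  (λ { (inj₁ a , p) → inj₁ (a , p) ; (inj₂ b , p) → inj₂ (b , p) }) (s (P? ∘ inj₁) ⊎-dec t (P? ∘ inj₂))

search-⊤ : Searchable ⊤
search-⊤ P? = map′ (tt ,_) proj₂ (P? tt)

bit : ∀ {X : Set} → Dec X → Fin 2
bit (yes _) = suc zero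
bit (no _) = zero

bit-≡ : ∀ {X Y : Set} (d : Dec X) (e : Dec Y) → bit d ≡ bit e → X → Y
bit-≡ (no ¬x) _ _ x = contradiction x ¬x
bit-≡ (yes _) (yes y) _ _ = y

funToFin-injective : ∀ {m k} {f g : Fin m → Fin k} → funToFin f ≡ funToFin g → ∀ i → f i ≡ g i
funToFin-injective {f = f} {g} e i = trans (sym (Finₚ.finToFun-funToFin f i)) (trans (cong (λ z → finToFun z i) e) (Finₚ.finToFun-funToFin g i))

bits : ∀ {m} {P : Fin m → Set} → Decidable P → Fin (2 ^ m)
bits P? = funToFin (bit ∘ P?)

bits-≡ : ∀ {m} {P Q : Fin m → Set} (P? : Decidable P) (Q? : Decidable Q) → bits P? ≡ bits Q? → ∀ i → P i → Q i
bits-≡ P? Q? e i = bit-≡ (P? i) (Q? i) (funToFin-injective e i)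

cap : ∀ N → ℕ → Fin (suc N)
cap N k = Fin.fromℕ< (s≤s (ℕₚ.m⊓n≤n k N))

cap-≡ : ∀ {N} k l → cap N k ≡ cap N l → k ≈[ N ] l
cap-≡ {N} k l e with N ℕ.≤? k | N ℕ.≤? l
... | yes p | yes q = big p q
... | yes p | no q = contradiction (subst (_≤ l) (trans (sym meet) (ℕₚ.m≥n⇒m⊓n≡n p)) (ℕₚ.m⊓n≤m l N)) q
  where meet = trans (sym (Finₚ.toℕ-fromℕ< _)) (trans (cong toℕ e) (Finₚ.toℕ-fromℕ< _))
... | no p | q? = same (trans (sym (ℕₚ.m≤n⇒m⊓n≡m (ℕₚ.<⇒≤ (ℕₚ.≰⇒> p)))) (trans meet (low q?)))
  where
  meet : k ⊓ N ≡ l ⊓ N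
  meet = trans (sym (Finₚ.toℕ-fromℕ< _)) (trans (cong toℕ e) (Finₚ.toℕ-fromℕ< _))
  low : Dec (N ≤ l) → l ⊓ N ≡ l
  low (yes q) = contradiction (subst (_≤ k) (trans meet (ℕₚ.m≥n⇒m⊓n≡n q)) (ℕₚ.m⊓n≤m k N)) p
  low (no q) = ℕₚ.m≤n⇒m⊓n≡m (ℕₚ.<⇒≤ (ℕₚ.≰⇒> q))

cap∞ : ∀ N → ℕ∞ → Fin (suc (suc N))
cap∞ N ∞ = zero
cap∞ N (fin k) = suc (cap N k)

cap∞-≡ : ∀ {N} k l → cap∞ N k ≡ cap∞ N l → k ≈∞[ N ] l
cap∞-≡ (fin k) (fin l) e = fin (cap-≡ k l (Finₚ.suc-injective e))
cap∞-≡ ∞ ∞ e = ∞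

module Types (N : ℕ) where

  -- These are Hintikka types. At rank zero: the equality and points-to matrices, the set of
  -- unallocated names, and two capped counts, the second with an extra value for `∞`. A higher rank
  -- adds the set of types reached by naming one more location.
  typeSize : ℕ → ℕ → ℕ
  typeSize zero m = (2 ^ m) ^ m * ((2 ^ m) ^ m * (2 ^ m * (suc N * suc (suc N))))
  typeSize (suc n) m = typeSize n m * 2 ^ typeSize n (suc m)

  module _ (S : Str) (s : Searchable (Carrier S)) where
    open Str S using (_≟_)

    points? : ∀ u v → Dec (hp S u ≡ just (v ∷ []))
    points? u v = Maybeₚ.≡-dec (Vecₚ.≡-dec _≟_) (hp S u) (just (v ∷ []))

    type : ∀ n {m} → (Fin m → Carrier S) → Fin (typeSize n m)
    type zero c =
      combine (funToFin λ i → bits λ j → c i ≟ c j) (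
      combine (funToFin λ i → bits λ j → points? (c i) (c j)) (
      combine (bits λ i → nothing? (hp S (c i))) (
      combine (cap N (proj₁ (Locations.countDom _≟_ c (heap S))))
              (cap∞ N (proj₁ (FSize-exists _≟_ (extent S) (Locations.anonFree? _≟_ c (hp S))))))))
    type (suc n) c = combine (type n c) (bits λ t → s λ u → Locations.fresh? _≟_ c u ×-dec type n (u ▹ c) Finₚ.≟ t)

  module _ (𝓜 : Modality) where
    open Modality 𝓜
    open Game 𝓜 N

    -- Answers are found by exhaustive search and are therefore explicit, which serves every
    -- modality.
    type-EF : ∀ n {S T} (s : Searchable (Carrier S)) (t : Searchable (Carrier T)) {m} {c : Fin m → Carrier S} {d : Fin m → Carrier T} →
      type S s n c ≡ type T t n d → EF n S c T d
    type-EF zero {S} {T} s t {m} {c} {d} e with Finₚ.combine-injective _ _ _ _ e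
    ... | eq , e with Finₚ.combine-injective _ _ _ _ e
    ... | pt , e with Finₚ.combine-injective _ _ _ _ e
    ... | al , e with Finₚ.combine-injective _ _ _ _ e
    ... | dm , fr = mkSim
      (mkHalf (λ {i} {j} → bits-≡ (λ j → S.≟ (c i) (c j)) (λ j → T.≟ (d i) (d j)) (funToFin-injective eq i) j)
        (λ {i} {j} → bits-≡ (λ j → points? S s (c i) (c j)) (λ j → points? T t (d i) (d j)) (funToFin-injective pt i) j)
        (λ {i} → bits-≡ (λ i → nothing? (hp S (c i))) (λ i → nothing? (hp T (d i))) al i))
      (mkHalf (λ {i} {j} → bits-≡ (λ j → T.≟ (d i) (d j)) (λ j → S.≟ (c i) (c j)) (sym (funToFin-injective eq i)) j)
        (λ {i} {j} → bits-≡ (λ j → points? T t (d i) (d j)) (λ j → points? S s (c i) (c j)) (sym (funToFin-injective pt i)) j)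
        (λ {i} → bits-≡ (λ i → nothing? (hp T (d i))) (λ i → nothing? (hp S (c i))) (sym al) i))
      (-, -, proj₂ (Locations.countDom S.≟ c (heap S)) , proj₂ (Locations.countDom T.≟ d (heap T)) , cap-≡ _ _ dm)
      (-, -, proj₂ (FSize-exists S.≟ (extent S) (Locations.anonFree? S.≟ c (hp S))) ,
        proj₂ (FSize-exists T.≟ (extent T) (Locations.anonFree? T.≟ d (hp T))) , cap∞-≡ _ _ fr)
      where
      module S = Str S renaming (_≟_ to ≟)
      module T = Str T renaming (_≟_ to ≟)
    type-EF (suc n) {S} {T} s t {m} {c} {d} e with Finₚ.combine-injective _ _ _ _ e
    ... | e₀ , e₁ = type-EF n s t e₀ ,
      (λ u f → let v , f′ , e′ = move S s T t c d e₁ u f in return (v , f′ , type-EF n s t (sym e′))) ,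
      (λ v f → let u , f′ , e′ = move T t S s d c (sym e₁) v f in return (u , f′ , type-EF n s t e′))
      where
      Moves : ∀ S → Searchable (Carrier S) → (Fin m → Carrier S) → Fin (typeSize n (suc m)) → Set
      Moves S s c t = Σ (Carrier S) λ u → Fresh c u × type S s n (u ▹ c) ≡ t
      moves? : ∀ S (s : Searchable (Carrier S)) c → Decidable (Moves S s c)
      moves? S s c t = s λ u → Locations.fresh? (Str._≟_ S) c u ×-dec type S s n (u ▹ c) Finₚ.≟ t
      move : ∀ S (s : Searchable (Carrier S)) T (t : Searchable (Carrier T)) (c : Fin m → Carrier S) (d : Fin m → Carrier T) →
        bits (moves? S s c) ≡ bits (moves? T t d) →
        ∀ u → Fresh c u → Σ (Carrier T) λ v → Fresh d v × type T t n (v ▹ d) ≡ type S s n (u ▹ c)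
      move S s T t c d e u f = bits-≡ (moves? S s c) (moves? T t d) e (type S s n (u ▹ c)) (u , f , refl)

-- Saturation, and terms for finite partial functions

module _ {X : Set} {K : ℕ} (τ : X → Fin K) (step : List X → List X) where

  private
    Hit : List X → X → Set
    Hit ts x = Any.Any (λ y → τ x ≡ τ y) ts

    hit? : ∀ ts → Decidable (Hit ts)
    hit? ts x = Any.any? (λ y → τ x Finₚ.≟ τ y) ts

    go : ∀ k ts → Unique (List.map τ ts) → K < length ts + k → Σ (List X) λ ts → All (Hit ts) (step ts)
    go zero ts u lt = contradiction (ℕₚ.≤-trans lt (ℕₚ.≤-trans (ℕₚ.≤-reflexive (ℕₚ.+-identityʳ (length ts)))
      (subst₂ _≤_ (Listₚ.length-map τ ts) (Listₚ.length-tabulate id)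
      (Unique-⊆⇒length≤ u (λ _ → ∈ₚ.∈-allFin _))))) (ℕₚ.n≮n K)
    go (suc k) ts u lt with All.all? (hit? ts) (step ts)
    ... | yes p = ts , p
    ... | no ¬p with find (Allₚ.¬All⇒Any¬ (hit? ts) (step ts) ¬p)
    ...   | x , _ , new = go k (x ∷ ts) (All.tabulate (λ { z∈ refl → let y , y∈ , e = ∈ₚ.∈-map⁻ τ z∈ in new (lose y∈ e) }) ∷ u)
      (subst (K <_) (ℕₚ.+-suc (length ts) k) lt)

  -- The list is not closed under `step`; what `step` yields merely repeats colours already present.
  -- Each failed test adds an element of a new colour, and `suc K` additions would exceed the number
  -- of colours, so this much fuel suffices.
  saturate : Σ (List X) λ ts → All (Hit ts) (step ts)
  saturate = go (suc K) [] [] (ℕₚ.n<1+n K)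

-- A term denotes a finite partial function with two points: the edges added later
-- start at 'last' and may end at 'first'.
data Tm : Set where
  sing  : Tm
  bin   : Maybe Bool → Bool → Tm → Tm → Tm
  close : Tm → Tm

record Pointed : Set₁ where
  constructor mkPointed
  field
    str        : Str
    first last : Carrier str
open Pointed public

ends : ∀ {U : Set} → U → U → Fin 2 → U
ends f l zero = f
ends f l (suc _) = l

pts : (P : Pointed) → Fin 2 → Carrier (str P)
pts P = ends (first P) (last P)

edgeHeap : ∀ {A B : Set} → DecidableEquality (A ⊎ B) → Maybe Bool → A → A → B → Heap (A ⊎ B) 1 → Heap (A ⊎ B) 1
edgeHeap _≟_ nothing f l b H = H
edgeHeap _≟_ (just t) f l b H = setHeap _≟_ (inj₂ b) (inj₁ (if t then l else f)) H

-- `b` says whether the last point of the second part receives an edge, and into which point of the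
-- first part; `s` selects the surviving first point. The last point of the first part always
-- survives, since a later edge may start there.
binₚ : Maybe Bool → Bool → Pointed → Pointed → Pointed
binₚ b s (mkPointed S f l) (mkPointed T f′ l′) = mkPointed
  (mkStr (Carrier S ⊎ Carrier T) (Str._≟_ (S ⊎ₛ T)) (edgeHeap (Str._≟_ (S ⊎ₛ T)) b f l l′ (heap (S ⊎ₛ T))) (extent (S ⊎ₛ T)))
  (if s then inj₁ f else inj₂ f′) (inj₁ l)

-- Repairs the cut made in `generated-first`, where the source of the edge is the point that must
-- remain distinguished.
closeₚ : Pointed → Pointed
closeₚ (mkPointed S f l) = mkPointed (set S l f) l l

singₚ : Pointed
singₚ = mkPointed (mkStr ⊤ (λ _ _ → yes refl) ((λ _ → nothing) , [] , λ _ n → contradiction refl n) (finite (tt ∷ []) (λ _ → here refl))) tt tt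

value : Tm → Pointed
value sing = singₚ
value (bin b s t t′) = binₚ b s (value t) (value t′)
value (close t) = closeₚ (value t)

search-value : ∀ t → Searchable (Carrier (str (value t)))
search-value sing = search-⊤
search-value (bin b s t t′) = search-⊎ (search-value t) (search-value t′)
search-value (close t) = search-value t

module Representatives (N n : ℕ) where

  module _ (𝓜 : Modality) where
    open Game 𝓜 N
    open GameLemmas 𝓜 N

    EFₚ : Pointed → Pointed → Set
    EFₚ P Q = EF n (str P) (pts P) (str Q) (pts Q)

    EF-bin : ∀ b s {P P′ Q Q′} → EFₚ P P′ → EFₚ Q Q′ → EFₚ (binₚ b s P Q) (binₚ b s P′ Q′)
    EF-bin b s {P} {P′} {Q} {Q′} E F = EF-reindex n {S = str (binₚ b s P Q)} {str (binₚ b s P′ Q′)} (incl s) (edges b)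
      where
      joined : EF n (str P ⊎ₛ str Q) (sumNames (pts P) (pts Q)) (str P′ ⊎ₛ str Q′) (sumNames (pts P′) (pts Q′))
      joined = EF-sum n {str P} {str P′} {str Q} {str Q′} E F
      edges : ∀ b → EF n (str (binₚ b s P Q)) (sumNames (pts P) (pts Q)) (str (binₚ b s P′ Q′)) (sumNames (pts P′) (pts Q′))
      edges nothing = joined
      -- The names of the sum are the two points of `P` followed by those of `Q`; the edge starts at
      -- the fourth name.
      edges (just true) = EF-set n {str P ⊎ₛ str Q} {str P′ ⊎ₛ str Q′} (suc (suc (suc zero))) (suc zero) joined
      edges (just false) = EF-set n {str P ⊎ₛ str Q} {str P′ ⊎ₛ str Q′} (suc (suc (suc zero))) zero joined
      incl : ∀ s i → Σ (Fin 4) λ j →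
        sumNames (pts P) (pts Q) j ≡ ends (if s then inj₁ (first P) else inj₂ (first Q)) (inj₁ (last P)) i ×
        sumNames (pts P′) (pts Q′) j ≡ ends (if s then inj₁ (first P′) else inj₂ (first Q′)) (inj₁ (last P′)) i
      incl true zero = zero , refl , refl
      incl false zero = suc (suc zero) , refl , refl
      incl s (suc _) = suc zero , refl , refl

    EF-close : ∀ {P P′} → EFₚ P P′ → EFₚ (closeₚ P) (closeₚ P′)
    EF-close {P} {P′} E = EF-reindex n {S = str (closeₚ P)} {str (closeₚ P′)}
      (λ { zero → suc zero , refl , refl ; (suc _) → suc zero , refl , refl })
      (EF-set n {str P} {str P′} (suc zero) zero E)

  private
    τ : Tm → Fin (Types.typeSize N n 2)
    τ t = Types.type N (str (value t)) (search-value t) n (pts (value t))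

    step : List Tm → List Tm
    step ts = sing ∷ List.map close ts ++
      List.concatMap (λ (b , s) → List.cartesianProductWith (bin b s) ts ts)
        (List.cartesianProduct (nothing ∷ just true ∷ just false ∷ []) (true ∷ false ∷ []))

    bin∈step : ∀ b s {ts t t′} → t ∈ ts → t′ ∈ ts → bin b s t t′ ∈ step ts
    bin∈step b s {ts} p q = there (∈ₚ.∈-++⁺ʳ (List.map close ts)
      (∈ₚ.∈-concatMap⁺ (λ (b , s) → List.cartesianProductWith (bin b s) ts ts)
      (lose (∈ₚ.∈-cartesianProduct⁺ (edge b) (side s))
      (∈ₚ.∈-cartesianProductWith⁺ (bin b s) p q))))
      where
      edge : ∀ b → b ∈ nothing ∷ just true ∷ just false ∷ []
      edge nothing = here refl
      edge (just true) = there (here refl)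
      edge (just false) = there (there (here refl))
      side : ∀ s → s ∈ true ∷ false ∷ []
      side true = here refl
      side false = there (here refl)

  representatives : List Tm
  representatives = proj₁ (saturate τ step)

  -- Subterms are replaced by representatives, which is harmless as the operations are congruences.
  -- The result is one `step` away from the representatives, so one of them has its type.
  represented : ∀ 𝓜 t → Σ Tm λ t′ → t′ ∈ representatives × EFₚ 𝓜 (value t) (value t′)
  represented 𝓜 = go
    where
    open Game 𝓜 N
    hit : ∀ {t} → t ∈ step representatives → Σ Tm λ t′ → t′ ∈ representatives × EFₚ 𝓜 (value t) (value t′)
    hit {t} p with find (All.lookup (proj₂ (saturate τ step)) p)
    ... | t′ , t′∈ , e = t′ , t′∈ , Types.type-EF N 𝓜 n (search-value t) (search-value t′) e
    go : ∀ t → Σ Tm λ t′ → t′ ∈ representatives × EFₚ 𝓜 (value t) (value t′)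
    go sing = hit (here refl)
    go (bin b s t₁ t₂) with go t₁ | go t₂
    ... | t₁′ , p₁ , E₁ | t₂′ , p₂ , E₂ with hit (bin∈step b s p₁ p₂)
    ... | t′ , p , E = t′ , p , EF-trans n (EF-bin 𝓜 b s {value t₁} {value t₁′} {value t₂} {value t₂′} E₁ E₂) E
    go (close t) with go t
    ... | t₁ , p₁ , E₁ with hit {close t₁} (there (∈ₚ.∈-++⁺ˡ (∈ₚ.∈-map⁺ close p₁)))
    ... | t′ , p , E = t′ , p , EF-trans n (EF-close 𝓜 {value t} {value t₁} E₁) E

-- Every finite partial function is the value of a term

Iso-sym : ∀ {S T} → Iso S T → Iso T S
Iso-sym {S} {T} I = record
  { to = from ; from = to ; to-from = from-to ; from-to = to-from
  ; to-heap = λ y → sym (trans (cong (cell from) (trans (cong (hp T) (sym (to-from y))) (to-heap (from y)))) (cell-from (hp S (from y))))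
  ; kind = flip kind }
  where
  open Iso I
  cell-from : ∀ x → cell from (cell to x) ≡ x
  cell-from nothing = refl
  cell-from (just (v ∷ [])) = cong (just ∘ (_∷ [])) (from-to v)
  flip : ∀ {U V : Set} {E : Extent U} {F : Extent V} → SameKind E F → SameKind F E
  flip finite = finite
  flip infinite = infinite

cell-∘ : ∀ {A B C : Set} (f : B → C) (g : A → B) x → cell f (cell g x) ≡ cell (f ∘ g) x
cell-∘ f g nothing = refl
cell-∘ f g (just (v ∷ [])) = refl

Iso-trans : ∀ {S T R} → Iso S T → Iso T R → Iso S R
Iso-trans {S} I J = record
  { to = J.to ∘ I.to ; from = I.from ∘ J.from
  ; to-from = λ y → trans (cong J.to (I.to-from (J.from y))) (J.to-from y)
  ; from-to = λ x → trans (cong I.from (J.from-to (I.to x))) (I.from-to x)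
  ; to-heap = λ x → trans (J.to-heap (I.to x)) (trans (cong (cell J.to) (I.to-heap x)) (cell-∘ J.to I.to (hp S x)))
  ; kind = chain I.kind J.kind }
  where
  module I = Iso I
  module J = Iso J
  chain : ∀ {U V W : Set} {E : Extent U} {F : Extent V} {G : Extent W} → SameKind E F → SameKind F G → SameKind E G
  chain finite finite = finite
  chain infinite infinite = infinite

Iso-⊎ : ∀ {S S′ T T′} → Iso S S′ → Iso T T′ → Iso (S ⊎ₛ T) (S′ ⊎ₛ T′)
Iso-⊎ {S} {S′} {T} {T′} I J = record
  { to = Sum.map I.to J.to ; from = Sum.map I.from J.from
  ; to-from = [ cong inj₁ ∘ I.to-from , cong inj₂ ∘ J.to-from ]
  ; from-to = [ cong inj₁ ∘ I.from-to , cong inj₂ ∘ J.from-to ]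
  ; to-heap = [ (λ a → trans (cong (cell inj₁) (I.to-heap a)) (trans (cell-∘ inj₁ I.to (hp S a)) (sym (cell-∘ (Sum.map I.to J.to) inj₁ (hp S a))))) ,
                (λ b → trans (cong (cell inj₂) (J.to-heap b)) (trans (cell-∘ inj₂ J.to (hp T b)) (sym (cell-∘ (Sum.map I.to J.to) inj₂ (hp T b))))) ]
  ; kind = sumKind I.kind J.kind }
  where
  module I = Iso I
  module J = Iso J
  sumKind : ∀ {U V U′ V′ : Set} {E : Extent U} {F : Extent V} {E′ : Extent U′} {F′ : Extent V′} →
    SameKind E E′ → SameKind F F′ → SameKind (sumExtent E F) (sumExtent E′ F′)
  sumKind finite finite = finite
  sumKind finite infinite = infinite
  sumKind infinite finite = infinite
  sumKind infinite infinite = infinite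

Iso-set : ∀ {S T} (I : Iso S T) {a x a′ x′} → Iso.to I a ≡ a′ → Iso.to I x ≡ x′ → Iso (set S a x) (set T a′ x′)
Iso-set {S} {T} I {a} {x} {a′} {x′} ea ex = record { Iso I hiding (to-heap) ; to-heap = to-heap′ }
  where
  open Iso I
  to-heap′ : ∀ u → hp (set T a′ x′) (to u) ≡ cell to (hp (set S a x) u)
  to-heap′ u with Str._≟_ S u a
  ... | yes refl = trans (set-at T ea) (cong (just ∘ (_∷ [])) (sym ex))
  ... | no n = trans (set-off T (λ e → n (to-injective (trans e (sym ea))))) (to-heap u)

record PIso (P Q : Pointed) : Set where
  constructor mkPIso
  field
    iso      : Iso (str P) (str Q)
    to-first : Iso.to iso (first P) ≡ first Q
    to-last  : Iso.to iso (last P) ≡ last Q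
open PIso public

PIso-trans : ∀ {P Q R} → PIso P Q → PIso Q R → PIso P R
PIso-trans (mkPIso I f l) (mkPIso J f′ l′) =
  mkPIso (Iso-trans I J) (trans (cong (Iso.to J) f) f′) (trans (cong (Iso.to J) l) l′)

PIso-sym : ∀ {P Q} → PIso P Q → PIso Q P
PIso-sym (mkPIso I f l) = mkPIso (Iso-sym I)
  (trans (cong (Iso.from I) (sym f)) (Iso.from-to I _)) (trans (cong (Iso.from I) (sym l)) (Iso.from-to I _))

PIso-bin : ∀ b s {P P′ Q Q′} → PIso P P′ → PIso Q Q′ → PIso (binₚ b s P Q) (binₚ b s P′ Q′)
PIso-bin b s {P} {P′} {Q} {Q′} (mkPIso I f l) (mkPIso J f′ l′) = mkPIso (edges b) (fst b s) (lst b)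
  where
  K : Iso (str P ⊎ₛ str Q) (str P′ ⊎ₛ str Q′)
  K = Iso-⊎ I J
  edges : ∀ b → Iso (str (binₚ b s P Q)) (str (binₚ b s P′ Q′))
  edges nothing = K
  edges (just true) = Iso-set K (cong inj₂ l′) (cong inj₁ l)
  edges (just false) = Iso-set K (cong inj₂ l′) (cong inj₁ f)
  fst : ∀ b s → Iso.to (edges b) (first (binₚ b s P Q)) ≡ first (binₚ b s P′ Q′)
  fst nothing true = cong inj₁ f
  fst nothing false = cong inj₂ f′
  fst (just true) true = cong inj₁ f
  fst (just true) false = cong inj₂ f′
  fst (just false) true = cong inj₁ f
  fst (just false) false = cong inj₂ f′
  lst : ∀ b → Iso.to (edges b) (inj₁ (last P)) ≡ inj₁ (last P′)
  lst nothing = cong inj₁ l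
  lst (just true) = cong inj₁ l
  lst (just false) = cong inj₁ l

PIso-close : ∀ {P Q} → PIso P Q → PIso (closeₚ P) (closeₚ Q)
PIso-close (mkPIso I f l) = mkPIso (Iso-set I l f) l l

-- Grafting a leaf

leafₚ : (P : Pointed) → Carrier (str P) → Pointed
leafₚ P w = mkPointed (set (str P ⊎ₛ str singₚ) (inj₂ tt) (inj₁ w)) (inj₁ (first P)) (inj₁ (last P))

cell-id : ∀ (x : Maybe (Vec A 1)) → cell id x ≡ x
cell-id nothing = refl
cell-id (just (v ∷ [])) = refl

Iso-refl : ∀ {S} → SameKind (extent S) (extent S) → Iso S S
Iso-refl {S} k = record { to = id ; from = id ; to-from = λ _ → refl ; from-to = λ _ → refl ; to-heap = λ u → sym (cell-id (hp S u)) ; kind = k }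

SameKind-refl : ∀ {U} (E : Extent U) → SameKind E E
SameKind-refl (finite _ _) = finite
SameKind-refl infinite = infinite

PIso-refl : ∀ {P} → PIso P P
PIso-refl {P} = mkPIso (Iso-refl (SameKind-refl (extent (str P)))) refl refl

PIso-leaf : ∀ {P Q} (I : PIso P Q) w → PIso (leafₚ P (Iso.from (iso I) w)) (leafₚ Q w)
PIso-leaf (mkPIso I f l) w = mkPIso (Iso-set (Iso-⊎ I (iso (PIso-refl {singₚ}))) refl (cong inj₁ (Iso.to-from I w))) (cong inj₁ f) (cong inj₁ l)

module _ (b : Maybe Bool) (s : Bool) (P Q : Pointed) where

  private
    assocExtent : ∀ {A B C : Set} (E : Extent A) (F : Extent B) {xs all} →
      SameKind (sumExtent (sumExtent E F) (finite {C} xs all)) (sumExtent (sumExtent E (finite xs all)) F)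
    assocExtent (finite _ _) (finite _ _) = finite
    assocExtent (finite _ _) infinite = infinite
    assocExtent infinite (finite _ _) = infinite
    assocExtent infinite infinite = infinite

    assocExtent′ : ∀ {A B C : Set} (E : Extent A) (F : Extent B) {xs all} →
      SameKind (sumExtent (sumExtent E F) (finite {C} xs all)) (sumExtent E (sumExtent F (finite xs all)))
    assocExtent′ (finite _ _) (finite _ _) = finite
    assocExtent′ (finite _ _) infinite = infinite
    assocExtent′ infinite (finite _ _) = infinite
    assocExtent′ infinite infinite = infinite

  -- The new cell and the one filled by `binₚ` are different, so both additions commute up to
  -- reassociating the sum.
  leaf-bin₁ : ∀ a → PIso (leafₚ (binₚ b s P Q) (inj₁ a)) (binₚ b s (leafₚ P a) Q)
  leaf-bin₁ a = mkPIso (record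
    { to = to
    ; from = [ [ inj₁ ∘ inj₁ , inj₂ ]′ , inj₁ ∘ inj₂ ]′
    ; to-from = λ { (inj₁ (inj₁ _)) → refl ; (inj₁ (inj₂ _)) → refl ; (inj₂ _) → refl }
    ; from-to = λ { (inj₁ (inj₁ _)) → refl ; (inj₁ (inj₂ _)) → refl ; (inj₂ _) → refl }
    ; to-heap = to-heap b
    ; kind = assocExtent (extent (str P)) (extent (str Q)) }) (fst s) refl
    where
    to : (Carrier (str P) ⊎ Carrier (str Q)) ⊎ ⊤ → (Carrier (str P) ⊎ ⊤) ⊎ Carrier (str Q)
    to = [ Sum.map₁ inj₁ , inj₁ ∘ inj₂ ]′
    fst : ∀ s → to (inj₁ (if s then inj₁ (first P) else inj₂ (first Q))) ≡ (if s then inj₁ (inj₁ (first P)) else inj₂ (first Q))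
    fst true = refl
    fst false = refl
    shift₁ : ∀ x → cell inj₁ (cell inj₁ x) ≡ cell to (cell inj₁ (cell inj₁ x))
    shift₁ nothing = refl
    shift₁ (just (_ ∷ [])) = refl
    shift₂ : ∀ x → cell inj₂ x ≡ cell to (cell inj₁ (cell inj₂ x))
    shift₂ nothing = refl
    shift₂ (just (_ ∷ [])) = refl
    to-heap : ∀ b u → hp (str (binₚ b s (leafₚ P a) Q)) (to u) ≡ cell to (hp (str (leafₚ (binₚ b s P Q) (inj₁ a))) u)
    to-heap nothing (inj₁ (inj₁ p)) = shift₁ (hp (str P) p)
    to-heap (just _) (inj₁ (inj₁ p)) = shift₁ (hp (str P) p)
    to-heap nothing (inj₁ (inj₂ q)) = shift₂ (hp (str Q) q)
    to-heap (just t) (inj₁ (inj₂ q)) with Str._≟_ (str Q) q (last Q) | t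
    ... | yes _ | true = refl
    ... | yes _ | false = refl
    ... | no _ | _ = shift₂ (hp (str Q) q)
    to-heap nothing (inj₂ tt) = refl
    to-heap (just _) (inj₂ tt) = refl

  leaf-bin₂ : ∀ a → PIso (leafₚ (binₚ b s P Q) (inj₂ a)) (binₚ b s P (leafₚ Q a))
  leaf-bin₂ a = mkPIso (record
    { to = to
    ; from = [ inj₁ ∘ inj₁ , [ inj₁ ∘ inj₂ , inj₂ ]′ ]′
    ; to-from = λ { (inj₁ _) → refl ; (inj₂ (inj₁ _)) → refl ; (inj₂ (inj₂ _)) → refl }
    ; from-to = λ { (inj₁ (inj₁ _)) → refl ; (inj₁ (inj₂ _)) → refl ; (inj₂ _) → refl }
    ; to-heap = to-heap b
    ; kind = assocExtent′ (extent (str P)) (extent (str Q)) }) (fst s) refl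
    where
    to : (Carrier (str P) ⊎ Carrier (str Q)) ⊎ ⊤ → Carrier (str P) ⊎ (Carrier (str Q) ⊎ ⊤)
    to = [ Sum.map₂ inj₁ , inj₂ ∘ inj₂ ]′
    fst : ∀ s → to (inj₁ (if s then inj₁ (first P) else inj₂ (first Q))) ≡ (if s then inj₁ (first P) else inj₂ (inj₁ (first Q)))
    fst true = refl
    fst false = refl
    shift₁ : ∀ x → cell inj₁ x ≡ cell to (cell inj₁ (cell inj₁ x))
    shift₁ nothing = refl
    shift₁ (just (_ ∷ [])) = refl
    shift₂ : ∀ x → cell inj₂ (cell inj₁ x) ≡ cell to (cell inj₁ (cell inj₂ x))
    shift₂ nothing = refl
    shift₂ (just (_ ∷ [])) = refl
    to-heap : ∀ b u → hp (str (binₚ b s P (leafₚ Q a))) (to u) ≡ cell to (hp (str (leafₚ (binₚ b s P Q) (inj₂ a))) u)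
    to-heap nothing (inj₁ (inj₁ p)) = shift₁ (hp (str P) p)
    to-heap (just _) (inj₁ (inj₁ p)) = shift₁ (hp (str P) p)
    to-heap nothing (inj₁ (inj₂ q)) = shift₂ (hp (str Q) q)
    to-heap (just t) (inj₁ (inj₂ q)) with Str._≟_ (str Q) q (last Q) | t
    ... | yes _ | true = refl
    ... | yes _ | false = refl
    ... | no _ | _ = shift₂ (hp (str Q) q)
    to-heap nothing (inj₂ tt) = refl
    to-heap (just _) (inj₂ tt) = refl

leaf-close : ∀ P w → PIso (leafₚ (closeₚ P) w) (closeₚ (leafₚ P w))
leaf-close P w = mkPIso (record
  { to = id ; from = id ; to-from = λ _ → refl ; from-to = λ _ → refl ; to-heap = to-heap ; kind = SameKind-refl _ }) refl refl
  where
  to-heap : ∀ u → hp (str (closeₚ (leafₚ P w))) u ≡ cell id (hp (str (leafₚ (closeₚ P) w)) u)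
  to-heap (inj₁ p) with Str._≟_ (str P) p (last P)
  ... | yes _ = refl
  ... | no _ = sym (cell-id (cell inj₁ (hp (str P) p)))
  to-heap (inj₂ tt) = refl

-- The target `w` need not be one of the two points, so no operation at the root reaches it. The
-- leaf is pushed down to the `sing` that contributed `w`; there `w` is the only location and `bin`
-- can add the edge.
graft : ∀ t w → Σ Tm λ t′ → PIso (leafₚ (value t) w) (value t′)
graft sing tt = bin (just true) true sing sing , PIso-refl
graft (bin b s t₁ t₂) (inj₁ a) with graft t₁ a
... | t₁′ , I = bin b s t₁′ t₂ , PIso-trans (leaf-bin₁ b s (value t₁) (value t₂) a) (PIso-bin b s I PIso-refl)
graft (bin b s t₁ t₂) (inj₂ a) with graft t₂ a
... | t₂′ , I = bin b s t₁ t₂′ , PIso-trans (leaf-bin₂ b s (value t₁) (value t₂) a) (PIso-bin b s PIso-refl I)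
graft (close t) w with graft t w
... | t′ , I = close t′ , PIso-trans (leaf-close (value t) w) (PIso-close I)

-- Generation by removing and reinserting a leaf

Cells : ℕ → Set
Cells n = Fin n → Maybe (Vec (Fin n) 1)

finStr : ∀ n → Cells n → Str
finStr n h = mkStr (Fin n) Finₚ._≟_ (h , allFin n , λ u _ → ∈ₚ.∈-allFin u) (finite (allFin n) ∈ₚ.∈-allFin)

Generated : Pointed → Set
Generated P = Σ Tm λ t → PIso (value t) P

Leaf : ∀ {n} → Cells n → Fin n → Set
Leaf h z = ∀ u → h u ≢ just (z ∷ [])

-- Otherwise the predecessor map would inject Fin (suc n) into the allocated elements.
leaf-exists : ∀ {n} (h : Cells (suc n)) x → h x ≡ nothing → Σ (Fin (suc n)) (Leaf h)
leaf-exists {n} h x hx with Finₚ.any? (λ z → Finₚ.all? (λ u → ¬? (Maybeₚ.≡-dec (Vecₚ.≡-dec Finₚ._≟_) (h u) (just (z ∷ [])))))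
... | yes p = p
... | no ¬p = contradiction (Finₚ.injective⇒≤ {f = g} g-injective) (ℕₚ.n≮n n)
  where
  pred : ∀ z → Σ (Fin (suc n)) λ u → h u ≡ just (z ∷ [])
  pred z with Finₚ.any? (λ u → Maybeₚ.≡-dec (Vecₚ.≡-dec Finₚ._≟_) (h u) (just (z ∷ [])))
  ... | yes p = p
  ... | no ¬q = contradiction (z , λ u e → ¬q (u , e)) ¬p
  avoids : ∀ z → x ≢ proj₁ (pred z)
  avoids z e = case trans (sym hx) (trans (cong h e) (proj₂ (pred z))) of λ ()
  g : Fin (suc n) → Fin n
  g z = punchOut (avoids z)
  g-injective : Injective _≡_ _≡_ g
  g-injective {y} {z} e = Vecₚ.∷-injectiveˡ (Maybeₚ.just-injective (trans (sym (proj₂ (pred y)))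
    (trans (cong h (Finₚ.punchOut-injective (avoids y) (avoids z) e)) (proj₂ (pred z)))))

module Removal {n} (h : Cells (suc n)) (z : Fin (suc n)) (lf : Leaf h z) where

  delete : ∀ x → x ≢ just (z ∷ []) → Σ (Maybe (Vec (Fin n) 1)) λ y → cell (punchIn z) y ≡ x
  delete nothing _ = nothing , refl
  delete (just (v ∷ [])) ne with z Finₚ.≟ v
  ... | yes refl = contradiction refl ne
  ... | no z≢v = just (punchOut z≢v ∷ []) , cong (just ∘ (_∷ [])) (Finₚ.punchIn-punchOut z≢v)

  h⁻ : Cells n
  h⁻ u = proj₁ (delete (h (punchIn z u)) (lf _))

  h⁻-cell : ∀ u → cell (punchIn z) (h⁻ u) ≡ h (punchIn z u)
  h⁻-cell u = proj₂ (delete (h (punchIn z u)) (lf _))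

  h⁻-nothing : ∀ {x} (n : z ≢ x) → h x ≡ nothing → h⁻ (punchOut n) ≡ nothing
  h⁻-nothing ne e = cell-injective (Finₚ.punchIn-injective z _ _)
    (trans (h⁻-cell _) (trans (cong h (Finₚ.punchIn-punchOut ne)) e))

  insert : Fin n ⊎ ⊤ → Fin (suc n)
  insert = [ punchIn z , (λ _ → z) ]′

  extract : Fin (suc n) → Fin n ⊎ ⊤
  extract u with z Finₚ.≟ u
  ... | yes _ = inj₂ tt
  ... | no ne = inj₁ (punchOut ne)

  insert-extract : ∀ u → insert (extract u) ≡ u
  insert-extract u with z Finₚ.≟ u
  ... | yes e = e
  ... | no ne = Finₚ.punchIn-punchOut ne

  extract-insert : ∀ x → extract (insert x) ≡ x
  extract-insert (inj₁ u) with z Finₚ.≟ punchIn z u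
  ... | yes e = contradiction (sym e) (Finₚ.punchInᵢ≢i z u)
  ... | no ne = cong inj₁ (trans (Finₚ.punchOut-cong z refl) (Finₚ.punchOut-punchIn z))
  extract-insert (inj₂ tt) with z Finₚ.≟ z
  ... | yes _ = refl
  ... | no ne = contradiction refl ne

  -- Shared end of all cases of the induction: once `h⁻` has been rebuilt, only the cell of the
  -- reinserted location is compared with `h z`.
  restore : ∀ {_≟_ E} (g : Fin n ⊎ ⊤ → Maybe (Vec (Fin n ⊎ ⊤) 1)) {L : HasFiniteDomain g} → SameKind E (extent (finStr n h⁻)) →
    (∀ u → g (inj₁ u) ≡ cell inj₁ (h⁻ u)) → h z ≡ cell insert (g (inj₂ tt)) →
    Iso (mkStr (Fin n ⊎ ⊤) _≟_ (g , L) E) (finStr (suc n) h)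
  restore g k e e′ = record
    { to = insert ; from = extract ; to-from = insert-extract ; from-to = extract-insert
    ; to-heap = λ { (inj₁ u) → trans (sym (h⁻-cell u)) (trans (sym (cell-∘ insert inj₁ (h⁻ u))) (cong (cell insert) (sym (e u)))) ; (inj₂ tt) → e′ }
    ; kind = recast k }
    where
    recast : ∀ {E} → SameKind E (extent (finStr n h⁻)) → SameKind E (extent (finStr (suc n) h))
    recast finite = finite

bin-swap : ∀ P Q → Iso (str P ⊎ₛ str Q) (str Q ⊎ₛ str P)
bin-swap P Q = record
  { to = Sum.swap ; from = Sum.swap ; to-from = Sumₚ.swap-involutive ; from-to = Sumₚ.swap-involutive
  ; to-heap = [ (λ a → sym (cell-∘ Sum.swap inj₁ (hp (str P) a))) , (λ b → sym (cell-∘ Sum.swap inj₂ (hp (str Q) b))) ]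
  ; kind = swapped (extent (str P)) (extent (str Q)) }
  where
  swapped : ∀ {A B : Set} (E : Extent A) (F : Extent B) → SameKind (sumExtent E F) (sumExtent F E)
  swapped (finite _ _) (finite _ _) = finite
  swapped (finite _ _) infinite = infinite
  swapped infinite (finite _ _) = infinite
  swapped infinite infinite = infinite

-- The unallocated last point is what `leaf-exists` asks for, and it remains available when a leaf
-- other than `x` is removed.
GeneratedAt : ℕ → Set
GeneratedAt n = ∀ (h : Cells n) y x → h x ≡ nothing → Generated (mkPointed (finStr n h) y x)

-- If `y` points to `y′`, cutting this edge makes `y` unallocated; the hypothesis applies with
-- points `y′` and `y`, and `close` restores the edge. This covers total functions, at the price
-- that the last point cannot be prescribed.
generated-first : ∀ {n} → GeneratedAt n → ∀ (h : Cells n) y → Σ (Fin n) λ x → Generated (mkPointed (finStr n h) y x)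
generated-first {n} gen h y = y , case-cell (h y) refl
  where
  case-cell : ∀ c → h y ≡ c → Generated (mkPointed (finStr n h) y y)
  case-cell nothing hy = gen h y y hy
  case-cell (just (y′ ∷ [])) hy = close (proj₁ IH) , PIso-trans (PIso-close (proj₂ IH)) (mkPIso (record
      { to = id ; from = id ; to-from = λ _ → refl ; from-to = λ _ → refl ; to-heap = to-heap ; kind = finite }) refl refl)
    where
    h° : Cells n
    h° u = keep (¬? (u Finₚ.≟ y)) (h u)
    IH : Generated (mkPointed (finStr n h°) y′ y)
    IH = gen h° y′ y (keep-no (¬? (y Finₚ.≟ y)) (λ ne → ne refl))
    to-heap : ∀ u → h u ≡ cell id (hp (set (finStr n h°) y y′) u)
    to-heap u with u Finₚ.≟ y
    ... | yes refl = hy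
    ... | no ne = trans (sym (cell-id (h u))) (cong (cell id) (sym (keep-yes (¬? (u Finₚ.≟ y)) ne)))

generated-step : ∀ {n} → GeneratedAt (suc n) → GeneratedAt (suc (suc n))
generated-step {n} gen h y x hx with leaf-exists h x hx
... | z , lf with z Finₚ.≟ x | z Finₚ.≟ y
-- Being unallocated and without predecessor, `z` is isolated and supplies both points. The rest may
-- have no unallocated location, hence `generated-first`.
...   | yes refl | yes refl =
  let x₀ , t , I = generated-first gen h⁻ zero
  in bin nothing true sing t , PIso-trans (PIso-bin nothing true PIso-refl I) (mkPIso
    (Iso-trans (bin-swap singₚ (mkPointed (finStr (suc n) h⁻) zero x₀)) (restore _ finite (λ _ → refl) hx)) refl refl)
  where open Removal h z lf
...   | yes refl | no z≢y =
  let x₀ , t , I = generated-first gen h⁻ (punchOut z≢y)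
  in bin nothing false sing t , PIso-trans (PIso-bin nothing false (PIso-refl {singₚ}) I) (mkPIso
    (Iso-trans (bin-swap singₚ (mkPointed (finStr (suc n) h⁻) (punchOut z≢y) x₀)) (restore _ finite (λ _ → refl) hx)) (Finₚ.punchIn-punchOut z≢y) refl)
  where open Removal h z lf
...   | no z≢x | no z≢y = case-cell (h z) refl
  where
  open Removal h z lf
  IH : Generated (mkPointed (finStr (suc n) h⁻) (punchOut z≢y) (punchOut z≢x))
  IH = gen h⁻ (punchOut z≢y) (punchOut z≢x) (h⁻-nothing z≢x hx)
  case-cell : ∀ c → h z ≡ c → Generated (mkPointed (finStr (suc (suc n)) h) y x)
  case-cell nothing hz = bin nothing true (proj₁ IH) sing , PIso-trans (PIso-bin nothing true (proj₂ IH) PIso-refl) (mkPIso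
    (restore _ finite (λ _ → refl) hz) (Finₚ.punchIn-punchOut z≢y) (Finₚ.punchIn-punchOut z≢x))
  case-cell (just (w ∷ [])) hz with z Finₚ.≟ w
  ... | yes refl = contradiction hz (lf z)
  -- Both `y` and `x` must remain the points, while `w` may be neither of them, so the edge has to
  -- be grafted.
  ... | no z≢w with graft (proj₁ IH) (Iso.from (iso (proj₂ IH)) (punchOut z≢w))
  ...   | t′ , J = t′ , PIso-trans (PIso-sym J) (PIso-trans (PIso-leaf (proj₂ IH) (punchOut z≢w)) (mkPIso
    (restore _ finite (λ _ → refl) (trans hz (cong (just ∘ (_∷ [])) (sym (Finₚ.punchIn-punchOut z≢w)))))
    (Finₚ.punchIn-punchOut z≢y) (Finₚ.punchIn-punchOut z≢x)))
...   | no z≢x | yes refl = case-cell (h z) refl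
  where
  open Removal h z lf
  case-cell : ∀ c → h z ≡ c → Generated (mkPointed (finStr (suc (suc n)) h) z x)
  case-cell nothing hz with gen h⁻ (punchOut z≢x) (punchOut z≢x) (h⁻-nothing z≢x hx)
  ... | t , I = bin nothing false t sing , PIso-trans (PIso-bin nothing false I PIso-refl) (mkPIso
    (restore _ finite (λ _ → refl) hz) refl (Finₚ.punchIn-punchOut z≢x))
  case-cell (just (w ∷ [])) hz with z Finₚ.≟ w
  ... | yes refl = contradiction hz (lf z)
  -- The first point is about to become `z`, so the hypothesis may use that place for the target
  -- `w`.
  ... | no z≢w with gen h⁻ (punchOut z≢w) (punchOut z≢x) (h⁻-nothing z≢x hx)
  ...   | t , I = bin (just false) false t sing , PIso-trans (PIso-bin (just false) false I PIso-refl) (mkPIso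
    (restore _ finite (λ _ → refl) (trans hz (cong (just ∘ (_∷ [])) (sym (Finₚ.punchIn-punchOut z≢w)))))
    refl (Finₚ.punchIn-punchOut z≢x))

generated : ∀ n → GeneratedAt n
generated (suc zero) h zero zero hx = sing , mkPIso (record
  { to = λ _ → zero ; from = λ _ → tt ; to-from = λ { zero → refl } ; from-to = λ _ → refl ; to-heap = λ _ → hx ; kind = finite }) refl refl
generated (suc (suc n)) = generated-step (generated (suc n))

-- The decision procedures

nobody : ∀ {U : Set} → Fin 0 → U
nobody ()

nowhere : Store (Fin 0)
nowhere _ = nothing

lookup-injective : ∀ {xs : List A} → Unique xs → ∀ {i j} → List.lookup xs i ≡ List.lookup xs j → i ≡ j
lookup-injective {xs = _ ∷ _} (_ ∷ _) {zero} {zero} _ = refl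
lookup-injective {xs = _ ∷ xs} u@(_ ∷ _) {zero} {suc j} e =
  contradiction (subst (_∈ xs) (sym e) (∈ₚ.∈-lookup j)) (Uniqueₚ.Unique[x∷xs]⇒x∉xs u)
lookup-injective {xs = _ ∷ xs} u@(_ ∷ _) {suc i} {zero} e =
  contradiction (subst (_∈ xs) e (∈ₚ.∈-lookup i)) (Uniqueₚ.Unique[x∷xs]⇒x∉xs u)
lookup-injective {xs = _ ∷ _} (_ ∷ u) {suc i} {suc j} e = cong suc (lookup-injective u e)

listed⇒IsFinite : DecidableEquality A → (xs : List A) → (∀ u → u ∈ xs) → IsFinite A
listed⇒IsFinite _≟_ xs all = length ys , mk↔ₛ′ (List.lookup ys) index
    (λ u → sym (Anyₚ.lookup-index (mem u))) (λ i → lookup-injective (DecUniqueₚ.deduplicate-! _≟_ xs) (sym (Anyₚ.lookup-index (mem _))))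
  where
  ys = deduplicate _≟_ xs
  mem : ∀ u → u ∈ ys
  mem u = ∈ₚ.∈-deduplicate⁺ _≟_ (all u)
  index : _ → Fin (length ys)
  index u = Any.index (mem u)

↔-injective : ∀ {n} (I : Fin n ↔ A) {x y} → Inverse.from I x ≡ Inverse.from I y → x ≡ y
↔-injective I {x} {y} e = trans (sym (Inverse.strictlyInverseˡ I x)) (trans (cong (Inverse.to I) e) (Inverse.strictlyInverseˡ I y))

IsFinite⇒Countable : IsFinite A → Countable A
IsFinite⇒Countable (n , I) = toℕ ∘ Inverse.from I , ↔-injective I ∘ Finₚ.toℕ-injective

Countable⇒≟ : Countable A → DecidableEquality A
Countable⇒≟ (f , inj) x y = map′ inj (cong f) (f x ℕ.≟ f y)

fresh-ℕ : ∀ xs → Σ ℕ (_∉ xs)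
fresh-ℕ xs = suc (sum xs) , λ p → ℕₚ.n≮n _ (≤sum p)
  where
  ≤sum : ∀ {x xs} → x ∈ xs → x ≤ sum xs
  ≤sum {x} (here refl) = ℕₚ.m≤m+n x _
  ≤sum {xs = y ∷ _} (there p) = ℕₚ.≤-trans (≤sum p) (ℕₚ.m≤n+m _ y)

-- A value of a term has points, so the empty universe needs a code of its own.
Code : Set
Code = Maybe Tm

decode : Code → Str
decode nothing = finStr 0 λ ()
decode (just t) = str (value t)

search-decode : ∀ c → Searchable (Carrier (decode c))
search-decode nothing = search-Fin
search-decode (just t) = search-value t

value-listed : ∀ t → Σ _ λ xs → Σ _ λ all → extent (str (value t)) ≡ finite xs all
value-listed sing = -, -, refl
value-listed (bin b s t t′) with extent (str (value t)) | extent (str (value t′)) | value-listed t | value-listed t′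
... | _ | _ | _ , _ , refl | _ , _ , refl = -, -, refl
value-listed (close t) = value-listed t

decode-listed : ∀ c → Σ _ λ xs → Σ _ λ all → extent (decode c) ≡ finite xs all
decode-listed nothing = -, -, refl
decode-listed (just t) = value-listed t

decode-IsFinite : ∀ c → IsFinite (Carrier (decode c))
decode-IsFinite c = let xs , all , _ = decode-listed c in listed⇒IsFinite (Str._≟_ (decode c)) xs all

pure : (U : Set) → DecidableEquality U → Str
pure U _≟_ = mkStr U _≟_ ((λ _ → nothing) , [] , λ _ n → contradiction refl n) infinite

-- A finite carrier with enough locations stands for the infinitely many isolated ones.
pseudo : ℕ → Code → Str
pseudo K c = decode c ⊎ₛ pure (Fin K) Finₚ._≟_

genuine : Code → Str
genuine c = decode c ⊎ₛ pure ℕ ℕ._≟_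

module Decide {φ : Form 1} (p : Prenex φ) (sc : Sentence φ) where

  N n : ℕ
  N = bound p
  n = depth p

  codes : List Code
  codes = nothing ∷ List.map just (Representatives.representatives N n)

  Sat : Str → Set
  Sat S = ev S p (nobody {Carrier S}) nowhere

  nobody-injective : ∀ {U : Set} → Injective _≡_ _≡_ (nobody {U})
  nobody-injective {_} {()}

  real : ∀ S → Truthful (extent S) → ∀ {s} → ((Carrier S , s , heap S ⊨ φ) → Sat S) × (Sat S → Carrier S , s , heap S ⊨ φ)
  real S truth {s} = ev-correct S truth p {s = s} nobody-injective sc (λ ())

  module _ (𝓜 : Modality) where
    open Modality 𝓜
    open Game 𝓜 N
    open GameLemmas 𝓜 N

    _≃_ : Str → Str → Set
    S ≃ T = EF n S nobody T nobody

    ≃-iso : ∀ {S T} → Iso S T → S ≃ T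
    ≃-iso I = EF-iso n I λ ()

    ≃-⊎ : ∀ {S S′ T T′} → S ≃ S′ → T ≃ T′ → (S ⊎ₛ T) ≃ (S′ ⊎ₛ T′)
    ≃-⊎ {S} {S′} {T} {T′} E F = EF-reindex n {S ⊎ₛ T} {S′ ⊎ₛ T′} (λ ()) (EF-sum n {S} {S′} {T} {T′} E F)

    ≃-pure : ∀ {U V : Set} {_≟U_ _≟V_} → Supply n U → Supply n V → pure U _≟U_ ≃ pure V _≟V_
    ≃-pure s t = EF-pure n (λ _ → refl) (λ _ → refl) refl refl s t ℕₚ.≤-refl (λ {}) (λ {})

    transfer : ∀ {S T} → S ≃ T → Sat S → M (Sat T)
    transfer {S} {T} E = EF-ev p ℕₚ.≤-refl {S} {T} nobody-injective nobody-injective E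

    coded : ∀ k (h : Cells k) → Σ Code λ c → c ∈ codes × finStr k h ≃ decode c
    coded zero h = nothing , here refl , ≃-iso {finStr 0 h} (record
      { to = id ; from = id ; to-from = λ _ → refl ; from-to = λ _ → refl ; to-heap = λ () ; kind = finite })
    -- The choice of first point is arbitrary: points serve the construction and are dropped
    -- afterwards by `EF-reindex`.
    coded (suc k) h with generated-first (generated (suc k)) h zero
    ... | x , t , I with Representatives.represented N n 𝓜 t
    ... | t′ , t′∈ , E = just t′ , there (∈ₚ.∈-map⁺ just t′∈) ,
      EF-trans n {finStr (suc k) h} {str (value t)} {str (value t′)} (≃-iso (Iso-sym (iso I)))
        (EF-reindex n {str (value t)} {str (value t′)} (λ ()) E)

    -- If every location were named, picking a name for each would inject `Fin K` into `Fin m`.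
    supply-Fin : ∀ K → Supply K (Fin K)
    supply-Fin K {m} c m<K with Finₚ.any? (Locations.fresh? Finₚ._≟_ c)
    ... | yes f = return f
    ... | no ¬fr = contradiction (Finₚ.injective⇒≤ {f = proj₁ ∘ index} index-injective) (ℕₚ.<⇒≱ m<K)
      where
      index : ∀ u → Σ (Fin m) λ i → c i ≡ u
      index u = [ id , (λ f → contradiction (u , f) ¬fr) ]′ (Locations.named? Finₚ._≟_ c u)
      index-injective : Injective _≡_ _≡_ (proj₁ ∘ index)
      index-injective {x} {y} e = trans (sym (proj₂ (index x))) (trans (cong c e) (proj₂ (index y)))

    supply-ℕ : ∀ K → Supply K ℕ
    supply-ℕ K c _ = return (let u , u∉ = fresh-ℕ (List.tabulate c) in u , λ i e → u∉ (subst (_∈ List.tabulate c) e (∈ₚ.∈-tabulate⁺ i)))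

  finite-complete : FinSat φ → Any.Any (Sat ∘ decode) codes
  finite-complete (U , C , (k , I) , s , H , sat) =
    let c , c∈ , E = coded identity k h
    in lose c∈ (transfer identity (EF-trans n {S} {finStr k h} {decode c} (≃-iso identity iso′) E) (proj₁ (real S tt {s}) sat))
    where
    open Game identity N
    open Inverse I using (to; from; strictlyInverseˡ; strictlyInverseʳ)
    S : Str
    S = mkStr U (Countable⇒≟ C) H (finite (List.map to (allFin k))
      (λ u → subst (_∈ _) (strictlyInverseˡ u) (∈ₚ.∈-map⁺ to (∈ₚ.∈-allFin (from u)))))
    h : Cells k
    h i = cell from (app H (to i))
    iso′ : Iso S (finStr k h)
    iso′ = record { to = from ; from = to ; to-from = strictlyInverseʳ ; from-to = strictlyInverseˡ
      ; to-heap = λ u → cong (cell from ∘ app H) (strictlyInverseˡ u) ; kind = finite }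

  finite-sound : ∀ c → Sat (decode c) → FinSat φ
  finite-sound c sat = Carrier (decode c) , IsFinite⇒Countable (decode-IsFinite c) , decode-IsFinite c ,
    (λ _ → nothing) , heap (decode c) , proj₂ (real (decode c) truth) sat
    where
    truth : Truthful (extent (decode c))
    truth with extent (decode c) | decode-listed c
    ... | _ | _ , _ , refl = tt

  finite? : Dec (FinSat φ)
  finite? = map′ (λ any → let c , sat = Any.satisfied any in finite-sound c sat) finite-complete
    (Any.any? (λ c → ev? (decode c) (search-decode c) p nobody nowhere) codes)

  -- Infinite models: the support of a heap and the isolated remainder

  module Support {U : Set} (C : Countable U) (H : Heap U 1) where

    _≟_ : DecidableEquality U
    _≟_ = Countable⇒≟ C

    open import Data.List.Membership.DecPropositional _≟_ using (_∈?_)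

    target : Maybe (Vec U 1) → List U
    target nothing = []
    target (just (v ∷ [])) = v ∷ []

    -- Targets are included, so that the heap restricts to a partial self-map of the support and
    -- every other location is isolated.
    raw support : List U
    raw = proj₁ (proj₂ H) ++ List.concatMap (target ∘ app H) (proj₁ (proj₂ H))
    support = deduplicate _≟_ raw

    support-unique : Unique support
    support-unique = DecUniqueₚ.deduplicate-! _≟_ raw

    allocated∈ : ∀ {u} → app H u ≢ nothing → u ∈ support
    allocated∈ n = ∈ₚ.∈-deduplicate⁺ _≟_ (∈ₚ.∈-++⁺ˡ (proj₂ (proj₂ H) _ n))

    target∈ : ∀ {u v} → app H u ≡ just (v ∷ []) → v ∈ support
    target∈ {u} {v} e = ∈ₚ.∈-deduplicate⁺ _≟_ (∈ₚ.∈-++⁺ʳ (proj₁ (proj₂ H)) (∈ₚ.∈-concatMap⁺ (target ∘ app H)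
      (lose (proj₂ (proj₂ H) u (λ n → case trans (sym e) n of λ ())) (subst (λ x → v ∈ target x) (sym e) (here refl)))))

    k : ℕ
    k = length support

    retract : ∀ x → (∀ {v} → x ≡ just (v ∷ []) → v ∈ support) → Σ (Maybe (Vec (Fin k) 1)) λ y → x ≡ cell (List.lookup support) y
    retract nothing _ = nothing , refl
    retract (just (v ∷ [])) m = just (Any.index (m refl) ∷ []) , cong (just ∘ (_∷ [])) (Anyₚ.lookup-index (m refl))

    h : Cells k
    h i = proj₁ (retract (app H (List.lookup support i)) target∈)

    -- `False` of a decision has at most one proof, so equality in the complement is equality in
    -- `U`.
    Rest : Set
    Rest = Σ U λ u → False (u ∈? support)

    Rest-≡ : ∀ {x y : Rest} → proj₁ x ≡ proj₁ y → x ≡ y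
    Rest-≡ {u , a} {_ , b} refl = cong (u ,_) (irrelevant (u ∈? support) a b)
      where
      irrelevant : ∀ {X : Set} (d : Dec X) (a b : False d) → a ≡ b
      irrelevant (no _) _ _ = refl

    _≟R_ : DecidableEquality Rest
    x ≟R y = map′ Rest-≡ (cong proj₁) (proj₁ x ≟ proj₁ y)

    iso′ : Iso (finStr k h ⊎ₛ pure Rest _≟R_) (mkStr U _≟_ H infinite)
    iso′ = record { to = to ; from = from ; to-from = to-from ; from-to = λ x → to-injective _ _ (to-from (to x)) ; to-heap = to-heap ; kind = infinite }
      where
      to : Fin k ⊎ Rest → U
      to = [ List.lookup support , proj₁ ]′
      from : U → Fin k ⊎ Rest
      from u with u ∈? support
      ... | yes u∈ = inj₁ (Any.index u∈)
      ... | no u∉ = inj₂ (u , fromWitnessFalse {a? = u ∈? support} u∉)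
      to-from : ∀ u → to (from u) ≡ u
      to-from u with u ∈? support
      ... | yes u∈ = sym (Anyₚ.lookup-index u∈)
      ... | no _ = refl
      to-injective : ∀ x y → to x ≡ to y → x ≡ y
      to-injective (inj₁ i) (inj₁ j) e = cong inj₁ (lookup-injective support-unique e)
      to-injective (inj₁ i) (inj₂ (_ , f)) refl = contradiction (∈ₚ.∈-lookup i) (toWitnessFalse f)
      to-injective (inj₂ (_ , f)) (inj₁ i) refl = contradiction (∈ₚ.∈-lookup i) (toWitnessFalse f)
      to-injective (inj₂ x) (inj₂ y) e = cong inj₂ (Rest-≡ e)
      to-heap : ∀ x → app H (to x) ≡ cell to (hp (finStr k h ⊎ₛ pure Rest _≟R_) x)
      to-heap (inj₁ i) = trans (proj₂ (retract (app H (List.lookup support i)) target∈)) (sym (cell-∘ to inj₁ (h i)))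
      to-heap (inj₂ (u , f)) = decidable-stable (nothing? _) (λ a → toWitnessFalse f (allocated∈ a))

    supply-Rest : Truthful (infinite {U}) → ∀ K → GameLemmas.Supply doubleNegation N K Rest
    supply-Rest truth K c _ f = truth (support ++ List.map proj₁ (List.tabulate c)) λ (u , u∉) →
      f ((u , fromWitnessFalse (u∉ ∘ ∈ₚ.∈-++⁺ˡ)) ,
        λ i e → u∉ (∈ₚ.∈-++⁺ʳ support (subst (_∈ List.map proj₁ (List.tabulate c)) (cong proj₁ e) (∈ₚ.∈-map⁺ proj₁ (∈ₚ.∈-tabulate⁺ i)))))

  infinite-complete : InfSat φ → ¬¬ Any.Any (Sat ∘ pseudo n) codes
  infinite-complete (U , C , inf , s , H , sat) f =
    let c , c∈ , E = coded doubleNegation k h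
    in transfer doubleNegation (EF-trans n {S} {finStr k h ⊎ₛ pure Rest _≟R_} {pseudo n c} (≃-iso doubleNegation (Iso-sym iso′))
      (≃-⊎ doubleNegation {finStr k h} {decode c} {pure Rest _≟R_} {pure (Fin n) Finₚ._≟_} E
        (≃-pure doubleNegation (supply-Rest truth n) (supply-Fin doubleNegation n))))
      (proj₁ (real S truth {s}) sat) (λ x → f (lose c∈ x))
    where
    open Game doubleNegation N
    open Support C H
    open import Data.List.Membership.DecPropositional _≟_ using (_∈?_)
    S : Str
    S = mkStr U _≟_ H infinite
    truth : Truthful (infinite {U})
    -- If no location could lie outside `xs`, decidable membership would make `xs` a listing of `U`.
    truth xs absent = inf (listed⇒IsFinite _≟_ xs λ u → decidable-stable (u ∈? xs) λ u∉ → absent (u , u∉))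

  -- Evaluation under a false declaration is not satisfaction. Game equivalence carries it to the
  -- genuine structure, where it is; the answers there are explicit, so the identity modality is
  -- enough.
  infinite-sound : ∀ c → Sat (pseudo n c) → InfSat φ
  infinite-sound c sat = Carrier (genuine c) , (code , code-injective) , not-finite , (λ _ → nothing) , heap (genuine c) ,
    proj₂ (real (genuine c) truth) (transfer identity {pseudo n c} {genuine c}
      (≃-⊎ identity {decode c} {decode c} {pure (Fin n) Finₚ._≟_} {pure ℕ ℕ._≟_} (≃-iso identity (Iso-refl (SameKind-refl (extent (decode c)))))
        (≃-pure identity (supply-Fin identity n) (supply-ℕ identity n))) sat)
    where
    k = proj₁ (decode-IsFinite c)
    index : Carrier (decode c) → Fin k
    index = Inverse.from (proj₂ (decode-IsFinite c))
    code : Carrier (decode c) ⊎ ℕ → ℕ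
    code (inj₁ a) = toℕ (index a)
    code (inj₂ i) = k + i
    apart : ∀ a i → toℕ (index a) ≢ k + i
    apart a i e = ℕₚ.<⇒≢ (ℕₚ.≤-trans (Finₚ.toℕ<n (index a)) (ℕₚ.m≤m+n k i)) e
    code-injective : Injective _≡_ _≡_ code
    code-injective {inj₁ a} {inj₁ b} e = cong inj₁ (↔-injective (proj₂ (decode-IsFinite c)) (Finₚ.toℕ-injective e))
    code-injective {inj₁ a} {inj₂ i} e = contradiction e (apart a i)
    code-injective {inj₂ i} {inj₁ a} e = contradiction (sym e) (apart a i)
    code-injective {inj₂ i} {inj₂ j} e = cong inj₂ (ℕₚ.+-cancelˡ-≡ k i j e)
    not-finite : IsInfinite (Carrier (genuine c))
    not-finite (m , I) = ℕₚ.n≮n m (Finₚ.injective⇒≤ {f = λ (i : Fin (suc m)) → Inverse.from I (inj₂ (toℕ i))}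
      (λ e → Finₚ.toℕ-injective (Sumₚ.inj₂-injective (↔-injective I e))))
    truth : Truthful (extent (genuine c))
    truth with extent (decode c) | decode-listed c
    ... | _ | _ , _ , refl = λ xs f → let u , u∉ = fresh-ℕ (List.map [ (λ _ → 0) , id ]′ xs) in
      f (inj₂ u , λ p → u∉ (∈ₚ.∈-map⁺ [ (λ _ → 0) , id ]′ p))

  infinite? : Dec (InfSat φ)
  infinite? with Any.any? (λ c → ev? (pseudo n c) (search-⊎ (search-decode c) search-Fin) p nobody nowhere) codes
  ... | yes any = let c , sat = Any.satisfied any in yes (infinite-sound c sat)
  -- A refutation only needs completeness under double negation.
  ... | no ¬any = no (λ sat → infinite-complete sat ¬any)

theorem1 : (∀ (φ : Form 1) → PRE 1 φ → Dec (FinSat φ))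
    × (∀ (φ : Form 1) → PRE 1 φ → Dec (InfSat φ))
theorem1 = (λ φ (p , sc) → Decide.finite? p sc) , (λ φ (p , sc) → Decide.infinite? p sc)
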